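{- Suppose that every claw-free matroid of dimension at most $8$ is even-plane, or has triangle-free complement, or is a strict PG-sum, or has a decomposer. Then every claw-free matroid (of any dimension) is even-plane, or has triangle-free complement, or is a strict PG-sum, or has a decomposer.
   Context: A matroid is a pair $M=(E,G)$ where $G$ is the set of nonzero vectors of a finite-dimensional $\mathbb F_2$-vector space $V(G)=G\cup\{0\}$ and $E\subseteq G$; its dimension is $\dim V(G)$. A flat of $G$ is a set $F\subseteq G$ with $F\cup\{0\}$ a subspace; triangles and planes are flats of dimension $2$ and $3$. $M|F=(E\cap F,F)$. A claw is $(B,G)$ with $\dim G=3$, $B$ a basis; $M$ is claw-free if no $M|F$ is isomorphic (via a linear isomorphism) to a claw. $M$ is even-plane if $|E\cap P|$ is even for every plane $P$. $M^c=(G\setminus E,G)$; triangle-free means the ground set contains no triangle. $M$ is a strict PG-sum if $E$ spans $V(G)$ and $E$ is the union of two disjoint nonempty flats. A coset of a flat $F$ is $x+(F\cup\{0\})$ with $x\in G\setminus F$; it is mixed if it meets both $E$ and $G\setminus E$; a decomposer is a nonempty flat $F\ne G$ with no mixed cosets. -}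

module Defs where

open import Data.Bool using (Bool; true; false; _xor_; _∧_; _∨_; not)
open import Data.Nat using (ℕ; zero; suc; _≤_)
open import Data.Nat.Divisibility using (_∣_)
open import Data.Vec using (Vec; []; _∷_; replicate; zipWith; map)
open import Data.List using (List; []; _∷_; length; filter; foldr; concatMap)
open import Data.List.Relation.Unary.All using (All)
open import Data.List.Relation.Unary.Any using (Any)
open import Data.Product using (Σ; ∃; ∃-syntax; _×_; _,_)
open import Data.Sum using (_⊎_)
open import Relation.Binary.PropositionalEquality using (_≡_; _≢_)
open import Relation.Nullary using (¬_)
open import Function.Bundles using (_⇔_)

-- The vector space F₂ⁿ (every n-dimensional F₂-space is isomorphic to it)

Vect : ℕ → Set
Vect n = Vec Bool n

0v : ∀ {n} → Vect n
0v = replicate _ false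

infixl 6 _⊕_
_⊕_ : ∀ {n} → Vect n → Vect n → Vect n
_⊕_ = zipWith _xor_

allVects : (n : ℕ) → List (Vect n)
allVects zero    = [] ∷ []
allVects (suc n) = concatMap (λ v → (false ∷ v) ∷ (true ∷ v) ∷ []) (allVects n)

Subset : ℕ → Set
Subset n = Vect n → Bool

_∈_ : ∀ {n} → Vect n → Subset n → Set
v ∈ S = S v ≡ true

_∉_ : ∀ {n} → Vect n → Subset n → Set
v ∉ S = S v ≡ false

∣_∣ : ∀ {n} → Subset n → ℕ
∣_∣ {n} S = length (filter (λ v → Data.Bool._≟_ (S v) true) (allVects n))

lincomb : ∀ {n k} → Vec Bool k → Vec (Vect n) k → Vect n
lincomb []       []       = 0v
lincomb (c ∷ cs) (b ∷ bs) = (if c then b else 0v) ⊕ lincomb cs bs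
  where open import Data.Bool using (if_then_else_)

LinIndep : ∀ {n k} → Vec (Vect n) k → Set
LinIndep {k = k} bs = ∀ cs → lincomb cs bs ≡ 0v → cs ≡ replicate k false

InSpan : ∀ {n k} → Vect n → Vec (Vect n) k → Set
InSpan v bs = ∃[ cs ] lincomb cs bs ≡ v

IsSubspace : ∀ {n} → Subset n → Set
IsSubspace S = (0v ∈ S) × (∀ x y → x ∈ S → y ∈ S → (x ⊕ y) ∈ S)

HasDim : ∀ {n} → Subset n → ℕ → Set
HasDim {n} S k = Σ (Vec (Vect n) k) λ bs → LinIndep bs × (∀ v → (v ∈ S) ⇔ InSpan v bs)

with0 : ∀ {n} → Subset n → Subset n
with0 {n} F v = F v ∨ isZero v
  where
  isZero : ∀ {m} → Vect m → Bool
  isZero []       = true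
  isZero (b ∷ bs) = not b ∧ isZero bs

IsFlat : ∀ {n} → Subset n → Set
IsFlat F = (0v ∉ F) × IsSubspace (with0 F)

IsFlatOfDim : ∀ {n} → Subset n → ℕ → Set
IsFlatOfDim F k = IsFlat F × HasDim (with0 F) k

IsTriangle : ∀ {n} → Subset n → Set
IsTriangle F = IsFlatOfDim F 2

IsPlane : ∀ {n} → Subset n → Set
IsPlane F = IsFlatOfDim F 3

-- Matroids M = (E, G) with G = F₂ⁿ ∖ {0}, of dimension n

record Matroid (n : ℕ) : Set where
  field
    E    : Subset n
    E⊆G  : 0v ∉ E
open Matroid public

_∩_ : ∀ {n} → Subset n → Subset n → Subset n
(A ∩ B) v = A v ∧ B v

-- M|F is (linearly) isomorphic to a claw: F is a plane and E ∩ F is a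
-- basis of F ∪ {0}
RestrictionIsClaw : ∀ {n} → Matroid n → Subset n → Set
RestrictionIsClaw {n} M F =
  IsPlane F ×
  Σ (Vec (Vect n) 3) λ bs →
    LinIndep bs × (∀ v → (v ∈ with0 F) ⇔ InSpan v bs)
               × (∀ v → (v ∈ (E M ∩ F)) ⇔ Data.Vec.Membership.Propositional._∈_ v bs)
  where import Data.Vec.Membership.Propositional

ClawFree : ∀ {n} → Matroid n → Set
ClawFree M = ∀ F → IsFlat F → ¬ RestrictionIsClaw M F

EvenPlane : ∀ {n} → Matroid n → Set
EvenPlane M = ∀ P → IsPlane P → 2 ∣ ∣ E M ∩ P ∣

Ec : ∀ {n} → Matroid n → Subset n
Ec M v = not (E M v) ∧ not (with0 (λ _ → false) v)

TriangleFreeComplement : ∀ {n} → Matroid n → Set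
TriangleFreeComplement M = ∀ T → IsTriangle T → ¬ (∀ v → v ∈ T → v ∈ Ec M)

Spans : ∀ {n} → Subset n → Set
Spans {n} S = ∀ (v : Vect n) → ∃[ xs ] (All (_∈ S) xs × foldr _⊕_ 0v xs ≡ v)

StrictPGSum : ∀ {n} → Matroid n → Set
StrictPGSum {n} M =
  Spans (E M) ×
  ∃[ F₁ ] ∃[ F₂ ] (IsFlat F₁ × IsFlat F₂
    × (∃[ v ] v ∈ F₁) × (∃[ v ] v ∈ F₂)
    × (∀ v → ¬ (v ∈ F₁ × v ∈ F₂))
    × (∀ v → (v ∈ E M) ⇔ (v ∈ F₁ ⊎ v ∈ F₂)))

coset : ∀ {n} → Subset n → Vect n → Subset n
coset F x v = with0 F (v ⊕ x)

MixedCoset : ∀ {n} → Matroid n → Subset n → Vect n → Set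
MixedCoset M F x = (∃[ y ] (y ∈ coset F x × y ∈ E M))
                 × (∃[ z ] (z ∈ coset F x × z ∈ Ec M))

IsDecomposer : ∀ {n} → Matroid n → Subset n → Set
IsDecomposer M F =
  IsFlat F × (∃[ v ] v ∈ F) × (∃[ v ] (v ≢ 0v × v ∉ F))
  × (∀ x → x ≢ 0v → x ∉ F → ¬ MixedCoset M F x)

HasDecomposer : ∀ {n} → Matroid n → Set
HasDecomposer M = ∃[ F ] IsDecomposer M F

Outcome : ∀ {n} → Matroid n → Set
Outcome M = EvenPlane M ⊎ TriangleFreeComplement M ⊎ StrictPGSum M ⊎ HasDecomposer M

{-# OPTIONS --safe #-}
module Submission where

-- Write f for the indicator of E on V = F₂ⁿ and suppose that there is no decomposer.
-- Suppose first that E contains no PG-sum of two triangles.  An anti-claw (a plane whose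
-- non-elements form a basis) exists, because in a claw-free and anti-claw-free space E or
-- its complement fails to span.  Grow it to a maximal decomposer-free subspace U without
-- empty triangles: every coset of U is constant or a copy of f on U, the centres of the
-- copies form a subspace Z, and unless U = V one of U + Z and Z is a decomposer.
-- Otherwise take a maximal PG-sum U = A + B of two flats.  Every coset of U is constant or
-- has a centre d with f (d + u) = f u + c for all u ≠ 0.  Again the centres form a complement
-- of U, so either V = U is a strict PG-sum, or some c is 1; then A and B are two-dimensional
-- and f is the sum of quadratic forms on U and on the centres, hence even on planes.

open import Defs
open import Data.Bool using (Bool; true; false; _xor_; _∧_; _∨_; not; if_then_else_)
open import Data.Bool.Properties using (xor-comm; xor-assoc; xor-same; xor-identityʳ; not-involutive; ∧-identityʳ; ∧-zeroʳ)
open import Data.Empty using (⊥; ⊥-elim)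
open import Data.Fin using (Fin; zero; suc)
open import Data.List using (List; []; _∷_; length; filter; foldr; concatMap)
open import Data.List.Relation.Unary.All using (All; []; _∷_)
open import Data.List.Relation.Unary.Any using (Any; here; there; any?)
open import Data.Maybe using (Maybe; just; nothing)
open import Data.Nat using (ℕ; zero; suc; _≤_; _<_; _+_; s≤s; z≤n)
open import Data.Nat.Divisibility using (_∣_; divides)
open import Data.Nat.Properties using (+-mono-≤; +-mono-<-≤; +-mono-≤-<; ≤-refl; <-≤-trans)
open import Data.Product using (∃-syntax; ∃; _×_; _,_; proj₁; proj₂)
open import Data.Sum using (_⊎_; inj₁; inj₂; [_,_]′)
open import Data.Vec using (Vec; []; _∷_; lookup; zipWith; _++_; _[_]≔_)
open import Data.Vec.Properties using (zipWith-comm; zipWith-assoc; zipWith-identityˡ; zipWith-identityʳ; ≡-dec)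
open import Function using (_∘_)
open import Function.Bundles using (_⇔_; mk⇔; Equivalence)
open import Relation.Binary.PropositionalEquality using (_≡_; _≢_; refl; sym; trans; cong; cong₂; subst; setoid; module ≡-Reasoning)
open import Relation.Nullary using (¬_; Dec; yes; no; does)
open import Relation.Nullary.Decidable using (_×-dec_; _→-dec_; map′; dec-true; dec-false; ¬?)
import Data.Bool as B
import Data.Fin as F
import Data.Vec.Relation.Unary.Any as VAny
import Relation.Binary.Reflection as Reflection

-- Constant cosets and copies are what stops an indecomposable subspace `U` from staying
-- indecomposable when a vector `x` is adjoined. A decomposer of the larger space either contains
-- `U`, and then `x + U` is constant, or meets `U` only in 0, and then its nonzero vector lies in
-- `x + U` and is the centre of a copy of `f` on `U`. Indecomposability also makes such a centre
-- unique in its coset. An anti-claw is the seed because its span is indecomposable, has no empty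
-- triangle and keeps enough zeros at hand to build claws. The case split has its origin in the
-- growth of `U`: where an empty triangle or a pair of centres has the wrong values around it, these
-- values form a PG-sum of two triangles. On a coset of a PG-sum `A + B` the values form a grid
-- indexed by `A` and `B`. Claw-freeness leaves constant grids, a single row or column of ones,
-- which enlarges the PG-sum, and crosses around a centre.

private
  variable
    n k : ℕ

-- Linear algebra over F₂

⊕-comm : (x y : Vect n) → x ⊕ y ≡ y ⊕ x
⊕-comm = zipWith-comm xor-comm

⊕-assoc : (x y z : Vect n) → (x ⊕ y) ⊕ z ≡ x ⊕ (y ⊕ z)
⊕-assoc = zipWith-assoc xor-assoc

⊕-identityˡ : (x : Vect n) → 0v ⊕ x ≡ x
⊕-identityˡ = zipWith-identityˡ (λ _ → refl)

⊕-identityʳ : (x : Vect n) → x ⊕ 0v ≡ x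
⊕-identityʳ = zipWith-identityʳ xor-identityʳ

⊕-self : (x : Vect n) → x ⊕ x ≡ 0v
⊕-self []       = refl
⊕-self (b ∷ bs) = cong₂ _∷_ (xor-same b) (⊕-self bs)

⊕-interchange : (a b c d : Vect n) → (a ⊕ b) ⊕ (c ⊕ d) ≡ (a ⊕ c) ⊕ (b ⊕ d)
⊕-interchange a b c d = begin
  (a ⊕ b) ⊕ (c ⊕ d) ≡⟨ ⊕-assoc a b (c ⊕ d) ⟩
  a ⊕ (b ⊕ (c ⊕ d)) ≡⟨ cong (a ⊕_) (sym (⊕-assoc b c d)) ⟩
  a ⊕ ((b ⊕ c) ⊕ d) ≡⟨ cong (λ t → a ⊕ (t ⊕ d)) (⊕-comm b c) ⟩
  a ⊕ ((c ⊕ b) ⊕ d) ≡⟨ cong (a ⊕_) (⊕-assoc c b d) ⟩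
  a ⊕ (c ⊕ (b ⊕ d)) ≡⟨ sym (⊕-assoc a c (b ⊕ d)) ⟩
  (a ⊕ c) ⊕ (b ⊕ d) ∎
  where open ≡-Reasoning

lincomb-0 : (ρ : Vec (Vect n) k) → lincomb 0v ρ ≡ 0v
lincomb-0 []      = refl
lincomb-0 (b ∷ ρ) = trans (⊕-identityˡ _) (lincomb-0 ρ)

lincomb-⊕ : (cs ds : Vect k) (ρ : Vec (Vect n) k) → lincomb (cs ⊕ ds) ρ ≡ lincomb cs ρ ⊕ lincomb ds ρ
lincomb-⊕ []       []       []      = sym (⊕-identityˡ 0v)
lincomb-⊕ (c ∷ cs) (d ∷ ds) (b ∷ ρ) =
  trans (cong₂ _⊕_ (scale c d) (lincomb-⊕ cs ds ρ)) (⊕-interchange _ _ _ _)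
  where
  scale : ∀ c d → (if c xor d then b else 0v) ≡ (if c then b else 0v) ⊕ (if d then b else 0v)
  scale true  true  = sym (⊕-self b)
  scale true  false = sym (⊕-identityʳ b)
  scale false true  = sym (⊕-identityˡ b)
  scale false false = sym (⊕-identityˡ 0v)

unit : Fin k → Vect k
unit i = 0v [ i ]≔ true

lincomb-unit : (i : Fin k) (ρ : Vec (Vect n) k) → lincomb (unit i) ρ ≡ lookup ρ i
lincomb-unit zero    (b ∷ ρ) = trans (cong (b ⊕_) (lincomb-0 ρ)) (⊕-identityʳ b)
lincomb-unit (suc i) (b ∷ ρ) = trans (⊕-identityˡ _) (lincomb-unit i ρ)

data Exp (k : ℕ) : Set where
  var : Fin k → Exp k
  _:⊕_ : Exp k → Exp k → Exp k
  :0 : Exp k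

infixr 6 _:⊕_

⟦_⟧ : Exp k → Vec (Vect n) k → Vect n
⟦ var i ⟧   ρ = lookup ρ i
⟦ e :⊕ e' ⟧ ρ = ⟦ e ⟧ ρ ⊕ ⟦ e' ⟧ ρ
⟦ :0 ⟧      ρ = 0v

-- Normal form of the reflective solver: an F₂-linear expression is determined by its coefficient
-- vector, so an identity holds by `refl` once both sides have the same coefficients.
coeffs : Exp k → Vect k
coeffs (var i)   = unit i
coeffs (e :⊕ e') = coeffs e ⊕ coeffs e'
coeffs :0        = 0v

coeffs-correct : (e : Exp k) (ρ : Vec (Vect n) k) → lincomb (coeffs e) ρ ≡ ⟦ e ⟧ ρ
coeffs-correct (var i)   ρ = lincomb-unit i ρ
coeffs-correct (e :⊕ e') ρ =
  trans (lincomb-⊕ (coeffs e) (coeffs e') ρ) (cong₂ _⊕_ (coeffs-correct e ρ) (coeffs-correct e' ρ))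
coeffs-correct :0        ρ = lincomb-0 ρ

module Solver {n : ℕ} =
  Reflection (setoid (Vect n)) var ⟦_⟧ (λ e → lincomb (coeffs e)) coeffs-correct
open Solver using (solve)

infix 4 _⊜_
_⊜_ : Exp k → Exp k → Exp k × Exp k
_⊜_ = _,_

-- The same linear combination without zero summands, so that for concrete
-- coefficients it computes to b₁ ⊕ (b₂ ⊕ …).
mutual
  ⨁ : Vect k → Vec (Vect n) k → Vect n
  ⨁ []           []      = 0v
  ⨁ (false ∷ cs) (_ ∷ ρ) = ⨁ cs ρ
  ⨁ (true ∷ cs)  (b ∷ ρ) = ⨁⁺ b cs ρ

  ⨁⁺ : Vect n → Vect k → Vec (Vect n) k → Vect n
  ⨁⁺ b []           []       = b
  ⨁⁺ b (false ∷ cs) (_ ∷ ρ)  = ⨁⁺ b cs ρ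
  ⨁⁺ b (true ∷ cs)  (b' ∷ ρ) = b ⊕ ⨁⁺ b' cs ρ

mutual
  ⨁≡lincomb : (cs : Vect k) (ρ : Vec (Vect n) k) → ⨁ cs ρ ≡ lincomb cs ρ
  ⨁≡lincomb []           []      = refl
  ⨁≡lincomb (false ∷ cs) (_ ∷ ρ) = trans (⨁≡lincomb cs ρ) (sym (⊕-identityˡ _))
  ⨁≡lincomb (true ∷ cs)  (b ∷ ρ) = ⨁⁺≡lincomb b cs ρ

  ⨁⁺≡lincomb : (b : Vect n) (cs : Vect k) (ρ : Vec (Vect n) k) → ⨁⁺ b cs ρ ≡ b ⊕ lincomb cs ρ
  ⨁⁺≡lincomb b []           []       = sym (⊕-identityʳ b)
  ⨁⁺≡lincomb b (false ∷ cs) (_ ∷ ρ)  = trans (⨁⁺≡lincomb b cs ρ) (cong (b ⊕_) (sym (⊕-identityˡ _)))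
  ⨁⁺≡lincomb b (true ∷ cs)  (b' ∷ ρ) = cong (b ⊕_) (⨁⁺≡lincomb b' cs ρ)

⊕-cancel : (x y : Vect n) → x ⊕ (x ⊕ y) ≡ y
⊕-cancel x y = solve 2 (λ x y → x :⊕ x :⊕ y ⊜ y) refl x y

⊕≡0⇒≡ : {x y : Vect n} → x ⊕ y ≡ 0v → x ≡ y
⊕≡0⇒≡ {x = x} {y} eq =
  trans (solve 2 (λ x y → x ⊜ y :⊕ (x :⊕ y)) refl x y) (trans (cong (y ⊕_) eq) (⊕-identityʳ y))

≢⇒⊕≢0 : {x y : Vect n} → x ≢ y → x ⊕ y ≢ 0v
≢⇒⊕≢0 x≢y = x≢y ∘ ⊕≡0⇒≡

-- Finite search

infix 4 _≟ᵛ_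
_≟ᵛ_ : (x y : Vect n) → Dec (x ≡ y)
_≟ᵛ_ = ≡-dec B._≟_

all-vect? : {P : Vect n → Set} → (∀ v → Dec (P v)) → Dec (∀ v → P v)
all-vect? {zero} P? = map′ (λ { p [] → p }) (λ p → p []) (P? [])
all-vect? {suc n} P? = map′
  (λ { (p , q) (false ∷ v) → p v ; (p , q) (true ∷ v) → q v })
  (λ p → (λ v → p (false ∷ v)) , (λ v → p (true ∷ v)))
  (all-vect? (λ v → P? (false ∷ v)) ×-dec all-vect? (λ v → P? (true ∷ v)))

any-vect? : {P : Vect n → Set} → (∀ v → Dec (P v)) → Dec (∃ P)
any-vect? {zero} P? = map′ ([] ,_) (λ { ([] , p) → p }) (P? [])
any-vect? {suc n} P? with any-vect? (λ v → P? (false ∷ v)) | any-vect? (λ v → P? (true ∷ v))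
... | yes (v , p) | _           = yes (_ , p)
... | no _        | yes (v , p) = yes (_ , p)
... | no ¬p       | no ¬q       = no λ { (false ∷ v , p) → ¬p (v , p) ; (true ∷ v , q) → ¬q (v , q) }

-- A subset is rebuilt from its restrictions to the two values of the first coordinate only up to
-- pointwise equality; hence the demand that `P` respect it.
any-subset? : {P : Subset n → Set} → (∀ {S T} → (∀ v → S v ≡ T v) → P S → P T) →
              (∀ S → Dec (P S)) → Dec (∃ P)
any-subset? {zero} {P} resp P? with P? (λ _ → false) | P? (λ _ → true)
... | yes p | _     = yes (_ , p)
... | no _  | yes p = yes (_ , p)
... | no ¬p | no ¬q = no λ { (S , p) → either S p (S []) refl }
  where
  either : ∀ S → P S → ∀ b → S [] ≡ b → ⊥
  either S p false eq = ¬p (resp (λ { [] → eq }) p)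
  either S p true  eq = ¬q (resp (λ { [] → eq }) p)
any-subset? {suc n} {P} resp P? = map′
  (λ { (S , T , p) → glue S T , p })
  (λ { (S , p) → S ∘ (false ∷_) , S ∘ (true ∷_) , resp (λ { (false ∷ _) → refl ; (true ∷ _) → refl }) p })
  (any-subset?
    (λ { S≗S' (T , p) → T , resp (λ { (false ∷ v) → S≗S' v ; (true ∷ v) → refl }) p })
    (λ S → any-subset? (λ T≗T' → resp λ { (false ∷ v) → refl ; (true ∷ v) → T≗T' v })
                       (λ T → P? (glue S T))))
  where
  glue : Subset n → Subset n → Subset (suc n)
  glue S T (false ∷ v) = S v
  glue S T (true ∷ v)  = T v

does-sound : {A : Set} (d : Dec A) → does d ≡ true → A
does-sound (yes a) _ = a

true≢false : {b : Bool} → b ≡ true → b ≡ false → ⊥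
true≢false refl ()

≢true⇒false : {b : Bool} → ¬ (b ≡ true) → b ≡ false
≢true⇒false {true}  ne = ⊥-elim (ne refl)
≢true⇒false {false} _  = refl

≢false⇒true : {b : Bool} → ¬ (b ≡ false) → b ≡ true
≢false⇒true {true}  _  = refl
≢false⇒true {false} ne = ⊥-elim (ne refl)

-- Measure for the maximality arguments: the number of missing vectors drops whenever a subspace
-- grows, so recursion on it replaces the choice of a maximal subspace.
co-size : Subset n → ℕ
co-size {zero}  S = if S [] then 0 else 1
co-size {suc n} S = co-size (S ∘ (false ∷_)) + co-size (S ∘ (true ∷_))

co-size-antitone : {S T : Subset n} → (∀ v → v ∈ S → v ∈ T) → co-size T ≤ co-size S
co-size-antitone {zero} {S} {T} S⊆T with S [] in s | T [] in t
... | false | false = ≤-refl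
... | false | true  = z≤n
... | true  | true  = ≤-refl
... | true  | false = ⊥-elim (true≢false (S⊆T [] s) t)
co-size-antitone {suc n} S⊆T =
  +-mono-≤ (co-size-antitone (λ v → S⊆T (false ∷ v))) (co-size-antitone (λ v → S⊆T (true ∷ v)))

co-size-strict : {S T : Subset n} → (∀ v → v ∈ S → v ∈ T) → ∀ x → x ∉ S → x ∈ T → co-size T < co-size S
co-size-strict {S = S} {T} S⊆T [] x∉S x∈T rewrite x∉S | x∈T = s≤s z≤n
co-size-strict S⊆T (false ∷ x) x∉S x∈T =
  +-mono-<-≤ (co-size-strict (λ v → S⊆T (false ∷ v)) x x∉S x∈T) (co-size-antitone (λ v → S⊆T (true ∷ v)))
co-size-strict S⊆T (true ∷ x) x∉S x∈T =
  +-mono-≤-< (co-size-antitone (λ v → S⊆T (false ∷ v))) (co-size-strict (λ v → S⊆T (true ∷ v)) x x∉S x∈T)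

-- Subspaces

∉-shift : {D : Subset n} → IsSubspace D → ∀ x d → x ∉ D → d ∈ D → (x ⊕ d) ∉ D
∉-shift {D = D} (_ , clo) x d x∉ d∈ = ≢true⇒false λ xd∈ → true≢false
  (subst (_∈ D) (solve 2 (λ x d → (x :⊕ d) :⊕ d ⊜ x) refl x d) (clo (x ⊕ d) d xd∈ d∈)) x∉

-- Over F₂ the span of a subspace `U` and `x` is `U` together with the single coset `x + U`.
adj : Subset n → Vect n → Subset n
adj U x v = U v ∨ U (v ⊕ x)

adj-⊇ : (U : Subset n) (x : Vect n) → ∀ v → v ∈ U → v ∈ adj U x
adj-⊇ U x v v∈U rewrite v∈U = refl

adj-intro : (U : Subset n) (x : Vect n) → ∀ v → (v ⊕ x) ∈ U → v ∈ adj U x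
adj-intro U x v p with U v
... | true  = refl
... | false = p

adj-elim : (U : Subset n) (x : Vect n) → ∀ v → v ∈ adj U x → (v ∈ U) ⊎ ((v ⊕ x) ∈ U)
adj-elim U x v p with U v
... | true  = inj₁ refl
... | false = inj₂ p

adj-subspace : (U : Subset n) (x : Vect n) → IsSubspace U → IsSubspace (adj U x)
adj-subspace U x (0∈ , clo) = adj-⊇ U x _ 0∈ , closed
  where
  closed : ∀ v w → v ∈ adj U x → w ∈ adj U x → (v ⊕ w) ∈ adj U x
  closed v w v∈ w∈ with adj-elim U x v v∈ | adj-elim U x w w∈
  ... | inj₁ p | inj₁ q = adj-⊇ U x _ (clo _ _ p q)
  ... | inj₁ p | inj₂ q = adj-intro U x _ (subst (_∈ U) (solve 3 (λ v w x → v :⊕ w :⊕ x ⊜ (v :⊕ w) :⊕ x) refl v w x) (clo _ _ p q))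
  ... | inj₂ p | inj₁ q = adj-intro U x _ (subst (_∈ U) (solve 3 (λ v w x → (v :⊕ x) :⊕ w ⊜ (v :⊕ w) :⊕ x) refl v w x) (clo _ _ p q))
  ... | inj₂ p | inj₂ q = adj-⊇ U x _ (subst (_∈ U) (solve 3 (λ v w x → (v :⊕ x) :⊕ w :⊕ x ⊜ v :⊕ w) refl v w x) (clo _ _ p q))

adj-self : (U : Subset n) (x : Vect n) → IsSubspace U → x ∈ adj U x
adj-self U x (0∈ , _) = adj-intro U x x (subst (_∈ U) (sym (⊕-self x)) 0∈)

⟨0⟩ : Subset n
⟨0⟩ v = does (v ≟ᵛ 0v)

⟨0⟩-subspace : IsSubspace (⟨0⟩ {n})
⟨0⟩-subspace {n} = dec-true (0v {n} ≟ᵛ 0v) refl ,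
  λ x y x∈ y∈ → dec-true (x ⊕ y ≟ᵛ 0v) (trans (cong₂ _⊕_ (does-sound (x ≟ᵛ 0v) x∈) (does-sound (y ≟ᵛ 0v) y∈)) (⊕-self 0v))

⊞? : (A B : Subset n) (v : Vect n) → Dec (∃[ a ] (a ∈ A × (a ⊕ v) ∈ B))
⊞? A B v = any-vect? λ a → (A a B.≟ true) ×-dec (B (a ⊕ v) B.≟ true)

infixl 6 _⊞_
_⊞_ : Subset n → Subset n → Subset n
(A ⊞ B) v = does (⊞? A B v)

⊞-intro : (A B : Subset n) {a b : Vect n} → a ∈ A → b ∈ B → (a ⊕ b) ∈ (A ⊞ B)
⊞-intro A B {a} {b} a∈A b∈B =
  dec-true (⊞? A B _) (a , a∈A , subst (_∈ B) (sym (⊕-cancel a b)) b∈B)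

⊞-elim : (A B : Subset n) {v : Vect n} → v ∈ (A ⊞ B) → ∃[ a ] ∃[ b ] (a ∈ A × b ∈ B × v ≡ a ⊕ b)
⊞-elim A B {v} p with does-sound (⊞? A B v) p
... | a , a∈A , b∈B = a , a ⊕ v , a∈A , b∈B , sym (⊕-cancel a v)

⊞-subspace : (A B : Subset n) → IsSubspace A → IsSubspace B → IsSubspace (A ⊞ B)
⊞-subspace A B (0∈A , cloA) (0∈B , cloB) =
  subst (_∈ (A ⊞ B)) (⊕-self 0v) (⊞-intro A B 0∈A 0∈B) , closed
  where
  closed : ∀ v w → v ∈ (A ⊞ B) → w ∈ (A ⊞ B) → (v ⊕ w) ∈ (A ⊞ B)
  closed v w v∈ w∈ with ⊞-elim A B v∈ | ⊞-elim A B w∈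
  ... | a , b , a∈ , b∈ , refl | a' , b' , a'∈ , b'∈ , refl =
    subst (_∈ (A ⊞ B)) (⊕-interchange a a' b b') (⊞-intro A B (cloA _ _ a∈ a'∈) (cloB _ _ b∈ b'∈))

span? : (ρ : Vec (Vect n) k) (v : Vect n) → Dec (InSpan v ρ)
span? ρ v = any-vect? λ cs → lincomb cs ρ ≟ᵛ v

span : Vec (Vect n) k → Subset n
span ρ v = does (span? ρ v)

span-intro : (ρ : Vec (Vect n) k) (cs : Vect k) → lincomb cs ρ ∈ span ρ
span-intro ρ cs = dec-true (span? ρ _) (cs , refl)

span-elim : (ρ : Vec (Vect n) k) {v : Vect n} → v ∈ span ρ → InSpan v ρ
span-elim ρ = does-sound (span? ρ _)

span-subspace : (ρ : Vec (Vect n) k) → IsSubspace (span ρ)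
span-subspace ρ = subst (_∈ span ρ) (lincomb-0 ρ) (span-intro ρ 0v) , closed
  where
  closed : ∀ v w → v ∈ span ρ → w ∈ span ρ → (v ⊕ w) ∈ span ρ
  closed v w v∈ w∈ with span-elim ρ v∈ | span-elim ρ w∈
  ... | cs , refl | ds , refl = subst (_∈ span ρ) (lincomb-⊕ cs ds ρ) (span-intro ρ (cs ⊕ ds))

-- Decompositions

-- a, b, c need not be assumed independent: if f 0v ≡ false, the seven values force it.
NoClaw : Subset n → Set
NoClaw f = ∀ a b c → a ∈ f → b ∈ f → c ∈ f →
           (a ⊕ b) ∉ f → (a ⊕ c) ∉ f → (b ⊕ c) ∉ f → (a ⊕ (b ⊕ c)) ∉ f → ⊥

-- A decomposer of the restriction of `f` to `U`, with 0 included. The absence of mixed cosets is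
-- phrased as invariance of `f` under translation by `D`, off `D`.
Decomposes : Subset n → Subset n → Subset n → Set
Decomposes f U D = IsSubspace D × (∀ v → v ∈ D → v ∈ U)
  × (∃[ v ] (v ≢ 0v × v ∈ D)) × (∃[ v ] (v ∈ U × v ∉ D))
  × (∀ x d → x ∈ U → x ∉ D → d ∈ D → f (x ⊕ d) ≡ f x)

Indecomposable : Subset n → Subset n → Set
Indecomposable f U = ∀ D → ¬ Decomposes f U D

full : Subset n
full _ = true

-- The triangles excluded are those consisting of zeros of `f`: this is triangle-freeness of the
-- complement of E, inside `U`.
TriFree : Subset n → Subset n → Set
TriFree f U = ∀ p q → p ∈ U → q ∈ U → p ≢ 0v → q ≢ 0v → p ≢ q → p ∉ f → q ∉ f → (p ⊕ q) ∈ f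

claw-at-lincomb : {f : Subset n} → NoClaw f → (ρ : Vec (Vect n) k) (c₁ c₂ c₃ : Vect k) →
  lincomb c₁ ρ ∈ f → lincomb c₂ ρ ∈ f → lincomb c₃ ρ ∈ f →
  lincomb (c₁ ⊕ c₂) ρ ∉ f → lincomb (c₁ ⊕ c₃) ρ ∉ f → lincomb (c₂ ⊕ c₃) ρ ∉ f →
  lincomb (c₁ ⊕ (c₂ ⊕ c₃)) ρ ∉ f → ⊥
claw-at-lincomb {f = f} cf ρ c₁ c₂ c₃ h₁ h₂ h₃ h₁₂ h₁₃ h₂₃ h = cf _ _ _ h₁ h₂ h₃
  (subst (_∉ f) (lincomb-⊕ c₁ c₂ ρ) h₁₂)
  (subst (_∉ f) (lincomb-⊕ c₁ c₃ ρ) h₁₃)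
  (subst (_∉ f) (lincomb-⊕ c₂ c₃ ρ) h₂₃)
  (subst (_∉ f) (trans (lincomb-⊕ c₁ (c₂ ⊕ c₃) ρ) (cong (lincomb c₁ ρ ⊕_) (lincomb-⊕ c₂ c₃ ρ))) h)

-- The seven vectors are named by coefficients over `ρ`, so their sums are computed, and the
-- hypotheses reduce to `f` of short sums, the form in which the values are known.
claw-at : {f : Subset n} → NoClaw f → (ρ : Vec (Vect n) k) (c₁ c₂ c₃ : Vect k) →
  ⨁ c₁ ρ ∈ f → ⨁ c₂ ρ ∈ f → ⨁ c₃ ρ ∈ f →
  ⨁ (c₁ ⊕ c₂) ρ ∉ f → ⨁ (c₁ ⊕ c₃) ρ ∉ f → ⨁ (c₂ ⊕ c₃) ρ ∉ f →
  ⨁ (c₁ ⊕ (c₂ ⊕ c₃)) ρ ∉ f → ⊥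
claw-at {f = f} cf ρ c₁ c₂ c₃ h₁ h₂ h₃ h₁₂ h₁₃ h₂₃ h = claw-at-lincomb cf ρ c₁ c₂ c₃
  (to c₁ h₁) (to c₂ h₂) (to c₃ h₃)
  (to (c₁ ⊕ c₂) h₁₂) (to (c₁ ⊕ c₃) h₁₃) (to (c₂ ⊕ c₃) h₂₃) (to (c₁ ⊕ (c₂ ⊕ c₃)) h)
  where
  to : ∀ {b} c → f (⨁ c ρ) ≡ b → f (lincomb c ρ) ≡ b
  to {b} c = subst (λ v → f v ≡ b) (⨁≡lincomb c ρ)

-- If neither alternative holds, `U ∩ D` is a nonzero proper subspace of `U`. It inherits invariance
-- from `D`, because a vector of `U` outside `U ∩ D` is outside `D`.
indecomposable-meets : {f U D W : Subset n} → Indecomposable f U → IsSubspace U → (∀ v → v ∈ U → v ∈ W) →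
  Decomposes f W D →
  (∀ u → u ∈ U → u ∈ D) ⊎ (∀ u → u ∈ U → u ≢ 0v → u ∉ D)
indecomposable-meets {f = f} {U} {D} {W} ind (0∈U , cloU) U⊆W ((0∈D , cloD) , _ , _ , _ , inv)
  with any-vect? (λ v → (U v B.≟ true) ×-dec (D v B.≟ true) ×-dec ¬? (v ≟ᵛ 0v))
     | any-vect? (λ v → (U v B.≟ true) ×-dec (D v B.≟ false))
... | no none | _ = inj₂ λ u u∈U u≢0 → ≢true⇒false λ u∈D → none (u , u∈U , u∈D , u≢0)
... | yes _ | no none = inj₁ λ u u∈U → ≢false⇒true λ u∉D → none (u , u∈U , u∉D)
... | yes (d , d∈U , d∈D , d≢0) | yes (v , v∈U , v∉D) = ⊥-elim (ind (U ∩ D)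
  ( (∧-intro 0∈U 0∈D
    , λ x y x∈ y∈ → ∧-intro (cloU x y (∧-left x∈) (∧-left y∈)) (cloD x y (∧-right {U x} x∈) (∧-right {U y} y∈)))
  , (λ v v∈ → ∧-left v∈) , (d , d≢0 , ∧-intro d∈U d∈D) , (v , v∈U , outside v∉D)
  , λ x d x∈U x∉ d∈ → inv x d (U⊆W x x∈U) (outside⁻¹ x∈U x∉) (∧-right {U d} d∈)))
  where
  ∧-intro : ∀ {a b} → a ≡ true → b ≡ true → a ∧ b ≡ true
  ∧-intro refl refl = refl
  ∧-left : ∀ {a b} → a ∧ b ≡ true → a ≡ true
  ∧-left {true} _ = refl
  ∧-right : ∀ {a b} → a ∧ b ≡ true → b ≡ true
  ∧-right {true} eq = eq
  outside : ∀ {v} → v ∉ D → v ∉ (U ∩ D)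
  outside {v} v∉D with U v
  ... | true  = v∉D
  ... | false = refl
  outside⁻¹ : ∀ {v} → v ∈ U → v ∉ (U ∩ D) → v ∉ D
  outside⁻¹ v∈U v∉ rewrite v∈U = v∉

-- Otherwise U + Z is a decomposer.
sum-exhausts : {f U Z : Subset n} → Indecomposable f full → IsSubspace U → IsSubspace Z →
  (∃[ v ] (v ≢ 0v × v ∈ U)) →
  (∀ x u → x ∉ (U ⊞ Z) → u ∈ U → f (x ⊕ u) ≡ f x) →
  (∀ x z → x ∉ (U ⊞ Z) → z ∈ Z → f (x ⊕ z) ≡ f x) →
  ∀ v → v ∈ (U ⊞ Z)
sum-exhausts {f = f} {U} {Z} ind subU subZ (e , e≢0 , e∈U) constU constZ v = ≢false⇒true λ v∉ →
  ind (U ⊞ Z) (sub , (λ _ _ → refl) , (e , e≢0 , e∈) , (v , refl , v∉) , inv)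
  where
  sub = ⊞-subspace U Z subU subZ
  U⊆ : ∀ {u} → u ∈ U → u ∈ (U ⊞ Z)
  U⊆ u∈U = subst (_∈ (U ⊞ Z)) (⊕-identityʳ _) (⊞-intro U Z u∈U (proj₁ subZ))
  e∈ = U⊆ e∈U
  inv : ∀ x d → x ∈ full → x ∉ (U ⊞ Z) → d ∈ (U ⊞ Z) → f (x ⊕ d) ≡ f x
  inv x d _ x∉ d∈ with ⊞-elim U Z d∈
  ... | u , z , u∈U , z∈Z , refl =
    trans (cong f (sym (⊕-assoc x u z))) (trans (constZ (x ⊕ u) z (∉-shift sub x u x∉ (U⊆ u∈U)) z∈Z) (constU x u x∉ u∈U))

-- Otherwise Z is a decomposer.
copies-trivial : {f U Z : Subset n} → Indecomposable f full → IsSubspace U → IsSubspace Z →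
  (∃[ v ] (v ≢ 0v × v ∈ U)) →
  (∀ v → v ∈ U → v ∈ Z → v ≡ 0v) →
  (∀ z u → z ∈ Z → u ∈ U → u ≢ 0v → f (z ⊕ u) ≡ f u) →
  (∀ v → v ∈ (U ⊞ Z)) →
  ∀ v → v ∈ U
copies-trivial {f = f} {U} {Z} ind subU subZ (e , e≢0 , e∈U) disj copy all v
  with ⊞-elim U Z (all v)
... | u , z , u∈U , z∈Z , refl with z ≟ᵛ 0v
...   | yes refl = subst (_∈ U) (sym (⊕-identityʳ u)) u∈U
...   | no z≢0 = ⊥-elim (ind Z (subZ , (λ _ _ → refl) , (z , z≢0 , z∈Z) , (e , refl , e∉Z) , inv))
  where
  e∉Z : e ∉ Z
  e∉Z = ≢true⇒false λ e∈Z → e≢0 (disj e e∈U e∈Z)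
  inv : ∀ x d → x ∈ full → x ∉ Z → d ∈ Z → f (x ⊕ d) ≡ f x
  inv x d _ x∉Z d∈Z with ⊞-elim U Z (all x)
  ... | w , y , w∈U , y∈Z , refl with w ≟ᵛ 0v
  ...   | yes refl = ⊥-elim (true≢false (subst (_∈ Z) (sym (⊕-identityˡ y)) y∈Z) x∉Z)
  ...   | no w≢0 = trans
    (trans (cong f (solve 3 (λ w y d → (w :⊕ y) :⊕ d ⊜ (y :⊕ d) :⊕ w) refl w y d))
           (copy (y ⊕ d) w (proj₂ subZ _ _ y∈Z d∈Z) w∈U w≢0))
    (sym (trans (cong f (⊕-comm w y)) (copy y w y∈Z w∈U w≢0)))

pattern I = true
pattern O = false

-- Copies and constant cosets

Const : Subset n → Subset n → Vect n → Set
Const f U x = ∀ u → u ∈ U → f (x ⊕ u) ≡ f x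

Copy : Subset n → Subset n → Vect n → Set
Copy f U d = ∀ u → u ∈ U → u ≢ 0v → f (d ⊕ u) ≡ f u

-- Two triangles a₁, a₂, a₁ + a₂ and b₁, b₂, b₁ + b₂ forming a PG-sum.
record BiTriangle (f : Subset n) (a₁ a₂ b₁ b₂ : Vect n) : Set where
  field
    a₁∈   : a₁ ∈ f
    a₂∈   : a₂ ∈ f
    a₁₂∈  : (a₁ ⊕ a₂) ∈ f
    b₁∈   : b₁ ∈ f
    b₂∈   : b₂ ∈ f
    b₁₂∈  : (b₁ ⊕ b₂) ∈ f
    a₁b₁∉ : (a₁ ⊕ b₁) ∉ f
    a₁b₂∉ : (a₁ ⊕ b₂) ∉ f
    a₁b₁₂∉ : (a₁ ⊕ (b₁ ⊕ b₂)) ∉ f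
    a₂b₁∉ : (a₂ ⊕ b₁) ∉ f
    a₂b₂∉ : (a₂ ⊕ b₂) ∉ f
    a₂b₁₂∉ : (a₂ ⊕ (b₁ ⊕ b₂)) ∉ f
    a₁₂b₁∉ : ((a₁ ⊕ a₂) ⊕ b₁) ∉ f
    a₁₂b₂∉ : ((a₁ ⊕ a₂) ⊕ b₂) ∉ f
    a₁₂b₁₂∉ : ((a₁ ⊕ a₂) ⊕ (b₁ ⊕ b₂)) ∉ f

-- The situation to be settled: `a` in `U` and `x`, `x + a` outside form an empty triangle. Such a
-- triangle is the only way in which adjoining `x` can spoil triangle-freeness, and it forces
-- `x + U` to vanish or to be a copy.
module CosetWithEmptyTriangle {n : ℕ} {f U : Subset n} (f0 : 0v ∉ f) (cf : NoClaw f)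
  (noBi : ∀ {a₁ a₂ b₁ b₂} → ¬ BiTriangle f a₁ a₂ b₁ b₂)
  (subU : IsSubspace U) (ind : Indecomposable f U) (tri : TriFree f U) where

  X : Vect n → Set
  X c = c ∈ U × c ≢ 0v × c ∉ f

  X? : ∀ c → Dec (X c)
  X? c = (U c B.≟ true) ×-dec ¬? (c ≟ᵛ 0v) ×-dec (f c B.≟ false)

  cloU : ∀ {u v} → u ∈ U → v ∈ U → (u ⊕ v) ∈ U
  cloU = proj₂ subU _ _

  X-sum : ∀ {c d} → X c → X d → c ≢ d → (c ⊕ d) ∈ f
  X-sum (c∈U , c≢0 , c∉f) (d∈U , d≢0 , d∉f) c≢d = tri _ _ c∈U d∈U c≢0 d≢0 c≢d c∉f d∉f

  -- The three configurations of values on x + ⟨c, e⟩ (translated by u) that a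
  -- zero c of U excludes.
  single : ∀ x u c e → c ∉ f → e ∈ f → (c ⊕ e) ∈ f →
    (x ⊕ u) ∈ f → (x ⊕ (u ⊕ c)) ∉ f → (x ⊕ (u ⊕ e)) ∉ f → (x ⊕ (u ⊕ (c ⊕ e))) ∉ f → ⊥
  single x u c e c∉ e∈ ce∈ p pc pe pce =
    claw-at cf (x ∷ u ∷ c ∷ e ∷ []) (I ∷ I ∷ O ∷ O ∷ []) (O ∷ O ∷ O ∷ I ∷ []) (O ∷ O ∷ I ∷ I ∷ [])
      p e∈ ce∈ pe pce c∉ pc

  parallel : ∀ x u c e → c ∉ f → e ∈ f → (c ⊕ e) ∉ f →
    (x ⊕ u) ∈ f → (x ⊕ (u ⊕ c)) ∈ f → (x ⊕ (u ⊕ e)) ∉ f → (x ⊕ (u ⊕ (c ⊕ e))) ∉ f → ⊥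
  parallel x u c e c∉ e∈ ce∉ p pc pe pce =
    claw-at cf (x ∷ u ∷ c ∷ e ∷ []) (O ∷ O ∷ O ∷ I ∷ []) (I ∷ I ∷ O ∷ O ∷ []) (I ∷ I ∷ I ∷ O ∷ [])
      e∈ p pc pe pce c∉ ce∉

  aligned : ∀ x u c e → c ∉ f → e ∉ f → (c ⊕ e) ∈ f →
    (x ⊕ u) ∈ f → (x ⊕ (u ⊕ e)) ∈ f → (x ⊕ (u ⊕ c)) ∉ f → (x ⊕ (u ⊕ (c ⊕ e))) ∉ f → ⊥
  aligned x u c e c∉ e∉ ce∈ p pe pc pce =
    claw-at cf (x ∷ u ∷ c ∷ e ∷ []) (I ∷ I ∷ O ∷ O ∷ []) (I ∷ I ∷ O ∷ I ∷ []) (O ∷ O ∷ I ∷ I ∷ [])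
      p pe ce∈ e∉ pce pc c∉

  module Constant (x a : Vect n) (Xa : X a) (x∉f : x ∉ f)
    (inva : ∀ u → u ∈ U → f (x ⊕ (u ⊕ a)) ≡ f (x ⊕ u)) where

    Stab? : ∀ s → Dec (s ∈ U × (∀ u → u ∈ U → f (x ⊕ (u ⊕ s)) ≡ f (x ⊕ u)))
    Stab? s = (U s B.≟ true) ×-dec all-vect? (λ u → (U u B.≟ true) →-dec (f (x ⊕ (u ⊕ s)) B.≟ f (x ⊕ u)))

    Stab : Subset n
    Stab s = does (Stab? s)

    stab-subspace : IsSubspace Stab
    stab-subspace = dec-true (Stab? 0v) (proj₁ subU , λ u _ → cong (λ v → f (x ⊕ v)) (⊕-identityʳ u)) ,
      λ s t s∈ t∈ → let (s∈U , hs) = does-sound (Stab? s) s∈ ; (t∈U , ht) = does-sound (Stab? t) t∈ in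
        dec-true (Stab? (s ⊕ t)) (cloU s∈U t∈U , λ u u∈U →
          trans (cong (λ v → f (x ⊕ v)) (sym (⊕-assoc u s t))) (trans (ht (u ⊕ s) (cloU u∈U s∈U)) (hs u u∈U)))

    -- A single period `a` in `X` suffices: `parallel` with `a` and `a + c` shows that `c` changes
    -- no value, since `a` and `c` are zeros and `a + c` is a one.
    X⊆Stab : ∀ {c} → X c → c ∈ Stab
    X⊆Stab {c} Xc with c ≟ᵛ a
    ... | yes refl = dec-true (Stab? c) (proj₁ Xc , inva)
    ... | no c≢a = dec-true (Stab? c) (proj₁ Xc , same)
      where
      same : ∀ u → u ∈ U → f (x ⊕ (u ⊕ c)) ≡ f (x ⊕ u)
      same u u∈U with f (x ⊕ u) in fu | f (x ⊕ (u ⊕ c)) in fuc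
      ... | true  | true  = refl
      ... | false | false = refl
      ... | true  | false = ⊥-elim (parallel x u a (a ⊕ c) (proj₂ (proj₂ Xa))
        (X-sum Xa Xc (c≢a ∘ sym)) (trans (cong f (⊕-cancel a c)) (proj₂ (proj₂ Xc))) fu (trans (inva u u∈U) fu)
        (trans (cong f (solve 4 (λ x u a c → x :⊕ u :⊕ a :⊕ c ⊜ x :⊕ (u :⊕ c) :⊕ a) refl x u a c))
               (trans (inva (u ⊕ c) (cloU u∈U (proj₁ Xc))) fuc))
        (trans (cong f (solve 4 (λ x u a c → x :⊕ u :⊕ a :⊕ a :⊕ c ⊜ x :⊕ u :⊕ c) refl x u a c)) fuc))
      ... | false | true  = ⊥-elim (parallel x (u ⊕ c) a (a ⊕ c) (proj₂ (proj₂ Xa))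
        (X-sum Xa Xc (c≢a ∘ sym)) (trans (cong f (⊕-cancel a c)) (proj₂ (proj₂ Xc))) fuc
        (trans (inva (u ⊕ c) (cloU u∈U (proj₁ Xc))) fuc)
        (trans (cong f (solve 4 (λ x u a c → x :⊕ (u :⊕ c) :⊕ a :⊕ c ⊜ x :⊕ u :⊕ a) refl x u a c))
               (trans (inva u u∈U) fu))
        (trans (cong f (solve 4 (λ x u a c → x :⊕ (u :⊕ c) :⊕ a :⊕ a :⊕ c ⊜ x :⊕ u) refl x u a c)) fu))

    outside-Stab : ∀ {y} → y ∈ U → y ∉ Stab → y ∈ f
    outside-Stab {y} y∈U y∉ = ≢false⇒true λ y∉f → true≢false
      (X⊆Stab (y∈U , (λ { refl → true≢false (proj₁ stab-subspace) y∉ }) , y∉f)) y∉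

    -- All vectors of `U` outside `Stab` are ones of `f`, so a proper `Stab` would decompose `U`.
    -- Hence every vector of `U` is a period of the coset.
    constant : ∀ u → u ∈ U → (x ⊕ u) ∉ f
    constant u u∈U with Stab u in eq
    ... | true  = trans (cong (λ v → f (x ⊕ v)) (sym (⊕-identityˡ u)))
      (trans (proj₂ (does-sound (Stab? u) eq) 0v (proj₁ subU)) (trans (cong f (⊕-identityʳ x)) x∉f))
    ... | false = ⊥-elim (ind Stab (stab-subspace , (λ s s∈ → proj₁ (does-sound (Stab? s) s∈))
        , (a , proj₁ (proj₂ Xa) , X⊆Stab Xa) , (u , u∈U , eq) , inv))
      where
      inv : ∀ y d → y ∈ U → y ∉ Stab → d ∈ Stab → f (y ⊕ d) ≡ f y
      inv y d y∈U y∉ d∈ = trans (outside-Stab (cloU y∈U (proj₁ (does-sound (Stab? d) d∈))) (∉-shift stab-subspace y d y∉ d∈))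
        (sym (outside-Stab y∈U y∉))

  module Copied (x a b : Vect n) (Xa : X a) (Xb : X b)
    (x∉f : x ∉ f) (xa∉ : (x ⊕ a) ∉ f) (xb∉ : (x ⊕ b) ∉ f) (xab∈ : (x ⊕ (a ⊕ b)) ∈ f) where

    a∉f : a ∉ f
    a∉f = proj₂ (proj₂ Xa)

    b∉f : b ∉ f
    b∉f = proj₂ (proj₂ Xb)

    a≢b : a ≢ b
    a≢b refl = true≢false xab∈ (trans (cong f (solve 2 (λ x a → x :⊕ a :⊕ a ⊜ x) refl x a)) x∉f)

    ab∈ : (a ⊕ b) ∈ f
    ab∈ = X-sum Xa Xb a≢b

    module _ {c : Vect n} (Xc : X c) (xc∈ : (x ⊕ c) ∈ f) where
      c∉f : c ∉ f
      c∉f = proj₂ (proj₂ Xc)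

      ac∈ : (a ⊕ c) ∈ f
      ac∈ = X-sum Xa Xc λ { refl → true≢false xc∈ xa∉ }

      bc∈ : (b ⊕ c) ∈ f
      bc∈ = X-sum Xb Xc λ { refl → true≢false xc∈ xb∉ }

      xac∉ : (x ⊕ (a ⊕ c)) ∉ f
      xac∉ = ≢true⇒false λ xac∈ → parallel x c a (a ⊕ c) a∉f ac∈ (trans (cong f (⊕-cancel a c)) c∉f) xc∈
        (trans (cong (λ v → f (x ⊕ v)) (⊕-comm c a)) xac∈)
        (trans (cong f (solve 3 (λ x a c → x :⊕ c :⊕ a :⊕ c ⊜ x :⊕ a) refl x a c)) xa∉)
        (trans (cong f (solve 3 (λ x a c → x :⊕ c :⊕ a :⊕ a :⊕ c ⊜ x) refl x a c)) x∉f)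

      xbc∉ : (x ⊕ (b ⊕ c)) ∉ f
      xbc∉ = ≢true⇒false λ xbc∈ → parallel x c b (b ⊕ c) b∉f bc∈ (trans (cong f (⊕-cancel b c)) c∉f) xc∈
        (trans (cong (λ v → f (x ⊕ v)) (⊕-comm c b)) xbc∈)
        (trans (cong f (solve 3 (λ x b c → x :⊕ c :⊕ b :⊕ c ⊜ x :⊕ b) refl x b c)) xb∉)
        (trans (cong f (solve 3 (λ x b c → x :⊕ c :⊕ b :⊕ b :⊕ c ⊜ x) refl x b c)) x∉f)

      abc∈ : (a ⊕ (b ⊕ c)) ∈ f
      abc∈ = ≢false⇒true λ abc∉ → aligned x c a (a ⊕ (b ⊕ c)) a∉f abc∉ (trans (cong f (⊕-cancel a (b ⊕ c))) bc∈) xc∈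
        (trans (cong f (solve 4 (λ x a b c → x :⊕ c :⊕ a :⊕ b :⊕ c ⊜ x :⊕ a :⊕ b) refl x a b c)) xab∈)
        (trans (cong (λ v → f (x ⊕ v)) (⊕-comm c a)) xac∉)
        (trans (cong f (solve 4 (λ x a b c → x :⊕ c :⊕ a :⊕ a :⊕ b :⊕ c ⊜ x :⊕ b) refl x a b c)) xb∉)

      xabc∉ : (x ⊕ (a ⊕ (b ⊕ c))) ∉ f
      xabc∉ = ≢true⇒false λ xabc∈ → parallel x (a ⊕ b) c (a ⊕ c) c∉f ac∈
        (trans (cong f (solve 2 (λ a c → c :⊕ a :⊕ c ⊜ a) refl a c)) a∉f) xab∈
        (trans (cong (λ v → f (x ⊕ v)) (⊕-assoc a b c)) xabc∈)
        (trans (cong f (solve 4 (λ x a b c → x :⊕ (a :⊕ b) :⊕ a :⊕ c ⊜ x :⊕ b :⊕ c) refl x a b c)) xbc∉)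
        (trans (cong f (solve 4 (λ x a b c → x :⊕ (a :⊕ b) :⊕ c :⊕ a :⊕ c ⊜ x :⊕ b) refl x a b c)) xb∉)

      -- By the values found so far, the ones on the span of `x`, `a`, `b`, `c` are exactly the
      -- points of two triangles: `x + c`, `x + a + b`, `a + b + c` and `a + b`, `b + c`, `a + c`.
      bi-triangle : BiTriangle f (x ⊕ c) (x ⊕ (a ⊕ b)) (a ⊕ b) (b ⊕ c)
      bi-triangle = record
        { a₁∈ = xc∈ ; a₂∈ = xab∈
        ; a₁₂∈ = trans (cong f (solve 4 (λ x a b c → (x :⊕ c) :⊕ x :⊕ a :⊕ b ⊜ a :⊕ b :⊕ c) refl x a b c)) abc∈
        ; b₁∈ = ab∈ ; b₂∈ = bc∈
        ; b₁₂∈ = trans (cong f (solve 3 (λ a b c → (a :⊕ b) :⊕ b :⊕ c ⊜ a :⊕ c) refl a b c)) ac∈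
        ; a₁b₁∉ = trans (cong f (solve 4 (λ x a b c → (x :⊕ c) :⊕ a :⊕ b ⊜ x :⊕ a :⊕ b :⊕ c) refl x a b c)) xabc∉
        ; a₁b₂∉ = trans (cong f (solve 3 (λ x b c → (x :⊕ c) :⊕ b :⊕ c ⊜ x :⊕ b) refl x b c)) xb∉
        ; a₁b₁₂∉ = trans (cong f (solve 4 (λ x a b c → (x :⊕ c) :⊕ (a :⊕ b) :⊕ b :⊕ c ⊜ x :⊕ a) refl x a b c)) xa∉
        ; a₂b₁∉ = trans (cong f (solve 3 (λ x a b → (x :⊕ a :⊕ b) :⊕ a :⊕ b ⊜ x) refl x a b)) x∉f
        ; a₂b₂∉ = trans (cong f (solve 4 (λ x a b c → (x :⊕ a :⊕ b) :⊕ b :⊕ c ⊜ x :⊕ a :⊕ c) refl x a b c)) xac∉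
        ; a₂b₁₂∉ = trans (cong f (solve 4 (λ x a b c → (x :⊕ a :⊕ b) :⊕ (a :⊕ b) :⊕ b :⊕ c ⊜ x :⊕ b :⊕ c) refl x a b c)) xbc∉
        ; a₁₂b₁∉ = trans (cong f (solve 4 (λ x a b c → ((x :⊕ c) :⊕ x :⊕ a :⊕ b) :⊕ a :⊕ b ⊜ c) refl x a b c)) c∉f
        ; a₁₂b₂∉ = trans (cong f (solve 4 (λ x a b c → ((x :⊕ c) :⊕ x :⊕ a :⊕ b) :⊕ b :⊕ c ⊜ a) refl x a b c)) a∉f
        ; a₁₂b₁₂∉ = trans (cong f (solve 4 (λ x a b c → ((x :⊕ c) :⊕ x :⊕ a :⊕ b) :⊕ (a :⊕ b) :⊕ b :⊕ c ⊜ b) refl x a b c)) b∉f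
        }

    X-zero : ∀ {c} → X c → (x ⊕ c) ∉ f
    X-zero Xc = ≢true⇒false λ xc∈ → noBi (bi-triangle Xc xc∈)

    -- Join u and u' when u + u' ∈ X, a triangle-free graph on U.  A vertex v with f (x + v) = 0
    -- but no neighbour w with f (x + w) = 1 turns out to satisfy v + X = X, hence v = 0.
    Full : Vect n → Set
    Full v = v ∈ U × (x ⊕ v) ∉ f × (∀ c → X c → (x ⊕ (v ⊕ c)) ∉ f)

    full-0 : Full 0v
    full-0 = proj₁ subU , trans (cong f (⊕-identityʳ x)) x∉f ,
      λ c Xc → trans (cong (λ v → f (x ⊕ v)) (⊕-identityˡ c)) (X-zero Xc)

    -- Suppose that `m + v` is a one. If `c + m + v` is a one too, `single` gives a claw. Otherwise
    -- `c + m + v` lies in `X` and joins the full vertex `v` to `m + c`, although `x + m + c` is a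
    -- one.
    boundary : ∀ {v m c} → Full v → m ∈ U → X c → (x ⊕ m) ∉ f → (x ⊕ (m ⊕ c)) ∈ f → X (m ⊕ v)
    boundary {v} {m} {c} (v∈U , xv∉ , nbr) m∈U Xc xm∉ xmc∈ = cloU m∈U v∈U , m≢v ∘ ⊕≡0⇒≡ , ≢true⇒false no-edge
      where
      m≢v : m ≢ v
      m≢v refl = true≢false xmc∈ (nbr c Xc)
      no-edge : (m ⊕ v) ∈ f → ⊥
      no-edge mv∈ with f (c ⊕ (m ⊕ v)) in eq
      ... | true = single x (m ⊕ c) c (m ⊕ v) (proj₂ (proj₂ Xc)) mv∈ eq xmc∈
        (trans (cong f (solve 3 (λ x m c → x :⊕ (m :⊕ c) :⊕ c ⊜ x :⊕ m) refl x m c)) xm∉)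
        (trans (cong f (solve 4 (λ x m c v → x :⊕ (m :⊕ c) :⊕ m :⊕ v ⊜ x :⊕ v :⊕ c) refl x m c v)) (nbr c Xc))
        (trans (cong f (solve 4 (λ x m c v → x :⊕ (m :⊕ c) :⊕ c :⊕ m :⊕ v ⊜ x :⊕ v) refl x m c v)) xv∉)
      ... | false = true≢false
        (trans (cong f (solve 4 (λ x m c v → x :⊕ v :⊕ c :⊕ m :⊕ v ⊜ x :⊕ m :⊕ c) refl x m c v)) xmc∈)
        (nbr (c ⊕ (m ⊕ v)) (cloU (proj₁ Xc) (cloU m∈U v∈U)
          , (λ z → true≢false mv∈ (trans (cong f (sym (⊕≡0⇒≡ z))) (proj₂ (proj₂ Xc)))) , eq))

    -- If `c` has a neighbour at which the coset takes the value 1, `boundary` applies to `c`.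
    -- Otherwise `c` is itself full, and `boundary` from `c` to `a` puts `a + c` into `X`, against
    -- triangle-freeness.
    full-shifts-X : ∀ {v c} → Full v → X c → X (c ⊕ v)
    full-shifts-X {v} {c} Fv Xc with any-vect? (λ d → X? d ×-dec (f (x ⊕ (c ⊕ d)) B.≟ true))
    ... | yes (d , Xd , xcd∈) = boundary Fv (proj₁ Xc) Xd (X-zero Xc) xcd∈
    ... | no none = ⊥-elim (true≢false (X-sum Xa Xc λ { refl → none (b , Xb , xab∈) }) (proj₂ (proj₂ Xac)))
      where
      Xac : X (a ⊕ c)
      Xac = boundary (proj₁ Xc , X-zero Xc , λ d Xd → ≢true⇒false λ xcd∈ → none (d , Xd , xcd∈)) (proj₁ Xa) Xb xa∉ xab∈

    Stab? : ∀ s → Dec (s ∈ U × (∀ c → X c → X (c ⊕ s)))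
    Stab? s = (U s B.≟ true) ×-dec all-vect? (λ c → X? c →-dec X? (c ⊕ s))

    Stab : Subset n
    Stab s = does (Stab? s)

    -- Translations that preserve `X` preserve the values of `f` on `U` off `Stab`, so a nonzero
    -- `Stab` would decompose `U`. It is proper because `a + a` is 0, which is not in `X`.
    stab-trivial : ∀ s → s ∈ Stab → s ≡ 0v
    stab-trivial s s∈ with s ≟ᵛ 0v
    ... | yes s≡0 = s≡0
    ... | no s≢0 = ⊥-elim (ind Stab (sub , (λ t t∈ → proj₁ (does-sound (Stab? t) t∈)) , (s , s≢0 , s∈)
        , (a , proj₁ Xa , ≢true⇒false λ a∈ → proj₁ (proj₂ (proj₂ (does-sound (Stab? a) a∈) a Xa)) (⊕-self a)) , inv))
      where
      sub : IsSubspace Stab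
      sub = dec-true (Stab? 0v) (proj₁ subU , λ c → subst X (sym (⊕-identityʳ c))) ,
        λ s t s∈ t∈ → let (s∈U , hs) = does-sound (Stab? s) s∈ ; (t∈U , ht) = does-sound (Stab? t) t∈ in
          dec-true (Stab? (s ⊕ t)) (cloU s∈U t∈U , λ c Xc → subst X (⊕-assoc c s t) (ht (c ⊕ s) (hs c Xc)))
      inv : ∀ y d → y ∈ U → y ∉ Stab → d ∈ Stab → f (y ⊕ d) ≡ f y
      inv y d y∈U y∉ d∈ with f y in fy | f (y ⊕ d) in fyd
      ... | true  | true  = refl
      ... | false | false = refl
      ... | false | true  = ⊥-elim (true≢false fyd (proj₂ (proj₂ (proj₂ (does-sound (Stab? d) d∈) y
        (y∈U , (λ { refl → true≢false (proj₁ sub) y∉ }) , fy)))))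
      ... | true  | false = ⊥-elim (true≢false fy (proj₂ (proj₂
        (subst X (solve 2 (λ y d → (y :⊕ d) :⊕ d ⊜ y) refl y d) (proj₂ (does-sound (Stab? d) d∈) (y ⊕ d)
          (cloU y∈U (proj₁ (does-sound (Stab? d) d∈))
          , (λ z → true≢false d∈ (trans (cong Stab (sym (⊕≡0⇒≡ z))) y∉)) , fyd))))))

    copy : Copy f U x
    copy u u∈U u≢0 with f u in fu
    ... | false = X-zero (u∈U , u≢0 , fu)
    -- Were `x + u` a zero, then `u` would be full: a neighbour with value 1 would make `u` a zero,
    -- by `boundary` from the full vertex 0. A full vertex fixes `X` and is therefore 0.
    ... | true  = ≢false⇒true λ xu∉ → u≢0 (stab-trivial u (dec-true (Stab? u) (u∈U , λ c →
      full-shifts-X (u∈U , xu∉ , λ d Xd → ≢true⇒false λ xud∈ → true≢false fu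
        (trans (cong f (sym (⊕-identityʳ u))) (proj₂ (proj₂ (boundary full-0 u∈U Xd xu∉ xud∈))))))))

  -- If `a` is not a period, some `m` sees a change along `a`. By `single`, `m` or `m + a` is a zero
  -- of `f`, and this zero serves as `b` in `Copied`, after translation of `x` by `a` if necessary.
  coset-kind : ∀ x a → X a → x ∉ f → (x ⊕ a) ∉ f →
    (∀ u → u ∈ U → (x ⊕ u) ∉ f) ⊎ (∃[ w ] (w ∈ U × Copy f U (x ⊕ w)))
  coset-kind x a Xa@(a∈U , a≢0 , a∉f) x∉f xa∉
    with any-vect? (λ m → (U m B.≟ true) ×-dec ¬? (f (x ⊕ (m ⊕ a)) B.≟ f (x ⊕ m)))
  ... | no none = inj₁ (Constant.constant x a Xa x∉f λ u u∈U → decided u u∈U)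
    where
    decided : ∀ u → u ∈ U → f (x ⊕ (u ⊕ a)) ≡ f (x ⊕ u)
    decided u u∈U with f (x ⊕ (u ⊕ a)) B.≟ f (x ⊕ u)
    ... | yes eq = eq
    ... | no ne  = ⊥-elim (none (u , u∈U , ne))
  ... | yes (m , m∈U , ne) = inj₂ (from (f m B.≟ false) (f (m ⊕ a) B.≟ false))
    where
    from-b : ∀ b → X b → f (x ⊕ (b ⊕ a)) ≢ f (x ⊕ b) → ∃[ w ] (w ∈ U × Copy f U (x ⊕ w))
    from-b b Xb ne with f (x ⊕ b) in xb | f (x ⊕ (b ⊕ a)) in xba
    ... | true  | true  = ⊥-elim (ne refl)
    ... | false | false = ⊥-elim (ne refl)
    ... | false | true  = 0v , proj₁ subU , subst (Copy f U) (sym (⊕-identityʳ x))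
      (Copied.copy x a b Xa Xb x∉f xa∉ xb (trans (cong (λ v → f (x ⊕ v)) (⊕-comm a b)) xba))
    ... | true  | false = a , a∈U , Copied.copy (x ⊕ a) a b Xa Xb xa∉
      (trans (cong f (solve 2 (λ x a → (x :⊕ a) :⊕ a ⊜ x) refl x a)) x∉f)
      (trans (cong f (solve 3 (λ x a b → (x :⊕ a) :⊕ b ⊜ x :⊕ b :⊕ a) refl x a b)) xba)
      (trans (cong f (solve 3 (λ x a b → (x :⊕ a) :⊕ a :⊕ b ⊜ x :⊕ b) refl x a b)) xb)
    m≢0 : m ≢ 0v
    m≢0 refl = ne (trans (trans (cong (λ v → f (x ⊕ v)) (⊕-identityˡ a)) xa∉) (sym (trans (cong f (⊕-identityʳ x)) x∉f)))
    ma≢0 : m ⊕ a ≢ 0v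
    ma≢0 z with ⊕≡0⇒≡ z
    ... | refl = ne (trans (trans (cong f (solve 2 (λ x a → x :⊕ a :⊕ a ⊜ x) refl x a)) x∉f) (sym xa∉))
    from : Dec (f m ≡ false) → Dec (f (m ⊕ a) ≡ false) → ∃[ w ] (w ∈ U × Copy f U (x ⊕ w))
    from (yes m∉f) _ = from-b m (m∈U , m≢0 , m∉f) ne
    from (no _) (yes ma∉f) = from-b (m ⊕ a) (cloU m∈U a∈U , ma≢0 , ma∉f)
      λ eq → ne (sym (trans (cong f (solve 3 (λ x m a → x :⊕ m ⊜ x :⊕ (m :⊕ a) :⊕ a) refl x m a)) eq))
    from (no m∈) (no ma∈) with f (x ⊕ m) in xm | f (x ⊕ (m ⊕ a)) in xma
    ... | true  | true  = ⊥-elim (ne refl)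
    ... | false | false = ⊥-elim (ne refl)
    ... | true  | false = ⊥-elim (single x m a m a∉f (≢false⇒true m∈) (trans (cong f (⊕-comm a m)) (≢false⇒true ma∈)) xm xma
      (trans (cong f (solve 2 (λ x m → x :⊕ m :⊕ m ⊜ x) refl x m)) x∉f)
      (trans (cong f (solve 3 (λ x m a → x :⊕ m :⊕ a :⊕ m ⊜ x :⊕ a) refl x m a)) xa∉))
    ... | false | true  = ⊥-elim (single x (m ⊕ a) a m a∉f (≢false⇒true m∈) (trans (cong f (⊕-comm a m)) (≢false⇒true ma∈)) xma
      (trans (cong f (solve 3 (λ x m a → x :⊕ (m :⊕ a) :⊕ a ⊜ x :⊕ m) refl x m a)) xm)
      (trans (cong f (solve 3 (λ x m a → x :⊕ (m :⊕ a) :⊕ m ⊜ x :⊕ a) refl x m a)) xa∉)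
      (trans (cong f (solve 3 (λ x m a → x :⊕ (m :⊕ a) :⊕ a :⊕ m ⊜ x) refl x m a)) x∉f))


-- Growing an indecomposable subspace from an anti-claw

record AntiClaw (f : Subset n) (a b c : Vect n) : Set where
  field
    a∉   : a ∉ f
    b∉   : b ∉ f
    c∉   : c ∉ f
    ab∈  : (a ⊕ b) ∈ f
    ac∈  : (a ⊕ c) ∈ f
    bc∈  : (b ⊕ c) ∈ f
    abc∈ : (a ⊕ (b ⊕ c)) ∈ f

module TriangleFreeCase {n : ℕ} {f : Subset n} (f0 : 0v ∉ f) (cf : NoClaw f)
  (noBi : ∀ {a₁ a₂ b₁ b₂} → ¬ BiTriangle f a₁ a₂ b₁ b₂)
  {k₁ k₂ k₃ : Vect n} (K : AntiClaw f k₁ k₂ k₃) where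

  open AntiClaw K renaming (a∉ to k₁∉; b∉ to k₂∉; c∉ to k₃∉; ab∈ to k₁₂∈; ac∈ to k₁₃∈; bc∈ to k₂₃∈; abc∈ to k₁₂₃∈)

  E⇒≢0 : ∀ {u} → u ∈ f → u ≢ 0v
  E⇒≢0 u∈f refl = true≢false u∈f f0

  k₁≢0 : k₁ ≢ 0v
  k₁≢0 refl = true≢false k₁₂∈ (trans (cong f (⊕-identityˡ k₂)) k₂∉)

  k₂≢0 : k₂ ≢ 0v
  k₂≢0 refl = true≢false k₁₂∈ (trans (cong f (⊕-identityʳ k₁)) k₁∉)

  k₃≢0 : k₃ ≢ 0v
  k₃≢0 refl = true≢false k₁₃∈ (trans (cong f (⊕-identityʳ k₁)) k₁∉)

  k₁≢k₂ : k₁ ≢ k₂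
  k₁≢k₂ refl = true≢false k₁₂∈ (trans (cong f (⊕-self k₁)) f0)

  -- The anti-claw stays inside `U` to supply explicit zeros and ones for claws, and in particular a
  -- nonzero zero different from any given vector.
  record Good (U : Subset n) : Set where
    field
      sub  : IsSubspace U
      ind  : Indecomposable f U
      tri  : TriFree f U
      k₁∈U : k₁ ∈ U
      k₂∈U : k₂ ∈ U
      k₃∈U : k₃ ∈ U

  module Extension {U : Subset n} (G : Good U) where
    open Good G
    open CosetWithEmptyTriangle f0 cf noBi sub ind tri using (X; cloU; X-sum; coset-kind)

    0∈U : 0v ∈ U
    0∈U = proj₁ sub

    Xk₁ : X k₁
    Xk₁ = k₁∈U , k₁≢0 , k₁∉

    Xk₂ : X k₂
    Xk₂ = k₂∈U , k₂≢0 , k₂∉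

    another-X : ∀ w → ∃[ v ] (X v × v ≢ w)
    another-X w with k₁ ≟ᵛ w
    ... | no k₁≢w  = k₁ , Xk₁ , k₁≢w
    ... | yes refl = k₂ , Xk₂ , k₁≢k₂ ∘ sym

    copy-0 : Copy f U 0v
    copy-0 u _ _ = cong f (⊕-identityˡ u)

    -- Otherwise `{0, w}` decomposes `U`; it is proper because `U` has a nonzero zero other than
    -- `w`.
    shift-trivial : ∀ w → w ∈ U → (∀ u → u ∈ U → u ≢ 0v → u ≢ w → f (u ⊕ w) ≡ f u) → w ≡ 0v
    shift-trivial w w∈U inv with w ≟ᵛ 0v
    ... | yes w≡0 = w≡0
    ... | no w≢0 = ⊥-elim (ind D (subD , D⊆U , (w , w≢0 , adj-self ⟨0⟩ w ⟨0⟩-subspace) , (v , proj₁ Xv , v∉D) , invD))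
      where
      D : Subset n
      D = adj ⟨0⟩ w
      subD : IsSubspace D
      subD = adj-subspace ⟨0⟩ w ⟨0⟩-subspace
      elim : ∀ {d} → d ∈ D → d ≡ 0v ⊎ d ≡ w
      elim {d} d∈ with adj-elim ⟨0⟩ w d d∈
      ... | inj₁ p = inj₁ (does-sound (d ≟ᵛ 0v) p)
      ... | inj₂ p = inj₂ (⊕≡0⇒≡ (does-sound (d ⊕ w ≟ᵛ 0v) p))
      D⊆U : ∀ d → d ∈ D → d ∈ U
      D⊆U d d∈ with elim {d} d∈
      ... | inj₁ refl = 0∈U
      ... | inj₂ refl = w∈U
      v = proj₁ (another-X w)
      Xv = proj₁ (proj₂ (another-X w))
      v∉D : v ∉ D
      v∉D = ≢true⇒false λ v∈ → [ proj₁ (proj₂ Xv) , proj₂ (proj₂ (another-X w)) ]′ (elim {v} v∈)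
      invD : ∀ x d → x ∈ U → x ∉ D → d ∈ D → f (x ⊕ d) ≡ f x
      invD x d x∈U x∉D d∈ with elim {d} d∈
      ... | inj₁ refl = cong f (⊕-identityʳ x)
      ... | inj₂ refl = inv x x∈U (λ { refl → true≢false (proj₁ subD) x∉D })
        (λ { refl → true≢false (adj-self ⟨0⟩ w ⟨0⟩-subspace) x∉D })

    -- Two copies in one coset show `f` to be invariant under translation by `d + e`, away from 0
    -- and `d + e`.
    copy-unique : ∀ {d e} → Copy f U d → Copy f U e → (d ⊕ e) ∈ U → d ≡ e
    copy-unique {d} {e} cd ce de∈U = ⊕≡0⇒≡ (shift-trivial (d ⊕ e) de∈U λ u u∈U u≢0 u≢w →
      trans (sym (ce (u ⊕ (d ⊕ e)) (cloU u∈U de∈U) (≢⇒⊕≢0 u≢w)))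
            (trans (cong f (solve 3 (λ d e u → e :⊕ u :⊕ d :⊕ e ⊜ d :⊕ u) refl d e u)) (cd u u∈U u≢0)))

    copy-in-U : ∀ v → v ∈ U → Copy f U v → v ≡ 0v
    copy-in-U v v∈U cv = copy-unique cv copy-0 (cloU v∈U 0∈U)

    Kind : Vect n → Set
    Kind x = Const f U x ⊎ ∃[ w ] (w ∈ U × Copy f U (x ⊕ w))

    copy? : ∀ d → Dec (Copy f U d)
    copy? d = all-vect? λ u → (U u B.≟ true) →-dec (¬? (u ≟ᵛ 0v) →-dec (f (d ⊕ u) B.≟ f u))

    const? : ∀ x → Dec (Const f U x)
    const? x = all-vect? λ u → (U u B.≟ true) →-dec (f (x ⊕ u) B.≟ f x)

    kind? : ∀ x → Dec (Kind x)
    kind? x with const? x | any-vect? (λ w → (U w B.≟ true) ×-dec copy? (x ⊕ w))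
    ... | yes c | _     = yes (inj₁ c)
    ... | no _  | yes c = yes (inj₂ c)
    ... | no ¬c | no ¬d = no [ ¬c , ¬d ]′

    const-shift : ∀ {x u} → u ∈ U → Const f U (x ⊕ u) → Const f U x
    const-shift {x} {u} u∈U c v v∈U = trans (to v v∈U) (trans (sym (to 0v 0∈U)) (cong f (⊕-identityʳ x)))
      where
      to : ∀ v → v ∈ U → f (x ⊕ v) ≡ f (x ⊕ u)
      to v v∈U = trans (cong f (solve 3 (λ x u v → x :⊕ v ⊜ (x :⊕ u) :⊕ u :⊕ v) refl x u v)) (c (u ⊕ v) (cloU u∈U v∈U))

    kind-shift : ∀ {x u} → u ∈ U → Kind (x ⊕ u) → Kind x
    kind-shift u∈U (inj₁ c) = inj₁ (const-shift u∈U c)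
    kind-shift {x} {u} u∈U (inj₂ (w , w∈U , c)) = inj₂ (u ⊕ w , cloU u∈U w∈U , subst (Copy f U) (⊕-assoc x u w) c)

    kind-zero : ∀ {x a} → X a → x ∉ f → (x ⊕ a) ∉ f → Kind x
    kind-zero {x} {a} Xa x∉f xa∉f with coset-kind x a Xa x∉f xa∉f
    ... | inj₁ c = inj₁ λ u u∈U → trans (c u u∈U) (sym x∉f)
    ... | inj₂ c = inj₂ c

    -- By `indecomposable-meets`, a decomposer of the larger space makes the new coset constant or
    -- gives it a centre. An empty triangle not inside `U` has one point in `U` and two in the new
    -- coset, where `kind-zero` applies.
    good-adj : ∀ x → ¬ Kind x → Good (adj U x)
    good-adj x ¬kind = record
      { sub = adj-subspace U x sub ; ind = ind' ; tri = tri'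
      ; k₁∈U = adj-⊇ U x _ k₁∈U ; k₂∈U = adj-⊇ U x _ k₂∈U ; k₃∈U = adj-⊇ U x _ k₃∈U }
      where
      ind' : Indecomposable f (adj U x)
      ind' D dec@(_ , D⊆ , (d , d≢0 , d∈D) , (v , v∈ , v∉D) , inv)
        with indecomposable-meets ind sub (adj-⊇ U x) dec
      ... | inj₁ U⊆D = ¬kind (inj₁ (const-shift (in-coset v∈ (λ v∈U → true≢false (U⊆D v v∈U) v∉D))
          (subst (Const f U) (solve 2 (λ v x → v ⊜ x :⊕ v :⊕ x) refl v x) λ u u∈U → inv v u v∈ v∉D (U⊆D u u∈U))))
        where
        in-coset : ∀ {v} → v ∈ adj U x → ¬ (v ∈ U) → (v ⊕ x) ∈ U
        in-coset {v} v∈ v∉U = [ ⊥-elim ∘ v∉U , (λ p → p) ]′ (adj-elim U x v v∈)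
      ... | inj₂ U∩D with adj-elim U x d (D⊆ d d∈D)
      ...   | inj₁ d∈U = true≢false d∈D (U∩D d d∈U d≢0)
      ...   | inj₂ dx∈U = ¬kind (inj₂ (d ⊕ x , dx∈U , subst (Copy f U) (solve 2 (λ d x → d ⊜ x :⊕ d :⊕ x) refl d x)
          λ u u∈U u≢0 → trans (cong f (⊕-comm d u)) (inv u d (adj-⊇ U x u u∈U) (U∩D u u∈U u≢0) d∈D)))
      tri' : TriFree f (adj U x)
      tri' p q p∈ q∈ p≢0 q≢0 p≢q p∉f q∉f = ≢false⇒true λ pq∉f →
        ¬kind (aux pq∉f (adj-elim U x p p∈) (adj-elim U x q q∈))
        where
        from : ∀ {v} → (v ⊕ x) ∈ U → Kind v → Kind x
        from {v} vx∈U kv = kind-shift vx∈U (subst Kind (solve 2 (λ v x → v ⊜ x :⊕ v :⊕ x) refl v x) kv)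
        aux : (p ⊕ q) ∉ f → p ∈ U ⊎ (p ⊕ x) ∈ U → q ∈ U ⊎ (q ⊕ x) ∈ U → Kind x
        aux pq∉f (inj₁ p∈U) (inj₁ q∈U) = ⊥-elim (true≢false (tri p q p∈U q∈U p≢0 q≢0 p≢q p∉f q∉f) pq∉f)
        aux pq∉f (inj₁ p∈U) (inj₂ qx∈U) =
          from qx∈U (kind-zero (p∈U , p≢0 , p∉f) q∉f (trans (cong f (⊕-comm q p)) pq∉f))
        aux pq∉f (inj₂ px∈U) (inj₁ q∈U) = from px∈U (kind-zero (q∈U , q≢0 , q∉f) p∉f pq∉f)
        aux pq∉f (inj₂ px∈U) (inj₂ qx∈U) = from px∈U (kind-zero
          (subst (_∈ U) (solve 3 (λ p q x → (p :⊕ x) :⊕ q :⊕ x ⊜ p :⊕ q) refl p q x) (cloU px∈U qx∈U)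
          , ≢⇒⊕≢0 p≢q , pq∉f) p∉f (trans (cong f (⊕-cancel p q)) q∉f))

    -- This is the failure of the centres to be closed under addition: the coset of `d₁ + d₂` is a
    -- copy, but its centre `d₃` is displaced by `w`. The values in such a triple turn out to be
    -- rigid enough for the span of `U`, `d₁`, `d₂` to have no empty triangle.
    record CopyTriple (d₁ d₂ d₃ w : Vect n) : Set where
      field
        copy₁ : Copy f U d₁
        copy₂ : Copy f U d₂
        copy₃ : Copy f U d₃
        w∈U   : w ∈ U
        w≢0   : w ≢ 0v
        sum   : d₁ ⊕ (d₂ ⊕ d₃) ≡ w

      third : ∀ {u} → u ∈ U → w ⊕ u ≢ 0v → f (d₁ ⊕ (d₂ ⊕ u)) ≡ f (w ⊕ u)
      third {u} u∈U wu≢0 = trans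
        (cong f (trans (solve 4 (λ d₁ d₂ d₃ u → d₁ :⊕ d₂ :⊕ u ⊜ d₃ :⊕ (d₁ :⊕ d₂ :⊕ d₃) :⊕ u) refl d₁ d₂ d₃ u)
                       (cong (λ s → d₃ ⊕ (s ⊕ u)) sum)))
        (copy₃ (w ⊕ u) (cloU w∈U u∈U) wu≢0)

      third-0 : f (d₁ ⊕ d₂) ≡ f w
      third-0 = trans (cong (λ v → f (d₁ ⊕ v)) (sym (⊕-identityʳ d₂)))
        (trans (third 0∈U (λ z → w≢0 (trans (sym (⊕-identityʳ w)) z))) (cong f (⊕-identityʳ w)))

      -- If `w` is a zero and `v` another one, `w + v` is a one by triangle-freeness, and its images
      -- in the three cosets generate a claw.
      w∈f : w ∈ f
      w∈f = ≢false⇒true λ w∉f → aux w∉f (another-X w)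
        where
        aux : w ∉ f → ∃[ v ] (X v × v ≢ w) → ⊥
        aux w∉f (v , Xv@(v∈U , v≢0 , v∉f) , v≢w) =
          claw-at cf (d₁ ∷ d₂ ∷ w ∷ v ∷ []) (I ∷ O ∷ I ∷ I ∷ []) (O ∷ I ∷ I ∷ I ∷ []) (I ∷ I ∷ O ∷ I ∷ [])
            (trans (copy₁ _ wv∈U wv≢0) wv∈) (trans (copy₂ _ wv∈U wv≢0) wv∈) (trans (third v∈U wv≢0) wv∈)
            (trans third-0 w∉f) (trans (copy₂ w w∈U w≢0) w∉f) (trans (copy₁ w w∈U w≢0) w∉f) v∉f
          where
          wv∈ = X-sum (w∈U , w≢0 , w∉f) Xv (v≢w ∘ sym)
          wv∈U = cloU w∈U v∈U
          wv≢0 = E⇒≢0 wv∈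

    open CopyTriple

    swap₁₂ : ∀ {d₁ d₂ d₃ w} → CopyTriple d₁ d₂ d₃ w → CopyTriple d₂ d₁ d₃ w
    swap₁₂ {d₁} {d₂} {d₃} t = record
      { copy₁ = copy₂ t ; copy₂ = copy₁ t ; copy₃ = copy₃ t ; w∈U = w∈U t ; w≢0 = w≢0 t
      ; sum = trans (solve 3 (λ a b c → b :⊕ a :⊕ c ⊜ a :⊕ b :⊕ c) refl d₁ d₂ d₃) (sum t) }

    swap₂₃ : ∀ {d₁ d₂ d₃ w} → CopyTriple d₁ d₂ d₃ w → CopyTriple d₁ d₃ d₂ w
    swap₂₃ {d₁} {d₂} {d₃} t = record
      { copy₁ = copy₁ t ; copy₂ = copy₃ t ; copy₃ = copy₂ t ; w∈U = w∈U t ; w≢0 = w≢0 t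
      ; sum = trans (solve 3 (λ a b c → a :⊕ c :⊕ b ⊜ a :⊕ b :⊕ c) refl d₁ d₂ d₃) (sum t) }

    module ZeroTriple {d₁ d₂ d₃ w : Vect n} (t : CopyTriple d₁ d₂ d₃ w) {a b : Vect n} (Xa : X a) (Xb : X b)
      (Xc : X (a ⊕ (b ⊕ w))) where

      a≢b : a ≢ b
      a≢b refl = true≢false (w∈f t) (trans (cong f (sym (⊕-cancel a w))) (proj₂ (proj₂ Xc)))

      ab∈ : (a ⊕ b) ∈ f
      ab∈ = X-sum Xa Xb a≢b

      abw∉ : (w ⊕ (a ⊕ b)) ∉ f
      abw∉ = trans (cong f (solve 3 (λ a b w → w :⊕ a :⊕ b ⊜ a :⊕ b :⊕ w) refl a b w)) (proj₂ (proj₂ Xc))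

      bw∈ : (w ⊕ b) ∈ f
      bw∈ = trans (cong f (solve 3 (λ a b w → w :⊕ b ⊜ a :⊕ a :⊕ b :⊕ w) refl a b w)) (X-sum Xa Xc λ a≡c →
        true≢false (w∈f t) (trans (cong f (trans (solve 3 (λ a b w → w ⊜ (a :⊕ a :⊕ b :⊕ w) :⊕ b) refl a b w)
          (trans (cong (λ c → (a ⊕ c) ⊕ b) (sym a≡c)) (solve 2 (λ a b → (a :⊕ a) :⊕ b ⊜ b) refl a b)))) (proj₂ (proj₂ Xb))))

      aw∈ : (w ⊕ a) ∈ f
      aw∈ = trans (cong f (solve 3 (λ a b w → w :⊕ a ⊜ b :⊕ a :⊕ b :⊕ w) refl a b w)) (X-sum Xb Xc λ b≡c →
        true≢false (w∈f t) (trans (cong f (trans (solve 3 (λ a b w → w ⊜ (b :⊕ a :⊕ b :⊕ w) :⊕ a) refl a b w)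
          (trans (cong (λ c → (b ⊕ c) ⊕ a) (sym b≡c)) (solve 2 (λ a b → (b :⊕ b) :⊕ a ⊜ a) refl a b)))) (proj₂ (proj₂ Xa))))

      on-copy : ∀ {d c} → Copy f U d → X c → (d ⊕ c) ∉ f
      on-copy cd (c∈U , c≢0 , c∉f) = trans (cd _ c∈U c≢0) c∉f

      d₁ab∈ : ∀ {d} → Copy f U d → (d ⊕ (a ⊕ b)) ∈ f
      d₁ab∈ cd = trans (cd _ (cloU (proj₁ Xa) (proj₁ Xb)) (E⇒≢0 ab∈)) ab∈

      d₁₂a∈ : (d₁ ⊕ (d₂ ⊕ a)) ∈ f
      d₁₂a∈ = trans (third t (proj₁ Xa) (E⇒≢0 aw∈)) aw∈

      d₁₂b∈ : (d₁ ⊕ (d₂ ⊕ b)) ∈ f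
      d₁₂b∈ = trans (third t (proj₁ Xb) (E⇒≢0 bw∈)) bw∈

      d₁₂ab∉ : (d₁ ⊕ (d₂ ⊕ (a ⊕ b))) ∉ f
      d₁₂ab∉ = trans (third t (cloU (proj₁ Xa) (proj₁ Xb))
        λ z → proj₁ (proj₂ Xc) (trans (solve 3 (λ a b w → a :⊕ b :⊕ w ⊜ w :⊕ a :⊕ b) refl a b w) z)) abw∉

      d₁∉ : d₁ ∉ f
      d₁∉ = ≢true⇒false λ d₁∈ →
        claw-at cf (d₁ ∷ d₂ ∷ a ∷ b ∷ []) (I ∷ O ∷ O ∷ O ∷ []) (O ∷ I ∷ I ∷ I ∷ []) (I ∷ I ∷ O ∷ I ∷ [])
          d₁∈ (d₁ab∈ (copy₂ t)) d₁₂b∈ d₁₂ab∉ (on-copy (copy₂ t) Xb) (on-copy (copy₁ t) Xa) (proj₂ (proj₂ Xa))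

    -- Three zeros of `U` with sum `w` would determine `f` on the span of `d₁`, `d₂`, `a`, `b`: its
    -- ones are the triangles `a + b`, `d₁ + d₂ + a`, `d₁ + d₂ + b` and `d₁ + d₂`, `d₁ + a + b`,
    -- `d₂ + a + b`.
    no-zero-triple : ∀ {d₁ d₂ d₃ w a b} → CopyTriple d₁ d₂ d₃ w → X a → X b → ¬ X (a ⊕ (b ⊕ w))
    no-zero-triple {d₁} {d₂} {d₃} {w} {a} {b} t Xa Xb Xc = noBi {a ⊕ b} {d₁ ⊕ (d₂ ⊕ a)} {d₁ ⊕ d₂} {d₁ ⊕ (a ⊕ b)} (record
      { a₁∈ = ab∈ ; a₂∈ = d₁₂a∈
      ; a₁₂∈ = trans (cong f (solve 4 (λ d₁ d₂ a b → (a :⊕ b) :⊕ d₁ :⊕ d₂ :⊕ a ⊜ d₁ :⊕ d₂ :⊕ b) refl d₁ d₂ a b)) d₁₂b∈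
      ; b₁∈ = trans (third-0 t) (w∈f t) ; b₂∈ = d₁ab∈ (copy₁ t)
      ; b₁₂∈ = trans (cong f (solve 4 (λ d₁ d₂ a b → (d₁ :⊕ d₂) :⊕ d₁ :⊕ a :⊕ b ⊜ d₂ :⊕ a :⊕ b) refl d₁ d₂ a b)) (d₁ab∈ (copy₂ t))
      ; a₁b₁∉ = trans (cong f (solve 4 (λ d₁ d₂ a b → (a :⊕ b) :⊕ d₁ :⊕ d₂ ⊜ d₁ :⊕ d₂ :⊕ a :⊕ b) refl d₁ d₂ a b)) d₁₂ab∉
      ; a₁b₂∉ = trans (cong f (solve 4 (λ d₁ d₂ a b → (a :⊕ b) :⊕ d₁ :⊕ a :⊕ b ⊜ d₁) refl d₁ d₂ a b)) d₁∉
      ; a₁b₁₂∉ = trans (cong f (solve 4 (λ d₁ d₂ a b → (a :⊕ b) :⊕ (d₁ :⊕ d₂) :⊕ d₁ :⊕ a :⊕ b ⊜ d₂) refl d₁ d₂ a b))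
          (ZeroTriple.d₁∉ (swap₁₂ t) Xa Xb Xc)
      ; a₂b₁∉ = trans (cong f (solve 4 (λ d₁ d₂ a b → (d₁ :⊕ d₂ :⊕ a) :⊕ d₁ :⊕ d₂ ⊜ a) refl d₁ d₂ a b)) (proj₂ (proj₂ Xa))
      ; a₂b₂∉ = trans (cong f (solve 4 (λ d₁ d₂ a b → (d₁ :⊕ d₂ :⊕ a) :⊕ d₁ :⊕ a :⊕ b ⊜ d₂ :⊕ b) refl d₁ d₂ a b)) (on-copy (copy₂ t) Xb)
      ; a₂b₁₂∉ = trans (cong f (solve 4 (λ d₁ d₂ a b → (d₁ :⊕ d₂ :⊕ a) :⊕ (d₁ :⊕ d₂) :⊕ d₁ :⊕ a :⊕ b ⊜ d₁ :⊕ b) refl d₁ d₂ a b)) (on-copy (copy₁ t) Xb)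
      ; a₁₂b₁∉ = trans (cong f (solve 4 (λ d₁ d₂ a b → ((a :⊕ b) :⊕ d₁ :⊕ d₂ :⊕ a) :⊕ d₁ :⊕ d₂ ⊜ b) refl d₁ d₂ a b)) (proj₂ (proj₂ Xb))
      ; a₁₂b₂∉ = trans (cong f (solve 4 (λ d₁ d₂ a b → ((a :⊕ b) :⊕ d₁ :⊕ d₂ :⊕ a) :⊕ d₁ :⊕ a :⊕ b ⊜ d₂ :⊕ a) refl d₁ d₂ a b)) (on-copy (copy₂ t) Xa)
      ; a₁₂b₁₂∉ = trans (cong f (solve 4 (λ d₁ d₂ a b → ((a :⊕ b) :⊕ d₁ :⊕ d₂ :⊕ a) :⊕ (d₁ :⊕ d₂) :⊕ d₁ :⊕ a :⊕ b ⊜ d₁ :⊕ a) refl d₁ d₂ a b))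
          (on-copy (copy₁ t) Xa)
      })
      where
      open ZeroTriple t Xa Xb Xc

    -- If `d₁` is a zero, zeros `r`, `p` of `U` with `w + r`, `r + p` and `w + r + p` all ones give
    -- a claw. They are found from a zero `v` with `v + w` a one, which exists because `w` is not a
    -- period, and a second zero; `no-zero-triple` removes the remaining case.
    copy∈f : ∀ {d₁ d₂ d₃ w} → CopyTriple d₁ d₂ d₃ w → d₁ ∈ f
    copy∈f {d₁} {d₂} {d₃} {w} t = ≢false⇒true λ d₁∉f → contradiction d₁∉f
      (any-vect? λ v → (U v B.≟ true) ×-dec ¬? (v ≟ᵛ 0v) ×-dec (f v B.≟ false) ×-dec (f (v ⊕ w) B.≟ true))
      where
      claw : ∀ {r p} → d₁ ∉ f → X r → X p → (w ⊕ r) ∈ f → (r ⊕ p) ∈ f → (w ⊕ (r ⊕ p)) ∈ f → ⊥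
      claw {r} {p} d₁∉f (r∈U , r≢0 , r∉f) (p∈U , p≢0 , p∉f) wr∈ rp∈ wrp∈ =
        claw-at cf (d₁ ∷ d₂ ∷ r ∷ p ∷ []) (I ∷ I ∷ I ∷ O ∷ []) (O ∷ I ∷ I ∷ I ∷ []) (I ∷ I ∷ I ∷ I ∷ [])
          (trans (third t r∈U (E⇒≢0 wr∈)) wr∈) (trans (copy₂ t _ (cloU r∈U p∈U) (E⇒≢0 rp∈)) rp∈)
          (trans (third t (cloU r∈U p∈U) (E⇒≢0 wrp∈)) wrp∈)
          (trans (copy₁ t p p∈U p≢0) p∉f) p∉f d₁∉f (trans (copy₂ t r r∈U r≢0) r∉f)
      contradiction : d₁ ∉ f → Dec (∃[ v ] (v ∈ U × v ≢ 0v × v ∉ f × (v ⊕ w) ∈ f)) → ⊥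
      contradiction _ (no none) = w≢0 t (shift-trivial w (w∈U t) inv)
        where
        zero-shift : ∀ u → u ∈ U → u ≢ 0v → u ∉ f → (u ⊕ w) ∉ f
        zero-shift u u∈U u≢0 u∉f = ≢true⇒false λ uw∈ → none (u , u∈U , u≢0 , u∉f , uw∈)
        inv : ∀ u → u ∈ U → u ≢ 0v → u ≢ w → f (u ⊕ w) ≡ f u
        inv u u∈U u≢0 u≢w with f u in fu | f (u ⊕ w) in fuw
        ... | true  | true  = refl
        ... | false | false = refl
        ... | false | true  = ⊥-elim (true≢false fuw (zero-shift u u∈U u≢0 fu))
        ... | true  | false = ⊥-elim (true≢false fu (trans (cong f (solve 2 (λ u w → u ⊜ (u :⊕ w) :⊕ w) refl u w))
          (zero-shift (u ⊕ w) (cloU u∈U (w∈U t)) (≢⇒⊕≢0 u≢w) fuw)))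
      contradiction d₁∉f (yes (v , v∈U , v≢0 , v∉f , vw∈)) with another-X v
      ... | v' , Xv'@(v'∈U , v'≢0 , v'∉f) , v'≢v with f (v' ⊕ w) in v'w
      ...   | false = claw d₁∉f Xv Xv' (trans (cong f (⊕-comm w v)) vw∈) (X-sum Xv Xv' (v'≢v ∘ sym))
          (trans (cong f (solve 3 (λ w v v' → w :⊕ v :⊕ v' ⊜ v :⊕ v' :⊕ w) refl w v v'))
            (X-sum Xv (cloU v'∈U (w∈U t) , (λ z → true≢false (w∈f t) (trans (cong f (sym (⊕≡0⇒≡ z))) v'∉f)) , v'w)
              λ v≡ → true≢false vw∈ (trans (cong f (trans (cong (_⊕ w) v≡)
                (solve 2 (λ v' w → (v' :⊕ w) :⊕ w ⊜ v') refl v' w))) v'∉f)))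
        where
        Xv : X v
        Xv = v∈U , v≢0 , v∉f
      ...   | true with f (v ⊕ (v' ⊕ w)) in vv'w
      ...     | false = no-zero-triple t (v∈U , v≢0 , v∉f) Xv' (cloU v∈U (cloU v'∈U (w∈U t))
            , (λ z → true≢false v'w (trans (cong f (sym (⊕≡0⇒≡ z))) v∉f)) , vv'w)
      ...     | true = claw d₁∉f Xv' (v∈U , v≢0 , v∉f) (trans (cong f (⊕-comm w v')) v'w)
            (X-sum Xv' (v∈U , v≢0 , v∉f) v'≢v)
            (trans (cong f (solve 3 (λ w v v' → w :⊕ v' :⊕ v ⊜ v :⊕ v' :⊕ w) refl w v v')) vv'w)

    -- The vector is `d₃ + (u + u' + w)`: either the centre `d₃`, which is a one, or the copy of a
    -- nonzero vector that `no-zero-triple` prevents from being a zero.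
    cross : ∀ {d₁ d₂ d₃ w} → CopyTriple d₁ d₂ d₃ w → ∀ {u u'} → X u → X u' → ((d₁ ⊕ u) ⊕ (d₂ ⊕ u')) ∈ f
    cross {d₁} {d₂} {d₃} {w} t {u} {u'} Xu Xu' = trans (cong f shape) value
      where
      shape : (d₁ ⊕ u) ⊕ (d₂ ⊕ u') ≡ d₃ ⊕ (u ⊕ (u' ⊕ w))
      shape = trans (solve 5 (λ d₁ d₂ d₃ u u' → (d₁ :⊕ u) :⊕ d₂ :⊕ u' ⊜ d₃ :⊕ u :⊕ u' :⊕ d₁ :⊕ d₂ :⊕ d₃) refl d₁ d₂ d₃ u u')
                    (cong (λ s → d₃ ⊕ (u ⊕ (u' ⊕ s))) (sum t))
      c∈U : (u ⊕ (u' ⊕ w)) ∈ U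
      c∈U = cloU (proj₁ Xu) (cloU (proj₁ Xu') (w∈U t))
      value : (d₃ ⊕ (u ⊕ (u' ⊕ w))) ∈ f
      value with u ⊕ (u' ⊕ w) ≟ᵛ 0v
      ... | yes z = trans (cong f (trans (cong (d₃ ⊕_) z) (⊕-identityʳ d₃))) (copy∈f (swap₁₂ (swap₂₃ t)))
      ... | no c≢0 = trans (copy₃ t _ c∈U c≢0) (≢false⇒true λ c∉f → no-zero-triple t Xu Xu' (c∈U , c≢0 , c∉f))

    module Pair {d₁ d₂ : Vect n} (c₁ : Copy f U d₁) (c₂ : Copy f U d₂) (¬c₁₂ : ¬ Copy f U (d₁ ⊕ d₂)) where

      W : Subset n
      W = adj (adj U d₁) d₂

      U⊆W : ∀ v → v ∈ U → v ∈ W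
      U⊆W v v∈U = adj-⊇ (adj U d₁) d₂ v (adj-⊇ U d₁ v v∈U)

      subW : IsSubspace W
      subW = adj-subspace (adj U d₁) d₂ (adj-subspace U d₁ sub)

      d₁∈W : d₁ ∈ W
      d₁∈W = adj-⊇ (adj U d₁) d₂ d₁ (adj-self U d₁ sub)

      d₂∈W : d₂ ∈ W
      d₂∈W = adj-self (adj U d₁) d₂ (adj-subspace U d₁ sub)

      not-const : ∀ {d} → Copy f U d → ¬ Const f U d
      not-const c k = true≢false
        (trans (c _ k₁₂∈U (E⇒≢0 k₁₂∈)) k₁₂∈)
        (trans (k _ k₁₂∈U) (trans (sym (k k₁ k₁∈U)) (trans (c k₁ k₁∈U k₁≢0) k₁∉)))
        where
        k₁₂∈U = cloU k₁∈U k₂∈U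

      cosets : ∀ {v} → v ∈ W → v ∈ U ⊎ (v ⊕ d₁) ∈ U ⊎ (v ⊕ d₂) ∈ U ⊎ ((v ⊕ d₂) ⊕ d₁) ∈ U
      cosets {v} v∈ with adj-elim (adj U d₁) d₂ v v∈
      ... | inj₁ p with adj-elim U d₁ v p
      ...   | inj₁ q = inj₁ q
      ...   | inj₂ q = inj₂ (inj₁ q)
      cosets {v} v∈ | inj₂ p with adj-elim U d₁ (v ⊕ d₂) p
      ...   | inj₁ q = inj₂ (inj₂ (inj₁ q))
      ...   | inj₂ q = inj₂ (inj₂ (inj₂ q))

      -- A decomposer containing `U` contains `d₁` and `d₂`, whose cosets are not constant. One that
      -- meets `U` trivially consists of centres and carries centres to centres; by `copy-unique`
      -- its nonzero vector is `d₁`, `d₂` or `d₁ + d₂`, and each time `d₁ + d₂` becomes a centre.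
      ind' : Indecomposable f W
      ind' D dec@((_ , cloD) , D⊆W , (d , d≢0 , d∈D) , (v , v∈W , v∉D) , inv)
        with indecomposable-meets ind sub U⊆W dec
      ... | inj₁ U⊆D = true≢false v∈D v∉D
        where
        copy∈D : ∀ {e} → e ∈ W → Copy f U e → e ∈ D
        copy∈D {e} e∈W ce = ≢false⇒true λ e∉D → not-const ce λ u u∈U → inv e u e∈W e∉D (U⊆D u u∈U)
        v∈D : v ∈ D
        v∈D with cosets v∈W
        ... | inj₁ p = U⊆D v p
        ... | inj₂ (inj₁ p) = subst (_∈ D) (solve 2 (λ v d → (v :⊕ d) :⊕ d ⊜ v) refl v d₁)
          (cloD _ _ (U⊆D _ p) (copy∈D d₁∈W c₁))
        ... | inj₂ (inj₂ (inj₁ p)) = subst (_∈ D) (solve 2 (λ v d → (v :⊕ d) :⊕ d ⊜ v) refl v d₂)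
          (cloD _ _ (U⊆D _ p) (copy∈D d₂∈W c₂))
        ... | inj₂ (inj₂ (inj₂ p)) = subst (_∈ D) (solve 3 (λ v d e → ((v :⊕ e) :⊕ d) :⊕ d :⊕ e ⊜ v) refl v d₁ d₂)
          (cloD _ _ (U⊆D _ p) (cloD _ _ (copy∈D d₁∈W c₁) (copy∈D d₂∈W c₂)))
      ... | inj₂ U∩D = absurd (cosets (D⊆W d d∈D))
        where
        copy-of-D : ∀ {e} → e ∈ D → Copy f U e
        copy-of-D {e} e∈D u u∈U u≢0 = trans (cong f (⊕-comm e u)) (inv u e (U⊆W u u∈U) (U∩D u u∈U u≢0) e∈D)
        translate : ∀ {e} → e ∈ W → Copy f U e → Copy f U (d ⊕ e)
        translate {e} e∈W ce u u∈U u≢0 = trans (cong f (solve 3 (λ d e u → (d :⊕ e) :⊕ u ⊜ (e :⊕ u) :⊕ d) refl d e u))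
          (trans (inv (e ⊕ u) d (proj₂ subW _ _ e∈W (U⊆W u u∈U)) eu∉D d∈D) (ce u u∈U u≢0))
          where
          eu∉D : (e ⊕ u) ∉ D
          eu∉D = ≢true⇒false λ eu∈D → u≢0 (trans (sym (⊕-cancel e u)) (trans (cong (e ⊕_)
            (copy-unique (copy-of-D eu∈D) ce (subst (_∈ U) (solve 2 (λ e u → u ⊜ (e :⊕ u) :⊕ e) refl e u) u∈U))) (⊕-self e)))
        absurd : d ∈ U ⊎ (d ⊕ d₁) ∈ U ⊎ (d ⊕ d₂) ∈ U ⊎ ((d ⊕ d₂) ⊕ d₁) ∈ U → ⊥
        absurd (inj₁ p) = true≢false d∈D (U∩D d p d≢0)
        absurd (inj₂ (inj₁ p)) = ¬c₁₂ (subst (λ e → Copy f U (e ⊕ d₂)) (copy-unique (copy-of-D d∈D) c₁ p) (translate d₂∈W c₂))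
        absurd (inj₂ (inj₂ (inj₁ p))) = ¬c₁₂ (subst (Copy f U) (trans (cong (_⊕ d₁) (copy-unique (copy-of-D d∈D) c₂ p)) (⊕-comm d₂ d₁))
          (translate d₁∈W c₁))
        absurd (inj₂ (inj₂ (inj₂ p))) = ¬c₁₂ (subst (Copy f U)
          (trans (solve 2 (λ d d₂ → d ⊜ (d :⊕ d₂) :⊕ d₂) refl d d₂) (cong (_⊕ d₂) (copy-unique (translate d₂∈W c₂) c₁ p)))
          (copy-of-D d∈D))

      -- In W every zero lies in U or in a coset with a centre in E; it is then
      -- that centre plus a zero of U.
      tri-from-centres : {J : Set} (_≟_ : (i j : J) → Dec (i ≡ j)) (e : J → Vect n) →
        (∀ i → Copy f U (e i)) → (∀ i → e i ∈ f) →
        (∀ i j → i ≢ j → ∀ {u u'} → X u → X u' → ((e i ⊕ u) ⊕ (e j ⊕ u')) ∈ f) →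
        (∀ p → p ∈ W → p ∉ f → p ∈ U ⊎ ∃[ i ] ((p ⊕ e i) ∈ U)) → TriFree f W
      tri-from-centres _≟_ e ce e∈f cr loc p q p∈ q∈ p≢0 q≢0 p≢q p∉f q∉f =
        aux (loc p p∈ p∉f) (loc q q∈ q∉f)
        where
        zero-part : ∀ {p} i → (p ⊕ e i) ∈ U → p ∉ f → X (p ⊕ e i)
        zero-part {p} i pe∈U p∉f = pe∈U , pe≢0 , trans (sym (ce i _ pe∈U pe≢0))
          (trans (cong f (solve 2 (λ p e → e :⊕ p :⊕ e ⊜ p) refl p (e i))) p∉f)
          where
          pe≢0 : p ⊕ e i ≢ 0v
          pe≢0 z = true≢false (e∈f i) (trans (cong f (sym (⊕≡0⇒≡ z))) p∉f)
        mixed : ∀ {p q} i → X p → (q ⊕ e i) ∈ U → q ∉ f → (p ⊕ q) ∈ f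
        mixed {p} {q} i Xp qe∈U q∉f with p ≟ᵛ (q ⊕ e i)
        ... | yes refl = trans (cong f (solve 2 (λ q e → (q :⊕ e) :⊕ q ⊜ e) refl q (e i))) (e∈f i)
        ... | no p≢ = trans (cong f (solve 3 (λ p q e → p :⊕ q ⊜ e :⊕ p :⊕ q :⊕ e) refl p q (e i)))
          (trans (ce i _ (cloU (proj₁ Xp) qe∈U) (≢⇒⊕≢0 p≢)) (X-sum Xp (zero-part i qe∈U q∉f) p≢))
        aux : p ∈ U ⊎ ∃[ i ] ((p ⊕ e i) ∈ U) → q ∈ U ⊎ ∃[ i ] ((q ⊕ e i) ∈ U) → (p ⊕ q) ∈ f
        aux (inj₁ p∈U) (inj₁ q∈U) = tri p q p∈U q∈U p≢0 q≢0 p≢q p∉f q∉f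
        aux (inj₁ p∈U) (inj₂ (i , qe∈U)) = mixed i (p∈U , p≢0 , p∉f) qe∈U q∉f
        aux (inj₂ (i , pe∈U)) (inj₁ q∈U) = trans (cong f (⊕-comm p q)) (mixed i (q∈U , q≢0 , q∉f) pe∈U p∉f)
        aux (inj₂ (i , pe∈U)) (inj₂ (j , qe∈U)) with i ≟ j
        ... | yes refl = trans (cong f (solve 3 (λ p q e → p :⊕ q ⊜ (p :⊕ e) :⊕ q :⊕ e) refl p q (e i)))
          (X-sum (zero-part i pe∈U p∉f) (zero-part i qe∈U q∉f) λ eq → p≢q
            (trans (solve 2 (λ p e → p ⊜ (p :⊕ e) :⊕ e) refl p (e i))
              (trans (cong (_⊕ e i) eq) (solve 2 (λ q e → (q :⊕ e) :⊕ e ⊜ q) refl q (e i)))))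
        ... | no i≢j = trans (cong f (solve 4 (λ p q e e' → p :⊕ q ⊜ (e :⊕ p :⊕ e) :⊕ e' :⊕ q :⊕ e') refl p q (e i) (e j)))
          (cr i j i≢j (zero-part i pe∈U p∉f) (zero-part j qe∈U q∉f))

      module ConstSum (k : Const f U (d₁ ⊕ d₂)) where

        k₃' : ∀ {u} → u ∈ U → f (d₁ ⊕ (d₂ ⊕ u)) ≡ f (d₁ ⊕ d₂)
        k₃' {u} u∈U = trans (cong f (sym (⊕-assoc d₁ d₂ u))) (k u u∈U)

        -- The claw uses the whole anti-claw: `k₁ + k₂ + k₃` is a one that translation by the one
        -- `k₁ + k₂` carries to the zero `k₃`.
        sum∈f : (d₁ ⊕ d₂) ∈ f
        sum∈f = ≢false⇒true λ s∉ → claw-at cf (d₁ ∷ d₂ ∷ k₁ ∷ k₂ ∷ k₃ ∷ [])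
          (I ∷ O ∷ I ∷ I ∷ I ∷ []) (O ∷ I ∷ I ∷ I ∷ I ∷ []) (O ∷ O ∷ I ∷ I ∷ O ∷ [])
          (trans (c₁ _ k₁₂₃∈U (E⇒≢0 k₁₂₃∈)) k₁₂₃∈) (trans (c₂ _ k₁₂₃∈U (E⇒≢0 k₁₂₃∈)) k₁₂₃∈) k₁₂∈
          s∉ (trans (c₁ k₃ k₃∈U k₃≢0) k₃∉) (trans (c₂ k₃ k₃∈U k₃≢0) k₃∉)
          (trans (k₃' (cloU k₁∈U k₂∈U)) s∉)
          where
          k₁₂₃∈U = cloU k₁∈U (cloU k₂∈U k₃∈U)

        d₁∈f : d₁ ∈ f
        d₁∈f = ≢false⇒true λ d₁∉ → claw-at cf (d₁ ∷ d₂ ∷ k₁ ∷ k₂ ∷ [])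
          (O ∷ I ∷ I ∷ I ∷ []) (I ∷ I ∷ O ∷ I ∷ []) (I ∷ I ∷ I ∷ I ∷ [])
          (trans (c₂ _ (cloU k₁∈U k₂∈U) (E⇒≢0 k₁₂∈)) k₁₂∈) (trans (k₃' k₂∈U) sum∈f) (trans (k₃' (cloU k₁∈U k₂∈U)) sum∈f)
          (trans (c₁ k₁ k₁∈U k₁≢0) k₁∉) d₁∉ k₁∉ (trans (c₂ k₂ k₂∈U k₂≢0) k₂∉)

        d₂∈f : d₂ ∈ f
        d₂∈f = ≢false⇒true λ d₂∉ → claw-at cf (d₁ ∷ d₂ ∷ k₁ ∷ k₂ ∷ [])
          (I ∷ O ∷ I ∷ I ∷ []) (I ∷ I ∷ O ∷ I ∷ []) (I ∷ I ∷ I ∷ I ∷ [])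
          (trans (c₁ _ (cloU k₁∈U k₂∈U) (E⇒≢0 k₁₂∈)) k₁₂∈) (trans (k₃' k₂∈U) sum∈f) (trans (k₃' (cloU k₁∈U k₂∈U)) sum∈f)
          (trans (c₂ k₁ k₁∈U k₁≢0) k₁∉) d₂∉ k₁∉ (trans (c₁ k₂ k₂∈U k₂≢0) k₂∉)

        tri' : TriFree f W
        tri' = tri-from-centres B._≟_ e ce e∈f cr loc
          where
          e : Bool → Vect n
          e true  = d₁
          e false = d₂
          ce : ∀ i → Copy f U (e i)
          ce true  = c₁
          ce false = c₂
          e∈f : ∀ i → e i ∈ f
          e∈f true  = d₁∈f
          e∈f false = d₂∈f
          both : ∀ {u u'} → u ∈ U → u' ∈ U → ((d₁ ⊕ u) ⊕ (d₂ ⊕ u')) ∈ f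
          both {u} {u'} u∈U u'∈U = trans (cong f (⊕-interchange d₁ u d₂ u')) (trans (k _ (cloU u∈U u'∈U)) sum∈f)
          cr : ∀ i j → i ≢ j → ∀ {u u'} → X u → X u' → ((e i ⊕ u) ⊕ (e j ⊕ u')) ∈ f
          cr true  true  ne Xu Xu' = ⊥-elim (ne refl)
          cr false false ne Xu Xu' = ⊥-elim (ne refl)
          cr true  false ne Xu Xu' = both (proj₁ Xu) (proj₁ Xu')
          cr false true  ne Xu Xu' = trans (cong f (⊕-comm _ _)) (both (proj₁ Xu') (proj₁ Xu))
          loc : ∀ p → p ∈ W → p ∉ f → p ∈ U ⊎ ∃[ i ] ((p ⊕ e i) ∈ U)
          loc p p∈W p∉f with cosets p∈W
          ... | inj₁ q = inj₁ q
          ... | inj₂ (inj₁ q) = inj₂ (true , q)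
          ... | inj₂ (inj₂ (inj₁ q)) = inj₂ (false , q)
          ... | inj₂ (inj₂ (inj₂ q)) = ⊥-elim (true≢false (trans (k _ q) sum∈f)
            (trans (cong f (solve 3 (λ p d₁ d₂ → (d₁ :⊕ d₂) :⊕ (p :⊕ d₂) :⊕ d₁ ⊜ p) refl p d₁ d₂)) p∉f))

      module CopySum {w : Vect n} (w∈U : w ∈ U) (c₃ : Copy f U ((d₁ ⊕ d₂) ⊕ w)) where

        triple : CopyTriple d₁ d₂ ((d₁ ⊕ d₂) ⊕ w) w
        triple = record { copy₁ = c₁ ; copy₂ = c₂ ; copy₃ = c₃ ; w∈U = w∈U
          ; w≢0 = λ { refl → ¬c₁₂ (subst (Copy f U) (⊕-identityʳ _) c₃) }
          ; sum = solve 3 (λ d₁ d₂ w → d₁ :⊕ d₂ :⊕ (d₁ :⊕ d₂) :⊕ w ⊜ w) refl d₁ d₂ w }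

        tri' : TriFree f W
        tri' = tri-from-centres F._≟_ e ce e∈f cr loc
          where
          e : Fin 3 → Vect n
          e zero             = d₁
          e (suc zero)       = d₂
          e (suc (suc zero)) = (d₁ ⊕ d₂) ⊕ w
          ce : ∀ i → Copy f U (e i)
          ce zero             = c₁
          ce (suc zero)       = c₂
          ce (suc (suc zero)) = c₃
          e∈f : ∀ i → e i ∈ f
          e∈f zero             = copy∈f triple
          e∈f (suc zero)       = copy∈f (swap₁₂ triple)
          e∈f (suc (suc zero)) = copy∈f (swap₁₂ (swap₂₃ triple))
          cr : ∀ i j → i ≢ j → ∀ {u u'} → X u → X u' → ((e i ⊕ u) ⊕ (e j ⊕ u')) ∈ f
          cr zero zero ne = ⊥-elim (ne refl)
          cr (suc zero) (suc zero) ne = ⊥-elim (ne refl)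
          cr (suc (suc zero)) (suc (suc zero)) ne = ⊥-elim (ne refl)
          cr zero (suc zero) _ = cross triple
          cr zero (suc (suc zero)) _ = cross (swap₂₃ triple)
          cr (suc zero) zero _ = cross (swap₁₂ triple)
          cr (suc zero) (suc (suc zero)) _ = cross (swap₂₃ (swap₁₂ triple))
          cr (suc (suc zero)) zero _ = cross (swap₁₂ (swap₂₃ triple))
          cr (suc (suc zero)) (suc zero) _ = cross (swap₁₂ (swap₂₃ (swap₁₂ triple)))
          loc : ∀ p → p ∈ W → p ∉ f → p ∈ U ⊎ ∃[ i ] ((p ⊕ e i) ∈ U)
          loc p p∈W p∉f with cosets p∈W
          ... | inj₁ q = inj₁ q
          ... | inj₂ (inj₁ q) = inj₂ (zero , q)
          ... | inj₂ (inj₂ (inj₁ q)) = inj₂ (suc zero , q)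
          ... | inj₂ (inj₂ (inj₂ q)) = inj₂ (suc (suc zero) , subst (_∈ U)
            (solve 4 (λ p d₁ d₂ w → ((p :⊕ d₂) :⊕ d₁) :⊕ w ⊜ p :⊕ (d₁ :⊕ d₂) :⊕ w) refl p d₁ d₂ w) (cloU q w∈U))

      good-pair : Kind (d₁ ⊕ d₂) → Good W
      good-pair kd = record
        { sub = subW ; ind = ind' ; tri = [ ConstSum.tri' , (λ { (w , w∈U , c) → CopySum.tri' w∈U c }) ]′ kd
        ; k₁∈U = U⊆W _ k₁∈U ; k₂∈U = U⊆W _ k₂∈U ; k₃∈U = U⊆W _ k₃∈U }

    -- If the two constants differed, the zeros `k₁`, `k₂` and the one `k₁ + k₂`, seen in the copy
    -- at `d`, would complete to a claw.
    const-along-copies : ∀ {t d} → Copy f U d → Const f U t → Const f U (t ⊕ d) → f (t ⊕ d) ≡ f t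
    const-along-copies {t} {d} cd kt ktd = by (f t) (f (t ⊕ d)) refl refl
      where
      by : ∀ a b → f t ≡ a → f (t ⊕ d) ≡ b → f (t ⊕ d) ≡ f t
      by true  true  ft ftd = trans ftd (sym ft)
      by false false ft ftd = trans ftd (sym ft)
      by false true  ft ftd = ⊥-elim (claw-at cf (t ∷ d ∷ k₁ ∷ k₂ ∷ []) (O ∷ I ∷ I ∷ I ∷ []) (I ∷ I ∷ I ∷ I ∷ []) (I ∷ I ∷ O ∷ I ∷ [])
          (trans (cd _ (cloU k₁∈U k₂∈U) (E⇒≢0 k₁₂∈)) k₁₂∈) (on-sum (cloU k₁∈U k₂∈U)) (on-sum k₂∈U)
          ft (trans (kt _ k₁∈U) ft) k₁∉ (trans (cd k₂ k₂∈U k₂≢0) k₂∉))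
        where
        on-sum : ∀ {u} → u ∈ U → (t ⊕ (d ⊕ u)) ∈ f
        on-sum {u} u∈U = trans (cong f (sym (⊕-assoc t d u))) (trans (ktd u u∈U) ftd)
      by true  false ft ftd = ⊥-elim (claw-at cf (t ∷ d ∷ k₁ ∷ k₂ ∷ []) (O ∷ I ∷ I ∷ I ∷ []) (I ∷ O ∷ I ∷ I ∷ []) (I ∷ O ∷ O ∷ I ∷ [])
          (trans (cd _ (cloU k₁∈U k₂∈U) (E⇒≢0 k₁₂∈)) k₁₂∈) (trans (kt _ (cloU k₁∈U k₂∈U)) ft) (trans (kt _ k₂∈U) ft)
          ftd (trans (cong f (sym (⊕-assoc t d k₁))) (trans (ktd _ k₁∈U) ftd)) k₁∉ (trans (cd k₂ k₂∈U k₂≢0) k₂∉))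

    Copies : Subset n
    Copies d = does (copy? d)

    -- The centres form a subspace to which `sum-exhausts` and then `copies-trivial` apply, so `U`
    -- is the whole space and its triangle-freeness is that of `f`.
    stuck⇒trifree : Indecomposable f full → (∀ x → x ∉ U → Kind x) →
      (∀ d₁ d₂ → Copy f U d₁ → Copy f U d₂ → Copy f U (d₁ ⊕ d₂)) → TriFree f full
    stuck⇒trifree indV kind closed p q _ _ = tri p q (all p) (all q)
      where
      copy : ∀ {d} → d ∈ Copies → Copy f U d
      copy {d} = does-sound (copy? d)
      sub' : IsSubspace Copies
      sub' = dec-true (copy? 0v) copy-0 ,
        λ d e d∈ e∈ → dec-true (copy? (d ⊕ e)) (closed d e (copy d∈) (copy e∈))
      S : Subset n
      S = U ⊞ Copies
      subS : IsSubspace S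
      subS = ⊞-subspace U Copies sub sub'
      U⊆S : ∀ {u} → u ∈ U → u ∈ S
      U⊆S {u} u∈U = subst (_∈ S) (⊕-identityʳ u) (⊞-intro U Copies u∈U (proj₁ sub'))
      const : ∀ {x} → x ∉ S → Const f U x
      const {x} x∉S with kind x (≢true⇒false λ x∈U → true≢false (U⊆S x∈U) x∉S)
      ... | inj₁ c = c
      ... | inj₂ (w , w∈U , c) = ⊥-elim (true≢false (subst (_∈ S) (solve 2 (λ x w → w :⊕ x :⊕ w ⊜ x) refl x w)
        (⊞-intro U Copies w∈U (dec-true (copy? (x ⊕ w)) c))) x∉S)
      shifted : ∀ {x z} → x ∉ S → z ∈ Copies → (x ⊕ z) ∉ S
      shifted {x} {z} x∉S z∈ = ∉-shift subS x z x∉S (subst (_∈ S) (⊕-identityˡ z) (⊞-intro U Copies 0∈U z∈))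
      all : ∀ v → v ∈ U
      all = copies-trivial indV sub sub' (k₁ , k₁≢0 , k₁∈U) (λ v v∈U v∈ → copy-in-U v v∈U (copy v∈))
        (λ z u z∈ → copy z∈ u)
        (sum-exhausts indV sub sub' (k₁ , k₁≢0 , k₁∈U) (λ x u x∉ → const x∉ u)
          (λ x z x∉ z∈ → const-along-copies (copy z∈) (const x∉) (const (shifted x∉ z∈))))

  module _ (indV : Indecomposable f full) (¬tri : ¬ TriFree f full) where

    step : ∀ U → Good U → (∀ W → Good W → co-size W < co-size U → ⊥) → ⊥
    step U G grow = ¬tri (stuck⇒trifree indV kind closed)
      where
      open Extension G
      kind : ∀ x → x ∉ U → Kind x
      kind x x∉U with kind? x
      ... | yes k = k
      ... | no ¬k = ⊥-elim (grow (adj U x) (good-adj x ¬k)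
        (co-size-strict (adj-⊇ U x) x x∉U (adj-self U x (Good.sub G))))
      closed : ∀ d₁ d₂ → Copy f U d₁ → Copy f U d₂ → Copy f U (d₁ ⊕ d₂)
      closed d₁ d₂ c₁ c₂ with copy? (d₁ ⊕ d₂)
      ... | yes c = c
      ... | no ¬c = ⊥-elim (grow W (good-pair (kind (d₁ ⊕ d₂) d₁₂∉))
        (co-size-strict U⊆W (d₁ ⊕ d₂) d₁₂∉ (proj₂ subW _ _ d₁∈W d₂∈W)))
        where
        open Pair c₁ c₂ ¬c
        d₁₂∉ : (d₁ ⊕ d₂) ∉ U
        d₁₂∉ = ≢true⇒false λ d₁₂∈ → ¬c (subst (Copy f U)
          (trans (sym (⊕-self d₁)) (cong (d₁ ⊕_) (copy-unique c₁ c₂ d₁₂∈))) copy-0)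

    descend : ∀ k U → co-size U < k → Good U → ⊥
    descend (suc k) U (s≤s le) G = step U G λ W GW lt → descend k W (<-≤-trans lt le) GW

    ρ : Vec (Vect n) 3
    ρ = k₁ ∷ k₂ ∷ k₃ ∷ []

    ⟨K⟩ : Subset n
    ⟨K⟩ = span ρ

    in⟨K⟩ : ∀ {v} → v ∈ ⟨K⟩ → ∃[ cs ] (⨁ cs ρ ≡ v)
    in⟨K⟩ v∈ = let (cs , eq) = span-elim ρ v∈ in cs , trans (⨁≡lincomb cs ρ) eq

    k∈⟨K⟩ : ∀ cs → ⨁ cs ρ ∈ ⟨K⟩
    k∈⟨K⟩ cs = subst (_∈ ⟨K⟩) (sym (⨁≡lincomb cs ρ)) (span-intro ρ cs)

    zeros⟨K⟩ : ∀ {v} → v ∈ ⟨K⟩ → v ≢ 0v → v ∉ f → v ≡ k₁ ⊎ v ≡ k₂ ⊎ v ≡ k₃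
    zeros⟨K⟩ v∈ v≢0 v∉f with in⟨K⟩ v∈
    ... | O ∷ O ∷ O ∷ [] , refl = ⊥-elim (v≢0 refl)
    ... | I ∷ O ∷ O ∷ [] , refl = inj₁ refl
    ... | O ∷ I ∷ O ∷ [] , refl = inj₂ (inj₁ refl)
    ... | O ∷ O ∷ I ∷ [] , refl = inj₂ (inj₂ refl)
    ... | I ∷ I ∷ O ∷ [] , refl = ⊥-elim (true≢false k₁₂∈ v∉f)
    ... | I ∷ O ∷ I ∷ [] , refl = ⊥-elim (true≢false k₁₃∈ v∉f)
    ... | O ∷ I ∷ I ∷ [] , refl = ⊥-elim (true≢false k₂₃∈ v∉f)
    ... | I ∷ I ∷ I ∷ [] , refl = ⊥-elim (true≢false k₁₂₃∈ v∉f)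

    -- A decomposer cannot separate two of the `k`s, because translating one by the other turns a
    -- zero into a one. If it contains none of them, each of its nonzero vectors still carries some
    -- zero `k` outside it to a one.
    ind⟨K⟩ : Indecomposable f ⟨K⟩
    ind⟨K⟩ D ((0∈D , cloD) , D⊆ , (d , d≢0 , d∈D) , (v , v∈ , v∉D) , inv)
      with D k₁ in D₁ | D k₂ in D₂ | D k₃ in D₃
    ... | true  | false | _     = true≢false (trans (cong f (⊕-comm k₂ k₁)) k₁₂∈)
      (trans (inv k₂ k₁ (k∈⟨K⟩ (O ∷ I ∷ O ∷ [])) D₂ D₁) k₂∉)
    ... | true  | true  | false = true≢false (trans (cong f (⊕-comm k₃ k₁)) k₁₃∈)
      (trans (inv k₃ k₁ (k∈⟨K⟩ (O ∷ O ∷ I ∷ [])) D₃ D₁) k₃∉)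
    ... | false | true  | _     = true≢false k₁₂∈ (trans (inv k₁ k₂ (k∈⟨K⟩ (I ∷ O ∷ O ∷ [])) D₁ D₂) k₁∉)
    ... | false | false | true  = true≢false k₁₃∈ (trans (inv k₁ k₃ (k∈⟨K⟩ (I ∷ O ∷ O ∷ [])) D₁ D₃) k₁∉)
    ... | true  | true  | true  with in⟨K⟩ v∈
    ...   | O ∷ O ∷ O ∷ [] , refl = true≢false 0∈D v∉D
    ...   | I ∷ O ∷ O ∷ [] , refl = true≢false D₁ v∉D
    ...   | O ∷ I ∷ O ∷ [] , refl = true≢false D₂ v∉D
    ...   | O ∷ O ∷ I ∷ [] , refl = true≢false D₃ v∉D
    ...   | I ∷ I ∷ O ∷ [] , refl = true≢false (cloD _ _ D₁ D₂) v∉D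
    ...   | I ∷ O ∷ I ∷ [] , refl = true≢false (cloD _ _ D₁ D₃) v∉D
    ...   | O ∷ I ∷ I ∷ [] , refl = true≢false (cloD _ _ D₂ D₃) v∉D
    ...   | I ∷ I ∷ I ∷ [] , refl = true≢false (cloD _ _ D₁ (cloD _ _ D₂ D₃)) v∉D
    ind⟨K⟩ D ((0∈D , cloD) , D⊆ , (d , d≢0 , d∈D) , (v , v∈ , v∉D) , inv) | false | false | false with in⟨K⟩ (D⊆ d d∈D)
    ...   | O ∷ O ∷ O ∷ [] , refl = d≢0 refl
    ...   | I ∷ O ∷ O ∷ [] , refl = true≢false d∈D D₁
    ...   | O ∷ I ∷ O ∷ [] , refl = true≢false d∈D D₂
    ...   | O ∷ O ∷ I ∷ [] , refl = true≢false d∈D D₃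
    ...   | I ∷ I ∷ O ∷ [] , refl = true≢false (trans (cong f (solve 3 (λ a b c → c :⊕ a :⊕ b ⊜ a :⊕ b :⊕ c) refl k₁ k₂ k₃)) k₁₂₃∈)
      (trans (inv k₃ _ (k∈⟨K⟩ (O ∷ O ∷ I ∷ [])) D₃ d∈D) k₃∉)
    ...   | I ∷ O ∷ I ∷ [] , refl = true≢false (trans (cong f (solve 3 (λ a b c → b :⊕ a :⊕ c ⊜ a :⊕ b :⊕ c) refl k₁ k₂ k₃)) k₁₂₃∈)
      (trans (inv k₂ _ (k∈⟨K⟩ (O ∷ I ∷ O ∷ [])) D₂ d∈D) k₂∉)
    ...   | O ∷ I ∷ I ∷ [] , refl = true≢false k₁₂₃∈ (trans (inv k₁ _ (k∈⟨K⟩ (I ∷ O ∷ O ∷ [])) D₁ d∈D) k₁∉)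
    ...   | I ∷ I ∷ I ∷ [] , refl = true≢false (trans (cong f (⊕-cancel k₁ (k₂ ⊕ k₃))) k₂₃∈)
      (trans (inv k₁ _ (k∈⟨K⟩ (I ∷ O ∷ O ∷ [])) D₁ d∈D) k₁∉)

    tri⟨K⟩ : TriFree f ⟨K⟩
    tri⟨K⟩ p q p∈ q∈ p≢0 q≢0 p≢q p∉f q∉f with zeros⟨K⟩ p∈ p≢0 p∉f | zeros⟨K⟩ q∈ q≢0 q∉f
    ... | inj₁ refl        | inj₁ refl        = ⊥-elim (p≢q refl)
    ... | inj₁ refl        | inj₂ (inj₁ refl) = k₁₂∈
    ... | inj₁ refl        | inj₂ (inj₂ refl) = k₁₃∈
    ... | inj₂ (inj₁ refl) | inj₁ refl        = trans (cong f (⊕-comm k₂ k₁)) k₁₂∈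
    ... | inj₂ (inj₁ refl) | inj₂ (inj₁ refl) = ⊥-elim (p≢q refl)
    ... | inj₂ (inj₁ refl) | inj₂ (inj₂ refl) = k₂₃∈
    ... | inj₂ (inj₂ refl) | inj₁ refl        = trans (cong f (⊕-comm k₃ k₁)) k₁₃∈
    ... | inj₂ (inj₂ refl) | inj₂ (inj₁ refl) = trans (cong f (⊕-comm k₃ k₂)) k₂₃∈
    ... | inj₂ (inj₂ refl) | inj₂ (inj₂ refl) = ⊥-elim (p≢q refl)

    no-bitriangle-contradiction : ⊥
    no-bitriangle-contradiction = descend (suc (co-size ⟨K⟩)) ⟨K⟩ ≤-refl record
      { sub = span-subspace ρ ; ind = ind⟨K⟩ ; tri = tri⟨K⟩
      ; k₁∈U = k∈⟨K⟩ (I ∷ O ∷ O ∷ []) ; k₂∈U = k∈⟨K⟩ (O ∷ I ∷ O ∷ []) ; k₃∈U = k∈⟨K⟩ (O ∷ O ∷ I ∷ []) }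


-- Spanning and anti-claws

NonSpanning : Subset n → Subset n → Set
NonSpanning g W = ∃[ F ] (IsSubspace F × (∀ v → v ∈ F → v ∈ W) × (∃[ v ] (v ∈ W × v ∉ F))
                          × (∀ v → v ∈ W → v ∈ g → v ∈ F))

-- Elements e of g and z of h outside H are at hand, else W is not spanned.  The set C of all
-- y ∈ H with e + y ∈ g is contained in F or a subspace; so g is not spanning in W.
module AdjoinVector {n : ℕ} {g h : Subset n} (cg : NoClaw g) (ch : NoClaw h)
  (g⇒¬h : ∀ {v} → v ∈ g → v ∉ h) (¬g⇒h : ∀ {v} → v ≢ 0v → v ∉ g → v ∈ h)
  {H F : Subset n} (subH : IsSubspace H) (subF : IsSubspace F) (F⊆H : ∀ v → v ∈ F → v ∈ H)
  (v₀ : Vect n) (v₀∈H : v₀ ∈ H) (v₀∉F : v₀ ∉ F) (g⊆F : ∀ v → v ∈ H → v ∈ g → v ∈ F)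
  (x : Vect n) (x∉H : x ∉ H) where

  W : Subset n
  W = adj H x

  subW : IsSubspace W
  subW = adj-subspace H x subH

  cloH : ∀ {u v} → u ∈ H → v ∈ H → (u ⊕ v) ∈ H
  cloH = proj₂ subH _ _

  sum-in-H : ∀ {u v} → u ∈ W → v ∈ W → u ∉ H → v ∉ H → (u ⊕ v) ∈ H
  sum-in-H {u} {v} u∈ v∈ u∉ v∉ with adj-elim H x u u∈ | adj-elim H x v v∈
  ... | inj₁ p | _      = ⊥-elim (true≢false p u∉)
  ... | inj₂ _ | inj₁ q = ⊥-elim (true≢false q v∉)
  ... | inj₂ p | inj₂ q = subst (_∈ H) (solve 3 (λ u v x → (u :⊕ x) :⊕ v :⊕ x ⊜ u :⊕ v) refl u v x) (cloH p q)

  outside-H : ∀ {u v} → u ∉ H → v ∈ H → (u ⊕ v) ∉ H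
  outside-H = ∉-shift subH _ _

  outside-F : ∀ {u v} → u ∉ F → v ∈ F → (u ⊕ v) ∉ F
  outside-F = ∉-shift subF _ _

  ∉H⇒≢0 : ∀ {u} → u ∉ H → u ≢ 0v
  ∉H⇒≢0 u∉ refl = true≢false (proj₁ subH) u∉

  ∉F⇒∉g : ∀ {u} → u ∈ H → u ∉ F → u ∉ g
  ∉F⇒∉g u∈H u∉F = ≢true⇒false λ u∈g → true≢false (g⊆F _ u∈H u∈g) u∉F

  ∉F⇒∈h : ∀ {u} → u ∈ H → u ∉ F → u ∈ h
  ∉F⇒∈h u∈H u∉F = ¬g⇒h (λ { refl → true≢false (proj₁ subF) u∉F }) (∉F⇒∉g u∈H u∉F)

  within-H : ∀ g' → (∀ v → v ∈ W → v ∈ g' → v ∈ H) → NonSpanning g' W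
  within-H g' sub = H , subH , adj-⊇ H x , (x , adj-self H x subH , x∉H) , sub

  module _ (e : Vect n) (e∈W : e ∈ W) (e∉H : e ∉ H) (e∈g : e ∈ g) where

    within-adj : ∀ {F'} → IsSubspace F' → (∀ v → v ∈ F' → v ∈ H) → (∃[ v ] (v ∈ W × v ∉ F' × (v ⊕ e) ∉ F')) →
      (∀ v → v ∈ H → v ∈ g → v ∈ F') → (∀ v → v ∈ H → (e ⊕ v) ∈ g → v ∈ F') → NonSpanning g W
    within-adj {F'} subF' F'⊆H (v , v∈W , v∉ , ve∉) inH inCoset =
      adj F' e , adj-subspace F' e subF' , ⊆W , (v , v∈W , v∉adj) , sub
      where
      ⊆W : ∀ u → u ∈ adj F' e → u ∈ W
      ⊆W u u∈ with adj-elim F' e u u∈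
      ... | inj₁ p = adj-⊇ H x u (F'⊆H u p)
      ... | inj₂ p = subst (_∈ W) (solve 2 (λ u e → (u :⊕ e) :⊕ e ⊜ u) refl u e) (proj₂ subW _ _ (adj-⊇ H x _ (F'⊆H _ p)) e∈W)
      v∉adj : v ∉ adj F' e
      v∉adj = ≢true⇒false λ v∈ → [ (λ p → true≢false p v∉) , (λ p → true≢false p ve∉) ]′ (adj-elim F' e v v∈)
      sub : ∀ u → u ∈ W → u ∈ g → u ∈ adj F' e
      sub u u∈W u∈g with H u B.≟ true
      ... | yes u∈H = adj-⊇ F' e u (inH u u∈H u∈g)
      ... | no u∉H  = adj-intro F' e u (inCoset (u ⊕ e) (sum-in-H {u} {e} u∈W e∈W (≢true⇒false u∉H) e∉H)
        (trans (cong g (solve 2 (λ u e → e :⊕ u :⊕ e ⊜ u) refl u e)) u∈g))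

    C : Subset n
    C y = H y ∧ g (e ⊕ y)

    C-intro : ∀ {y} → y ∈ H → (e ⊕ y) ∈ g → y ∈ C
    C-intro y∈H ey∈g rewrite y∈H = ey∈g

    C⇒H : ∀ {y} → y ∈ C → y ∈ H
    C⇒H {y} y∈C with H y
    ... | true = refl

    C⇒g : ∀ {y} → y ∈ C → (e ⊕ y) ∈ g
    C⇒g {y} y∈C with H y
    ... | true = y∈C

    0∈C : 0v ∈ C
    0∈C = C-intro (proj₁ subH) (trans (cong g (⊕-identityʳ e)) e∈g)

    -- On the coset of `H`, a difference `k` of two elements of `g` that lies off `F` is a period of
    -- `g`. A violation is a claw of `g` if neither `s` nor `k + s` is in `g`. Otherwise it is a
    -- claw of `h`, since vectors of `H` off `F` belong to `h`.
    period : ∀ p k s → p ∉ H → p ∈ g → k ∈ H → k ∉ F → (p ⊕ k) ∈ g → s ∈ H → (p ⊕ s) ∉ g → (p ⊕ (k ⊕ s)) ∉ g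
    period p k s p∉H p∈g k∈H k∉F pk∈g s∈H ps∉g = ≢true⇒false (go (g s) (g (k ⊕ s)) refl refl)
      where
      k∉g = ∉F⇒∉g k∈H k∉F
      ps∈h = ¬g⇒h (∉H⇒≢0 (outside-H p∉H s∈H)) ps∉g
      go : ∀ b b' → g s ≡ b → g (k ⊕ s) ≡ b' → (p ⊕ (k ⊕ s)) ∈ g → ⊥
      go false false gs gks pks∈g = claw-at cg (p ∷ k ∷ s ∷ []) (I ∷ O ∷ O ∷ []) (I ∷ I ∷ O ∷ []) (I ∷ I ∷ I ∷ [])
        p∈g pk∈g pks∈g k∉g gks gs ps∉g
      go true b' gs gks pks∈g = claw-at ch (p ∷ k ∷ s ∷ []) (O ∷ I ∷ O ∷ []) (O ∷ I ∷ I ∷ []) (I ∷ O ∷ I ∷ [])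
        (∉F⇒∈h k∈H k∉F) (∉F⇒∈h (cloH k∈H s∈H) (outside-F k∉F (g⊆F s s∈H gs))) ps∈h
        (g⇒¬h gs) (g⇒¬h pks∈g) (g⇒¬h pk∈g) (g⇒¬h p∈g)
      go false true gs gks pks∈g = claw-at ch (p ∷ k ∷ s ∷ []) (O ∷ I ∷ O ∷ []) (O ∷ O ∷ I ∷ []) (I ∷ O ∷ I ∷ [])
        (∉F⇒∈h k∈H k∉F) (∉F⇒∈h s∈H s∉F) ps∈h (g⇒¬h gks) (g⇒¬h pks∈g) (g⇒¬h p∈g) (g⇒¬h pk∈g)
        where
        s∉F : s ∉ F
        s∉F = ≢true⇒false λ s∈F → true≢false (g⊆F _ (cloH k∈H s∈H) gks) (outside-F k∉F s∈F)

    module _ (k : Vect n) (k∈C : k ∈ C) (k∉F : k ∉ F) where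

      shift : ∀ {y y' s} → y ∈ C → y' ∈ C → (y ⊕ y') ∉ F → s ∈ C → (s ⊕ (y ⊕ y')) ∈ C
      shift {y} {y'} {s} y∈ y'∈ yy'∉ s∈ = C-intro (cloH (C⇒H s∈) yy'∈H) (≢false⇒true λ out → true≢false (C⇒g s∈)
        (trans (cong g (solve 4 (λ e y y' s → e :⊕ s ⊜ (e :⊕ y) :⊕ (y :⊕ y') :⊕ y' :⊕ s) refl e y y' s))
          (period (e ⊕ y) (y ⊕ y') (y' ⊕ s) (outside-H e∉H (C⇒H y∈)) (C⇒g y∈) yy'∈H yy'∉
            (trans (cong g (solve 3 (λ e y y' → (e :⊕ y) :⊕ y :⊕ y' ⊜ e :⊕ y') refl e y y')) (C⇒g y'∈))
            (cloH (C⇒H y'∈) (C⇒H s∈))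
            (trans (cong g (solve 4 (λ e y y' s → (e :⊕ y) :⊕ y' :⊕ s ⊜ e :⊕ s :⊕ y :⊕ y') refl e y y' s)) out))))
        where
        yy'∈H = cloH (C⇒H y∈) (C⇒H y'∈)

      shift-1 : ∀ {y s} → y ∈ C → y ∉ F → s ∈ C → (s ⊕ y) ∈ C
      shift-1 {y} {s} y∈ y∉ s∈ = subst (λ t → (s ⊕ t) ∈ C) (⊕-identityʳ y)
        (shift y∈ 0∈C (trans (cong F (⊕-identityʳ y)) y∉) s∈)

      closed : ∀ s y → s ∈ C → y ∈ C → (s ⊕ y) ∈ C
      closed s y s∈ y∈ with F y in Fy
      ... | false = shift-1 y∈ Fy s∈
      -- `shift-1` needs a vector off `F`, so `y` is written as `(y + k) + k`, where both summands
      -- are off `F`.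
      ... | true  = subst (_∈ C) (solve 3 (λ s y k → (s :⊕ y :⊕ k) :⊕ k ⊜ s :⊕ y) refl s y k)
        (shift-1 k∈C k∉F (shift-1 (shift-1 k∈C k∉F y∈) (trans (cong F (⊕-comm y k)) (outside-F k∉F Fy)) s∈))

      g-in-C : ∀ v → v ∈ H → v ∈ g → v ∈ C
      g-in-C v v∈H v∈g = C-intro v∈H (≢false⇒true λ ev∉ → claw-at cg (v ∷ e ∷ k ∷ [])
        (I ∷ O ∷ O ∷ []) (O ∷ I ∷ O ∷ []) (O ∷ I ∷ I ∷ []) v∈g e∈g (C⇒g k∈C)
        (trans (cong g (⊕-comm v e)) ev∉)
        (≢true⇒false λ vek∈ → true≢false (C⇒g (subst (_∈ C) (solve 2 (λ v k → (v :⊕ k) :⊕ k ⊜ v) refl v k)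
          (shift-1 k∈C k∉F (C-intro (cloH v∈H (C⇒H k∈C))
            (trans (cong g (solve 3 (λ v e k → e :⊕ v :⊕ k ⊜ v :⊕ e :⊕ k) refl v e k)) vek∈))))) ev∉)
        (∉F⇒∉g (C⇒H k∈C) k∉F)
        (trans (cong g (⊕-comm v k)) (∉F⇒∉g (cloH (C⇒H k∈C) v∈H) (outside-F k∉F (g⊆F v v∈H v∈g)))))

  non-spanning : NonSpanning g W ⊎ NonSpanning h W
  non-spanning
    with any-vect? (λ v → (W v B.≟ true) ×-dec (H v B.≟ false) ×-dec (h v B.≟ true))
       | any-vect? (λ v → (W v B.≟ true) ×-dec (H v B.≟ false) ×-dec (g v B.≟ true))
  ... | no none | _ = inj₂ (within-H h λ v v∈W v∈h → ≢false⇒true λ v∉H → none (v , v∈W , v∉H , v∈h))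
  ... | yes _ | no none = inj₁ (within-H g λ v v∈W v∈g → ≢false⇒true λ v∉H → none (v , v∈W , v∉H , v∈g))
  ... | yes (z , z∈W , z∉H , z∈h) | yes (e , e∈W , e∉H , e∈g)
    with any-vect? (λ v → (C e e∈W e∉H e∈g v B.≟ true) ×-dec (F v B.≟ false))
  ...   | no none = inj₁ (within-adj e e∈W e∉H e∈g subF F⊆H (v₀ , adj-⊇ H x v₀ v₀∈H , v₀∉F , v₀e∉F) g⊆F
            λ v v∈H ev∈g → ≢false⇒true λ v∉F → none (v , C-intro e e∈W e∉H e∈g v∈H ev∈g , v∉F))
    where
    v₀e∉F : (v₀ ⊕ e) ∉ F
    v₀e∉F = ≢true⇒false λ p → true≢false (F⊆H _ p) (trans (cong H (⊕-comm v₀ e)) (outside-H e∉H v₀∈H))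
  ...   | yes (k , k∈C , k∉F) = inj₁ (within-adj e e∈W e∉H e∈g
            (0∈C e e∈W e∉H e∈g , closed e e∈W e∉H e∈g k k∈C k∉F) (λ v → C⇒H e e∈W e∉H e∈g)
            (z , z∈W , ≢true⇒false (λ z∈C → true≢false (C⇒H e e∈W e∉H e∈g z∈C) z∉H) , ≢true⇒false ze∉C)
            (g-in-C e e∈W e∉H e∈g k k∈C k∉F) (λ v → C-intro e e∈W e∉H e∈g))
    where
    ze∉C : ¬ ((z ⊕ e) ∈ C e e∈W e∉H e∈g)
    ze∉C p = true≢false z∈h (g⇒¬h (trans (cong g (solve 2 (λ z e → z ⊜ e :⊕ z :⊕ e) refl z e)) (C⇒g e e∈W e∉H e∈g p)))

zeros : Subset n → Subset n
zeros f v = not (f v) ∧ not (does (v ≟ᵛ 0v))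

zeros-intro : (f : Subset n) {v : Vect n} → v ≢ 0v → v ∉ f → v ∈ zeros f
zeros-intro f {v} v≢0 v∉ rewrite v∉ | dec-false (v ≟ᵛ 0v) v≢0 = refl

zeros-out : (f : Subset n) {v : Vect n} → v ∈ f → v ∉ zeros f
zeros-out f v∈ rewrite v∈ = refl

zeros⇒∉ : (f : Subset n) {v : Vect n} → v ∈ zeros f → v ∉ f
zeros⇒∉ f {v} p with f v
... | false = refl

¬zeros⇒∈ : (f : Subset n) {v : Vect n} → v ≢ 0v → v ∉ zeros f → v ∈ f
¬zeros⇒∈ f v≢0 v∉ = ≢false⇒true λ v∉f → true≢false (zeros-intro f v≢0 v∉f) v∉

-- A sum outside `zeros f` is a one only if it is not 0; a vanishing sum would identify a generator
-- with another sum, on which `zeros f` differs.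
NoAntiClaw⇒NoClaw-zeros : {f : Subset n} → (∀ {a b c} → ¬ AntiClaw f a b c) → NoClaw (zeros f)
NoAntiClaw⇒NoClaw-zeros {f = f} none a b c a∈ b∈ c∈ ab∉ ac∉ bc∉ abc∉ = none {a} {b} {c} record
  { a∉ = zeros⇒∉ f a∈ ; b∉ = zeros⇒∉ f b∈ ; c∉ = zeros⇒∉ f c∈
  ; ab∈ = ¬zeros⇒∈ f (λ z → true≢false c∈ (trans (cong (zeros f)
      (trans (solve 3 (λ a b c → c ⊜ (a :⊕ b) :⊕ a :⊕ b :⊕ c) refl a b c) (trans (cong (_⊕ (a ⊕ (b ⊕ c))) z) (⊕-identityˡ _)))) abc∉)) ab∉
  ; ac∈ = ¬zeros⇒∈ f (λ z → true≢false b∈ (trans (cong (zeros f)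
      (trans (solve 3 (λ a b c → b ⊜ (a :⊕ c) :⊕ a :⊕ b :⊕ c) refl a b c) (trans (cong (_⊕ (a ⊕ (b ⊕ c))) z) (⊕-identityˡ _)))) abc∉)) ac∉
  ; bc∈ = ¬zeros⇒∈ f (λ z → true≢false a∈ (trans (cong (zeros f)
      (trans (sym (⊕-identityʳ a)) (cong (a ⊕_) (sym z)))) abc∉)) bc∉
  ; abc∈ = ¬zeros⇒∈ f (λ z → true≢false a∈ (trans (cong (zeros f) (⊕≡0⇒≡ z)) bc∉)) abc∉
  }

-- In an indecomposable space both E and its complement span; a space that is
-- claw-free and anti-claw-free is built up keeping one of the two non-spanning.
module NoAntiClaw {n : ℕ} {f : Subset n} (f0 : 0v ∉ f) (cf : NoClaw f) (ind : Indecomposable f full)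
  (none : ∀ {a b c} → ¬ AntiClaw f a b c)
  {p q : Vect n} (p≢0 : p ≢ 0v) (q≢0 : q ≢ 0v) (q≢p : q ≢ p) where

  cz : NoClaw (zeros f)
  cz = NoAntiClaw⇒NoClaw-zeros none

  -- A nonzero `F` off which `f` is constant is itself a decomposer. If `F` is zero, `f` is constant
  -- off 0 and the line through `p` is one, with `q` outside it.
  constant-off : ∀ {b} F → IsSubspace F → ∃[ v ] (v ∉ F) → (∀ v → v ∉ F → f v ≡ b) → ⊥
  constant-off {b} F sub (v , v∉F) off with any-vect? (λ u → (F u B.≟ true) ×-dec ¬? (u ≟ᵛ 0v))
  ... | yes (u , u∈F , u≢0) = ind F (sub , (λ _ _ → refl) , (u , u≢0 , u∈F) , (v , refl , v∉F) ,
      λ x d _ x∉ d∈ → trans (off _ (∉-shift sub x d x∉ d∈)) (sym (off x x∉)))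
  ... | no trivial = ind D (subD , (λ _ _ → refl) , (p , p≢0 , p∈D) , (q , refl , q∉D) ,
      λ x d _ x∉ d∈ → trans (offD _ (∉-shift subD x d x∉ d∈)) (sym (offD x x∉)))
    where
    D : Subset n
    D = adj ⟨0⟩ p
    subD : IsSubspace D
    subD = adj-subspace ⟨0⟩ p ⟨0⟩-subspace
    p∈D : p ∈ D
    p∈D = adj-self ⟨0⟩ p ⟨0⟩-subspace
    q∉D : q ∉ D
    q∉D = ≢true⇒false λ q∈ → [ (λ r → q≢0 (does-sound (q ≟ᵛ 0v) r))
      , (λ r → q≢p (⊕≡0⇒≡ (does-sound (q ⊕ p ≟ᵛ 0v) r))) ]′ (adj-elim ⟨0⟩ p q q∈)
    offD : ∀ v → v ∉ D → f v ≡ b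
    offD v v∉ = off v (≢true⇒false λ v∈F → trivial (v , v∈F , λ { refl → true≢false (proj₁ subD) v∉ }))

  NS : Subset n → Set
  NS H = NonSpanning f H ⊎ NonSpanning (zeros f) H

  grow : ∀ {H} → IsSubspace H → NS H → ∀ x → x ∉ H → NS (adj H x)
  grow subH (inj₁ (F , subF , F⊆ , (v , v∈ , v∉) , in-F)) x x∉ =
    AdjoinVector.non-spanning cf cz (zeros-out f) (zeros-intro f) subH subF F⊆ v v∈ v∉ in-F x x∉
  grow subH (inj₂ (F , subF , F⊆ , (v , v∈ , v∉) , in-F)) x x∉ = [ inj₂ , inj₁ ]′
    (AdjoinVector.non-spanning cz cf (λ v∈ → zeros⇒∉ f v∈) (¬zeros⇒∈ f) subH subF F⊆ v v∈ v∉ in-F x x∉)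

  exhaust : ∀ k H → co-size H < k → IsSubspace H → NS H → ⊥
  exhaust (suc k) H (s≤s le) subH ns with any-vect? (λ v → H v B.≟ false)
  ... | yes (x , x∉) = exhaust k (adj H x)
    (<-≤-trans (co-size-strict (adj-⊇ H x) x x∉ (adj-self H x subH)) le) (adj-subspace H x subH) (grow subH ns x x∉)
  ... | no all = [ spanning-f , spanning-zeros ]′ ns
    where
    in-H : ∀ v → v ∈ H
    in-H v = ≢false⇒true λ v∉ → all (v , v∉)
    spanning-f : NonSpanning f H → ⊥
    spanning-f (F , subF , _ , (v , _ , v∉) , in-F) = constant-off F subF (v , v∉)
      λ u u∉ → ≢true⇒false λ u∈f → true≢false (in-F u (in-H u) u∈f) u∉
    spanning-zeros : NonSpanning (zeros f) H → ⊥
    spanning-zeros (F , subF , _ , (v , _ , v∉) , in-F) = constant-off F subF (v , v∉)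
      λ u u∉ → ≢false⇒true λ u∉f → true≢false
        (in-F u (in-H u) (zeros-intro f (λ { refl → true≢false (proj₁ subF) u∉ }) u∉f)) u∉

  contradiction : ⊥
  contradiction = exhaust (suc (co-size L)) L ≤-refl subL start
    where
    L : Subset n
    L = adj ⟨0⟩ p
    subL : IsSubspace L
    subL = adj-subspace ⟨0⟩ p ⟨0⟩-subspace
    avoiding : ∀ {g} → p ∉ g → NonSpanning g L
    avoiding {g} p∉g = ⟨0⟩ , ⟨0⟩-subspace , adj-⊇ ⟨0⟩ p , (p , adj-self ⟨0⟩ p ⟨0⟩-subspace , dec-false (p ≟ᵛ 0v) p≢0) , in-0
      where
      in-0 : ∀ v → v ∈ L → v ∈ g → v ∈ ⟨0⟩
      in-0 v v∈L v∈g with adj-elim ⟨0⟩ p v v∈L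
      ... | inj₁ r = r
      ... | inj₂ r = ⊥-elim (true≢false v∈g (trans (cong g (⊕≡0⇒≡ (does-sound (v ⊕ p ≟ᵛ 0v) r))) p∉g))
    start : NS L
    -- On `{0, p}` one of `f` and `zeros f` has no nonzero element, so it does not span.
    start with f p in fp
    ... | false = inj₁ (avoiding fp)
    ... | true  = inj₂ (avoiding (zeros-out f fp))

-- Cosets of a PG-sum

-- g a b stands for f (x + a + b) on a coset of A + B.  The rules say that g has
-- no rectangle with exactly one 1; that no two disjoint pairs of rows with the
-- same difference both change, in different columns; and that no four cells
-- with distinct rows and columns and with sum zero carry exactly three 1s.
record GridRules (A B : Subset n) (g : Vect n → Vect n → Bool) (a₁ a₂ b₁ b₂ : Vect n) : Set where
  field
    subA : IsSubspace A
    subB : IsSubspace B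
    a₁∈A : a₁ ∈ A
    a₂∈A : a₂ ∈ A
    b₁∈B : b₁ ∈ B
    b₂∈B : b₂ ∈ B
    a₁≢0 : a₁ ≢ 0v
    a₂≢0 : a₂ ≢ 0v
    b₁≢0 : b₁ ≢ 0v
    b₂≢0 : b₂ ≢ 0v
    a₁≢a₂ : a₁ ≢ a₂
    b₁≢b₂ : b₁ ≢ b₂
    rectangle : ∀ {a a' b b'} → a ∈ A → a' ∈ A → b ∈ B → b' ∈ B → a ≢ a' → b ≢ b' →
      g a b ≡ true → g a' b ≡ false → g a b' ≡ false → g a' b' ≡ false → ⊥
    two-changes : ∀ {a a' c c' b b'} → a ∈ A → a' ∈ A → c ∈ A → b ∈ B → b' ∈ B →
      a ≢ a' → c ≢ a → c ≢ a' → b ≢ b' → a ⊕ (a' ⊕ c) ≡ c' →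
      g a b ≡ true → g a' b ≡ false → g c b' ≡ true → g c' b' ≡ false → ⊥
    diagonal : ∀ {a a' a'' a* b b' b'' b*} → a ∈ A → a' ∈ A → a'' ∈ A → b ∈ B → b' ∈ B → b'' ∈ B →
      a ≢ a' → a ≢ a'' → a' ≢ a'' → b ≢ b' → b ≢ b'' → b' ≢ b'' → a ⊕ (a' ⊕ a'') ≡ a* → b ⊕ (b' ⊕ b'') ≡ b* →
      g a b ≡ true → g a' b' ≡ true → g a'' b'' ≡ true → g a* b* ≡ false → ⊥

≢-shift : {x y : Vect n} → y ≢ 0v → x ≢ x ⊕ y
≢-shift {x = x} {y} y≢0 eq = y≢0 (trans (sym (⊕-cancel x y)) (trans (cong (x ⊕_) (sym eq)) (⊕-self x)))

⊕-injˡ : {x y z : Vect n} → x ⊕ y ≡ x ⊕ z → y ≡ z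
⊕-injˡ {x = x} {y} {z} eq = trans (sym (⊕-cancel x y)) (trans (cong (x ⊕_) eq) (⊕-cancel x z))

module Rows {n : ℕ} {A B : Subset n} {g : Vect n → Vect n → Bool} {a₁ a₂ b₁ b₂ : Vect n}
  (R : GridRules A B g a₁ a₂ b₁ b₂) where

  open GridRules R

  cloA : ∀ {u v} → u ∈ A → v ∈ A → (u ⊕ v) ∈ A
  cloA = proj₂ subA _ _

  cloB : ∀ {u v} → u ∈ B → v ∈ B → (u ⊕ v) ∈ B
  cloB = proj₂ subB _ _

  fourth≢ : ∀ {a a' c c' : Vect n} → a ⊕ (a' ⊕ c) ≡ c' → c ≢ a' → a ≢ c'
  fourth≢ {a} {a'} {c} eq c≢a' refl = c≢a' (sym (⊕≡0⇒≡ (⊕-injˡ {x = a} (trans eq (sym (⊕-identityʳ a))))))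

  -- Two zeros in column `b''` would leave a rectangle with a single 1. Two different values would
  -- be a change in a column other than `b`, where the disjoint pair `q`, `q'` changes already.
  ones-elsewhere : ∀ {p p' q q' b b''} → p ∈ A → p' ∈ A → q ∈ A → q' ∈ A → b ∈ B → b'' ∈ B → b ≢ b'' →
    p ≢ p' → q ≢ q' → p ≢ q → p ≢ q' → p' ≢ q → p' ≢ q' → q ⊕ (q' ⊕ p) ≡ p' →
    g p b ≡ true → g p' b ≡ false → g q b ≡ true → g q' b ≡ false →
    g p b'' ≡ true × g p' b'' ≡ true
  ones-elsewhere {p} {p'} {q} {q'} {b} {b''} p∈ p'∈ q∈ q'∈ b∈ b''∈ b≢b'' p≢p' q≢q' p≢q p≢q' p'≢q p'≢q' eq pb p'b qb q'b
    with g p b'' in pb'' | g p' b'' in p'b''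
  ... | true  | true  = refl , refl
  ... | false | false = ⊥-elim (rectangle p∈ p'∈ b∈ b''∈ p≢p' b≢b'' pb p'b pb'' p'b'')
  ... | true  | false = ⊥-elim (two-changes q∈ q'∈ p∈ b∈ b''∈ q≢q' p≢q p≢q' b≢b'' eq qb q'b pb'' p'b'')
  ... | false | true  = ⊥-elim (two-changes q∈ q'∈ p'∈ b∈ b''∈ q≢q' p'≢q p'≢q' b≢b''
    (trans (cong (λ t → q ⊕ (q' ⊕ t)) (sym eq)) (solve 3 (λ q q' p → q :⊕ q' :⊕ q :⊕ q' :⊕ p ⊜ p) refl q q' p)) qb q'b p'b'' pb'')

  -- `two-changes` speaks of different columns only. If both pairs change in column `b`, all four
  -- rows are 1 in every other column, and three such cells, in the columns `b + b₁`, `b + b₂`,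
  -- `b + b₁ + b₂`, form a forbidden diagonal with the 0 at `a'`, `b`.
  no-two-changes : ∀ {a a' c c' b b'} → a ∈ A → a' ∈ A → c ∈ A → b ∈ B → b' ∈ B →
    a ≢ a' → c ≢ a → c ≢ a' → a ⊕ (a' ⊕ c) ≡ c' →
    g a b ≡ true → g a' b ≡ false → g c b' ≡ true → g c' b' ≡ false → ⊥
  no-two-changes {a} {a'} {c} {c'} {b} {b'} a∈ a'∈ c∈ b∈ b'∈ a≢a' c≢a c≢a' eq ab a'b cb' c'b' with b ≟ᵛ b'
  ... | no b≢b' = two-changes a∈ a'∈ c∈ b∈ b'∈ a≢a' c≢a c≢a' b≢b' eq ab a'b cb' c'b'
  ... | yes refl = diagonal a∈ c∈ c'∈ (cloB b∈ b₁∈B) (cloB b∈ b₂∈B) (cloB b∈ (cloB b₁∈B b₂∈B))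
      (c≢a ∘ sym) (fourth≢ eq c≢a') c≢c'
      (λ e → b₁≢b₂ (⊕-injˡ e)) (λ e → ≢-shift b₂≢0 (⊕-injˡ e)) (λ e → ≢-shift b₁≢0 (trans (⊕-injˡ e) (⊕-comm b₁ b₂)))
      back (solve 3 (λ b b₁ b₂ → (b :⊕ b₁) :⊕ (b :⊕ b₂) :⊕ b :⊕ b₁ :⊕ b₂ ⊜ b) refl b b₁ b₂)
      (proj₁ (on-a (cloB b∈ b₁∈B) (≢-shift b₁≢0)))
      (proj₁ (on-c (cloB b∈ b₂∈B) (≢-shift b₂≢0)))
      (proj₂ (on-c (cloB b∈ (cloB b₁∈B b₂∈B)) (≢-shift (≢⇒⊕≢0 b₁≢b₂)))) a'b
    where
    c'∈ = subst (_∈ A) eq (cloA a∈ (cloA a'∈ c∈))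
    back : a ⊕ (c ⊕ c') ≡ a'
    back = trans (cong (λ t → a ⊕ (c ⊕ t)) (sym eq)) (solve 3 (λ a a' c → a :⊕ c :⊕ a :⊕ a' :⊕ c ⊜ a') refl a a' c)
    c≢c' : c ≢ c'
    c≢c' e = a≢a' (⊕≡0⇒≡ (trans (solve 3 (λ a a' c → a :⊕ a' ⊜ (a :⊕ a' :⊕ c) :⊕ c) refl a a' c)
      (trans (cong (_⊕ c) (trans eq (sym e))) (⊕-self c))))
    a'≢c' : a' ≢ c'
    a'≢c' = fourth≢ (trans (solve 3 (λ a a' c → a' :⊕ a :⊕ c ⊜ a :⊕ a' :⊕ c) refl a a' c) eq) c≢a
    on-a : ∀ {b''} → b'' ∈ B → b ≢ b'' → g a b'' ≡ true × g a' b'' ≡ true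
    on-a b''∈ b≢ = ones-elsewhere a∈ a'∈ c∈ c'∈ b∈ b''∈ b≢ a≢a' c≢c' (c≢a ∘ sym) (fourth≢ eq c≢a') (c≢a' ∘ sym) a'≢c'
      (trans (solve 3 (λ a c c' → c :⊕ c' :⊕ a ⊜ a :⊕ c :⊕ c') refl a c c') back) ab a'b cb' c'b'
    on-c : ∀ {b''} → b'' ∈ B → b ≢ b'' → g c b'' ≡ true × g c' b'' ≡ true
    on-c b''∈ b≢ = ones-elsewhere c∈ c'∈ a∈ a'∈ b∈ b''∈ b≢ c≢c' a≢a' c≢a c≢a' (fourth≢ eq c≢a' ∘ sym) (a'≢c' ∘ sym)
      eq cb' c'b' ab a'b

  SameRow : Vect n → Vect n → Set
  SameRow a a' = ∀ b → b ∈ B → g a b ≡ g a' b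

  sameRow? : ∀ a a' → Dec (SameRow a a')
  sameRow? a a' = all-vect? λ b → (B b B.≟ true) →-dec (g a b B.≟ g a' b)

  sym-row : ∀ {a a'} → SameRow a a' → SameRow a' a
  sym-row s b b∈ = sym (s b b∈)

  trans-row : ∀ {a a' a''} → SameRow a a' → SameRow a' a'' → SameRow a a''
  trans-row s t b b∈ = trans (s b b∈) (t b b∈)

  difference : ∀ {a a'} → ¬ SameRow a a' → ∃[ b ] (b ∈ B × g a b ≢ g a' b)
  difference {a} {a'} ¬same with any-vect? (λ b → (B b B.≟ true) ×-dec ¬? (g a b B.≟ g a' b))
  ... | yes d = d
  ... | no none = ⊥-elim (¬same same)
    where
    same : SameRow a a'
    same b b∈ with g a b B.≟ g a' b
    ... | yes eq = eq
    ... | no ne  = ⊥-elim (none (b , b∈ , ne))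

  paired : ∀ {a a' c c'} → a ∈ A → a' ∈ A → c ∈ A → c ≢ a → c ≢ a' → a ⊕ (a' ⊕ c) ≡ c' → ¬ SameRow a a' → SameRow c c'
  paired {a} {a'} {c} {c'} a∈ a'∈ c∈ c≢a c≢a' eq ¬same b' b'∈ with difference ¬same
  ... | b , b∈ , ne with g a b in ab | g a' b in a'b | g c b' in cb' | g c' b' in c'b'
  ...   | true  | true  | _     | _     = ⊥-elim (ne refl)
  ...   | false | false | _     | _     = ⊥-elim (ne refl)
  ...   | true  | false | true  | true  = refl
  ...   | true  | false | false | false = refl
  ...   | false | true  | true  | true  = refl
  ...   | false | true  | false | false = refl
  ...   | true  | false | true  | false = ⊥-elim (no-two-changes a∈ a'∈ c∈ b∈ b'∈ (λ e → ¬same λ b _ → cong (λ a → g a b) e) c≢a c≢a' eq ab a'b cb' c'b')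
  ...   | false | true  | true  | false = ⊥-elim (no-two-changes a'∈ a∈ c∈ b∈ b'∈ (λ e → ¬same λ b _ → cong (λ a → g a b) (sym e)) c≢a' c≢a
            (trans (solve 3 (λ a a' c → a' :⊕ a :⊕ c ⊜ a :⊕ a' :⊕ c) refl a a' c) eq) a'b ab cb' c'b')
  ...   | true  | false | false | true  = ⊥-elim (no-two-changes a∈ a'∈ c'∈ b∈ b'∈ (λ e → ¬same λ b _ → cong (λ a → g a b) e)
            (fourth≢ eq c≢a' ∘ sym) (c'≢a' ∘ sym) eq' ab a'b c'b' cb')
    where
    c'∈ = subst (_∈ A) eq (cloA a∈ (cloA a'∈ c∈))
    c'≢a' = fourth≢ (trans (solve 3 (λ a a' c → a' :⊕ a :⊕ c ⊜ a :⊕ a' :⊕ c) refl a a' c) eq) c≢a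
    eq' = trans (cong (λ t → a ⊕ (a' ⊕ t)) (sym eq)) (solve 3 (λ a a' c → a :⊕ a' :⊕ a :⊕ a' :⊕ c ⊜ c) refl a a' c)
  ...   | false | true  | false | true  = ⊥-elim (no-two-changes a'∈ a∈ c'∈ b∈ b'∈ (λ e → ¬same λ b _ → cong (λ a → g a b) (sym e))
            (c'≢a' ∘ sym) (fourth≢ eq c≢a' ∘ sym) eq' a'b ab c'b' cb')
    where
    c'∈ = subst (_∈ A) eq (cloA a∈ (cloA a'∈ c∈))
    c'≢a' = fourth≢ (trans (solve 3 (λ a a' c → a' :⊕ a :⊕ c ⊜ a :⊕ a' :⊕ c) refl a a' c) eq) c≢a
    eq' = trans (cong (λ t → a' ⊕ (a ⊕ t)) (sym eq)) (solve 3 (λ a a' c → a' :⊕ a :⊕ a :⊕ a' :⊕ c ⊜ c) refl a a' c)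

  -- Suppose row s ≠ p also differs from q and r, and let e = p + q + s.  Then rows s and e
  -- agree, and comparing q with s and r with e gives row p = row r.
  odd-row : ∀ {p q r} → p ∈ A → q ∈ A → r ∈ A → p ≢ q → p ≢ r → q ≢ r → SameRow q r → ¬ SameRow p q →
    ∀ s → s ∈ A → s ≢ p → SameRow s q
  odd-row {p} {q} {r} p∈ q∈ r∈ p≢q p≢r q≢r qr ¬pq s s∈ s≢p with sameRow? s q
  ... | yes same = same
  ... | no ¬sq = ⊥-elim (¬pq (trans-row p≡t (trans-row (sym-row r≡t) (sym-row qr))))
    where
    s≢q : s ≢ q
    s≢q refl = ¬sq λ _ _ → refl
    s≢r : s ≢ r
    s≢r refl = ¬sq (sym-row qr)
    e t : Vect n
    e = p ⊕ (q ⊕ s)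
    t = q ⊕ (s ⊕ r)
    r≡t : SameRow r t
    r≡t = paired q∈ s∈ r∈ (q≢r ∘ sym) (s≢r ∘ sym) refl (¬sq ∘ sym-row)
    s≡e : SameRow s e
    s≡e = paired p∈ q∈ s∈ s≢p s≢q refl ¬pq
    p≢e : p ≢ e
    p≢e = fourth≢ {p} {q} {s} refl s≢q
    p≡t : SameRow p t
    p≡t = paired r∈ (cloA p∈ (cloA q∈ s∈)) p∈ p≢r p≢e
      (solve 4 (λ p q r s → r :⊕ (p :⊕ q :⊕ s) :⊕ p ⊜ q :⊕ s :⊕ r) refl p q r s)
      (λ re → ¬sq (trans-row s≡e (trans-row (sym-row re) (sym-row qr))))

  OddRow : Set
  OddRow = ∃[ a₀ ] (a₀ ∈ A × (∀ a a' → a ∈ A → a' ∈ A → a ≢ a₀ → a' ≢ a₀ → SameRow a a')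
                    × ∃[ a ] (a ∈ A × a ≢ a₀ × ¬ SameRow a a₀))

  rows : (∀ a a' → a ∈ A → a' ∈ A → SameRow a a') ⊎ OddRow
  rows with any-vect? (λ a → (A a B.≟ true) ×-dec ¬? (sameRow? a 0v))
  ... | no none = inj₁ λ a a' a∈ a'∈ → trans-row (zero-row a a∈) (sym-row (zero-row a' a'∈))
    where
    zero-row : ∀ a → a ∈ A → SameRow a 0v
    zero-row a a∈ with sameRow? a 0v
    ... | yes s = s
    ... | no ¬s = ⊥-elim (none (a , a∈ , ¬s))
  ... | yes (a , a∈ , ¬a0) = inj₂ (aux (other a))
    where
    0∈A = proj₁ subA
    a≢0 : a ≢ 0v
    a≢0 refl = ¬a0 λ _ _ → refl
    other : ∀ a → ∃[ c ] (c ∈ A × c ≢ 0v × c ≢ a)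
    other a with a₁ ≟ᵛ a
    ... | no a₁≢a  = a₁ , a₁∈A , a₁≢0 , a₁≢a
    ... | yes refl = a₂ , a₂∈A , a₂≢0 , a₁≢a₂ ∘ sym
    odd : ∀ {p q r} → p ∈ A → q ∈ A → r ∈ A → p ≢ q → p ≢ r → q ≢ r → SameRow q r → ¬ SameRow p q → OddRow
    odd {p} {q} p∈ q∈ r∈ p≢q p≢r q≢r qr ¬pq = p , p∈ ,
      (λ a a' a∈ a'∈ a≢p a'≢p → trans-row (all a a∈ a≢p) (sym-row (all a' a'∈ a'≢p))) ,
      (q , q∈ , p≢q ∘ sym , ¬pq ∘ sym-row)
      where
      all = odd-row p∈ q∈ r∈ p≢q p≢r q≢r qr ¬pq
    aux : ∃[ c ] (c ∈ A × c ≢ 0v × c ≢ a) → OddRow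
    aux (c , c∈ , c≢0 , c≢a) with sameRow? c 0v
    ... | yes c0 = odd a∈ 0∈A c∈ a≢0 (c≢a ∘ sym) (c≢0 ∘ sym) (sym-row c0) ¬a0
    -- Rows `a` and `c` both differ from row 0, so `paired` makes each of them equal to row `c + a`;
    -- row 0 is the odd one.
    ... | no ¬c0 = odd 0∈A a∈ c∈ (a≢0 ∘ sym) (c≢0 ∘ sym) (c≢a ∘ sym) (trans-row a≡ca (sym-row c≡ca)) (¬a0 ∘ sym-row)
      where
      c≡ca : SameRow c (c ⊕ a)
      c≡ca = paired 0∈A a∈ c∈ c≢0 c≢a (solve 2 (λ a c → :0 :⊕ a :⊕ c ⊜ c :⊕ a) refl a c) (¬a0 ∘ sym-row)
      a≡ca : SameRow a (c ⊕ a)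
      a≡ca = paired 0∈A c∈ a∈ a≢0 (c≢a ∘ sym) (⊕-identityˡ (c ⊕ a)) (¬c0 ∘ sym-row)

  Line : Set
  Line = ∃[ a₀ ] (a₀ ∈ A × (∀ a b → a ∈ A → b ∈ B → a ≢ a₀ → g a b ≡ false) × (∀ b → b ∈ B → g a₀ b ≡ true))

  -- With all columns equal, each row is constant. An odd row of zeros among rows of ones is
  -- excluded by `diagonal`, which leaves an odd row of ones.
  line : (∀ a b b' → a ∈ A → b ∈ B → b' ∈ B → g a b ≡ g a b') → OddRow → Line
  line flat (a₀ , a₀∈ , same , (a , a∈ , a≢a₀ , ¬aa₀)) with g a 0v in ga | g a₀ 0v in ga₀
  ... | true  | true  = ⊥-elim (¬aa₀ λ b b∈ → trans (flat a b 0v a∈ b∈ (proj₁ subB)) (trans ga (sym (trans (flat a₀ b 0v a₀∈ b∈ (proj₁ subB)) ga₀))))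
  ... | false | false = ⊥-elim (¬aa₀ λ b b∈ → trans (flat a b 0v a∈ b∈ (proj₁ subB)) (trans ga (sym (trans (flat a₀ b 0v a₀∈ b∈ (proj₁ subB)) ga₀))))
  ... | false | true  = a₀ , a₀∈ ,
      (λ c b c∈ b∈ c≢a₀ → trans (flat c b 0v c∈ b∈ (proj₁ subB)) (trans (same c a c∈ a∈ c≢a₀ a≢a₀ 0v (proj₁ subB)) ga)) ,
      (λ b b∈ → trans (flat a₀ b 0v a₀∈ b∈ (proj₁ subB)) ga₀)
  ... | true  | false = ⊥-elim (diagonal (cloA a₀∈ a₁∈A) (cloA a₀∈ a₂∈A) (cloA a₀∈ (cloA a₁∈A a₂∈A)) b₁∈B b₂∈B (cloB b₁∈B b₂∈B)
      (λ e → a₁≢a₂ (⊕-injˡ e)) (λ e → ≢-shift a₂≢0 (⊕-injˡ e)) (λ e → ≢-shift a₁≢0 (trans (⊕-injˡ e) (⊕-comm a₁ a₂)))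
      b₁≢b₂ (≢-shift b₂≢0) (λ e → ≢-shift b₁≢0 (trans e (⊕-comm b₁ b₂)))
      (solve 3 (λ a a₁ a₂ → (a :⊕ a₁) :⊕ (a :⊕ a₂) :⊕ a :⊕ a₁ :⊕ a₂ ⊜ a) refl a₀ a₁ a₂)
      (solve 2 (λ b₁ b₂ → b₁ :⊕ b₂ :⊕ b₁ :⊕ b₂ ⊜ :0) refl b₁ b₂)
      (one a₁∈A b₁∈B a₁≢0) (one a₂∈A b₂∈B a₂≢0) (one (cloA a₁∈A a₂∈A) (cloB b₁∈B b₂∈B) (≢⇒⊕≢0 a₁≢a₂)) ga₀)
    where
    one : ∀ {c b} → c ∈ A → b ∈ B → c ≢ 0v → g (a₀ ⊕ c) b ≡ true
    one {c} {b} c∈ b∈ c≢0 = trans (flat _ b 0v (cloA a₀∈ c∈) b∈ (proj₁ subB))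
      (trans (same (a₀ ⊕ c) a (cloA a₀∈ c∈) a∈ (≢-shift c≢0 ∘ sym) a≢a₀ 0v (proj₁ subB)) ga)

data GridKind {n : ℕ} (A B : Subset n) (g : Vect n → Vect n → Bool) : Set where
  constant : (∀ a b → a ∈ A → b ∈ B → g a b ≡ g 0v 0v) → GridKind A B g
  row      : ∀ a₀ → a₀ ∈ A → (∀ a b → a ∈ A → b ∈ B → a ≢ a₀ → g a b ≡ false) →
             (∀ b → b ∈ B → g a₀ b ≡ true) → GridKind A B g
  column   : ∀ b₀ → b₀ ∈ B → (∀ a b → a ∈ A → b ∈ B → b ≢ b₀ → g a b ≡ false) →
             (∀ a → a ∈ A → g a b₀ ≡ true) → GridKind A B g
  centred  : ∀ a₀ b₀ c → a₀ ∈ A → b₀ ∈ B →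
             (∀ a b → a ∈ A → b ∈ B → a ≢ a₀ → b ≢ b₀ → g a b ≡ c) →
             (∀ a → a ∈ A → a ≢ a₀ → g a b₀ ≡ not c) →
             (∀ b → b ∈ B → b ≢ b₀ → g a₀ b ≡ not c) → GridKind A B g

-- With an odd row and an odd column the grid is determined by four values: inner cells, rest of the
-- row, rest of the column, and crossing. The rules leave the two patterns in which row and column
-- are opposite to the inner cells; the crossing stays free.
classify : {A B : Subset n} {g g' : Vect n → Vect n → Bool} {a₁ a₂ b₁ b₂ : Vect n} →
  GridRules A B g a₁ a₂ b₁ b₂ → GridRules B A g' b₁ b₂ a₁ a₂ → (∀ a b → g a b ≡ g' b a) → GridKind A B g
classify {A = A} {B} {g} {g'} {a₁} {a₂} {b₁} {b₂} R R' flip with Rows.rows R | Rows.rows R'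
... | inj₁ r | inj₁ c = constant λ a b a∈ b∈ → trans (r a 0v a∈ (proj₁ (GridRules.subA R)) b b∈)
        (trans (flip 0v b) (trans (c b 0v b∈ (proj₁ (GridRules.subB R)) 0v (proj₁ (GridRules.subA R))) (sym (flip 0v 0v))))
... | inj₂ r | inj₁ c with Rows.line R (λ a b b' a∈ b∈ b'∈ → trans (flip a b) (trans (c b b' b∈ b'∈ a a∈) (sym (flip a b')))) r
...   | a₀ , a₀∈ , off , on = row a₀ a₀∈ off on
classify {A = A} {B} {g} {g'} R R' flip | inj₁ r | inj₂ c
  with Rows.line R' (λ b a a' b∈ a∈ a'∈ → trans (sym (flip a b)) (trans (r a a' a∈ a'∈ b b∈) (flip a' b))) c
...   | b₀ , b₀∈ , off , on = column b₀ b₀∈ (λ a b a∈ b∈ b≢ → trans (flip a b) (off b a b∈ a∈ b≢)) (λ a a∈ → trans (flip a b₀) (on a a∈))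
classify {A = A} {B} {g} {g'} {a₁} {a₂} {b₁} {b₂} R R' flip
  | inj₂ (a₀ , a₀∈ , same-row , (p , p∈ , p≢a₀ , ¬p)) | inj₂ (b₀ , b₀∈ , same-col , (q , q∈ , q≢b₀ , ¬q)) =
    by (g a b) (g a₀ b) (g a b₀) (g a₀ b₀) refl refl refl refl
  where
  open GridRules R
  open Rows R using (cloA; cloB)
  a b : Vect _
  a = a₀ ⊕ a₁
  b = b₀ ⊕ b₁
  a∈ = cloA a₀∈ a₁∈A
  b∈ = cloB b₀∈ b₁∈B
  a≢a₀ : a ≢ a₀
  a≢a₀ = ≢-shift a₁≢0 ∘ sym
  b≢b₀ : b ≢ b₀
  b≢b₀ = ≢-shift b₁≢0 ∘ sym
  inner : ∀ {c} → g a b ≡ c → ∀ a' b' → a' ∈ A → b' ∈ B → a' ≢ a₀ → b' ≢ b₀ → g a' b' ≡ c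
  inner ab a' b' a'∈ b'∈ a'≢ b'≢ = trans (same-row a' a a'∈ a∈ a'≢ a≢a₀ b' b'∈)
    (trans (flip a b') (trans (same-col b' b b'∈ b∈ b'≢ b≢b₀ a a∈) (trans (sym (flip a b)) ab)))
  in-col : ∀ {c} → g a b₀ ≡ c → ∀ a' → a' ∈ A → a' ≢ a₀ → g a' b₀ ≡ c
  in-col ab₀ a' a'∈ a'≢ = trans (same-row a' a a'∈ a∈ a'≢ a≢a₀ b₀ b₀∈) ab₀
  in-row : ∀ {c} → g a₀ b ≡ c → ∀ b' → b' ∈ B → b' ≢ b₀ → g a₀ b' ≡ c
  in-row a₀b b' b'∈ b'≢ = trans (flip a₀ b') (trans (same-col b' b b'∈ b∈ b'≢ b≢b₀ a₀ a₀∈) (trans (sym (flip a₀ b)) a₀b))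
  ¬rows : g a b ≡ g a₀ b → g a b₀ ≡ g a₀ b₀ → ⊥
  ¬rows e e₀ = ¬p λ b' b'∈ → same b' b'∈ (b' ≟ᵛ b₀)
    where
    same : ∀ b' → b' ∈ B → Dec (b' ≡ b₀) → g p b' ≡ g a₀ b'
    same b' b'∈ (yes refl) = trans (in-col e₀ p p∈ p≢a₀) refl
    same b' b'∈ (no b'≢) = trans (inner e p b' p∈ b'∈ p≢a₀ b'≢) (sym (in-row refl b' b'∈ b'≢))
  ¬cols : g a b ≡ g a b₀ → g a₀ b ≡ g a₀ b₀ → ⊥
  ¬cols e e₀ = ¬q λ a' a'∈ → trans (sym (flip a' q)) (trans (same a' a'∈ (a' ≟ᵛ a₀)) (flip a' b₀))
    where
    same : ∀ a' → a' ∈ A → Dec (a' ≡ a₀) → g a' q ≡ g a' b₀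
    same a' a'∈ (yes refl) = in-row e₀ q q∈ q≢b₀
    same a' a'∈ (no a'≢) = trans (inner e a' q a'∈ q∈ a'≢ q≢b₀) (sym (in-col refl a' a'∈ a'≢))
  -- The third cell of the diagonal is fixed at an inner cell, known to be 1, so that the other two
  -- and their sum can be placed as each pattern requires.
  diag : ∀ {a' a'' a* b' b'' b*} → a' ∈ A → b' ∈ B → a'' ∈ A → b'' ∈ B → a' ≢ a'' → b' ≢ b'' →
    a' ≢ a₀ ⊕ (a₁ ⊕ a₂) → a'' ≢ a₀ ⊕ (a₁ ⊕ a₂) → b' ≢ b₀ ⊕ (b₁ ⊕ b₂) → b'' ≢ b₀ ⊕ (b₁ ⊕ b₂) →
    a' ⊕ (a'' ⊕ (a₀ ⊕ (a₁ ⊕ a₂))) ≡ a* → b' ⊕ (b'' ⊕ (b₀ ⊕ (b₁ ⊕ b₂))) ≡ b* →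
    g a b ≡ true → g a' b' ≡ true → g a'' b'' ≡ true → g a* b* ≡ false → ⊥
  diag a'∈ b'∈ a''∈ b''∈ a'≢a'' b'≢b'' a'≢ a''≢ b'≢ b''≢ ea eb ab h h' h* =
    diagonal a'∈ a''∈ (cloA a₀∈ (cloA a₁∈A a₂∈A)) b'∈ b''∈ (cloB b₀∈ (cloB b₁∈B b₂∈B))
      a'≢a'' a'≢ a''≢ b'≢b'' b'≢ b''≢ ea eb h h'
      (inner ab _ _ (cloA a₀∈ (cloA a₁∈A a₂∈A)) (cloB b₀∈ (cloB b₁∈B b₂∈B))
        (≢-shift (≢⇒⊕≢0 a₁≢a₂) ∘ sym) (≢-shift (≢⇒⊕≢0 b₁≢b₂) ∘ sym)) h*
  a₂' b₂' : Vect _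
  a₂' = a₀ ⊕ a₂
  b₂' = b₀ ⊕ b₂
  a₂'∈ = cloA a₀∈ a₂∈A
  b₂'∈ = cloB b₀∈ b₂∈B
  a₂≢ : a₂' ≢ a₀ ⊕ (a₁ ⊕ a₂)
  a₂≢ e = ≢-shift a₁≢0 (trans (⊕-injˡ e) (⊕-comm a₁ a₂))
  b₂≢ : b₂' ≢ b₀ ⊕ (b₁ ⊕ b₂)
  b₂≢ e = ≢-shift b₁≢0 (trans (⊕-injˡ e) (⊕-comm b₁ b₂))
  a₁≢ : a ≢ a₀ ⊕ (a₁ ⊕ a₂)
  a₁≢ e = ≢-shift a₂≢0 (⊕-injˡ e)
  b₁≢ : b ≢ b₀ ⊕ (b₁ ⊕ b₂)
  b₁≢ e = ≢-shift b₂≢0 (⊕-injˡ e)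
  a₁₂ : a₀ ⊕ (a₂' ⊕ (a₀ ⊕ (a₁ ⊕ a₂))) ≡ a
  a₁₂ = solve 3 (λ a a₁ a₂ → a :⊕ (a :⊕ a₂) :⊕ a :⊕ a₁ :⊕ a₂ ⊜ a :⊕ a₁) refl a₀ a₁ a₂
  b₁₂ : b₀ ⊕ (b₂' ⊕ (b₀ ⊕ (b₁ ⊕ b₂))) ≡ b
  b₁₂ = solve 3 (λ a a₁ a₂ → a :⊕ (a :⊕ a₂) :⊕ a :⊕ a₁ :⊕ a₂ ⊜ a :⊕ a₁) refl b₀ b₁ b₂
  a₀₀ : a ⊕ (a₂' ⊕ (a₀ ⊕ (a₁ ⊕ a₂))) ≡ a₀
  a₀₀ = solve 3 (λ a a₁ a₂ → (a :⊕ a₁) :⊕ (a :⊕ a₂) :⊕ a :⊕ a₁ :⊕ a₂ ⊜ a) refl a₀ a₁ a₂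
  b₀₀ : b ⊕ (b₂' ⊕ (b₀ ⊕ (b₁ ⊕ b₂))) ≡ b₀
  b₀₀ = solve 3 (λ a a₁ a₂ → (a :⊕ a₁) :⊕ (a :⊕ a₂) :⊕ a :⊕ a₁ :⊕ a₂ ⊜ a) refl b₀ b₁ b₂
  one₂ : ∀ {c} → g a b ≡ c → g a₂' b₂' ≡ c
  one₂ ab = inner ab a₂' b₂' a₂'∈ b₂'∈ (≢-shift a₂≢0 ∘ sym) (≢-shift b₂≢0 ∘ sym)
  a≢a₂' : a ≢ a₂'
  a≢a₂' e = a₁≢a₂ (⊕-injˡ e)
  b≢b₂' : b ≢ b₂'
  b≢b₂' e = b₁≢b₂ (⊕-injˡ e)
  by : ∀ c c' c'' e → g a b ≡ c → g a₀ b ≡ c' → g a b₀ ≡ c'' → g a₀ b₀ ≡ e → GridKind A B g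
  by false true  true  e     ab a₀b ab₀ a₀b₀ = centred a₀ b₀ false a₀∈ b₀∈ (inner ab) (in-col ab₀) (in-row a₀b)
  by true  false false e     ab a₀b ab₀ a₀b₀ = centred a₀ b₀ true a₀∈ b₀∈ (inner ab) (in-col ab₀) (in-row a₀b)
  by true  true  true  true  ab a₀b ab₀ a₀b₀ = ⊥-elim (¬rows (trans ab (sym a₀b)) (trans ab₀ (sym a₀b₀)))
  by false false false false ab a₀b ab₀ a₀b₀ = ⊥-elim (¬rows (trans ab (sym a₀b)) (trans ab₀ (sym a₀b₀)))
  by false false false true  ab a₀b ab₀ a₀b₀ = ⊥-elim (rectangle a₀∈ a∈ b₀∈ b∈ (a≢a₀ ∘ sym) (b≢b₀ ∘ sym) a₀b₀ ab₀ a₀b ab)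
  by true  true  true  false ab a₀b ab₀ a₀b₀ = ⊥-elim (diag a∈ b∈ a₂'∈ b₂'∈ a≢a₂' b≢b₂' a₁≢ a₂≢ b₁≢ b₂≢ a₀₀ b₀₀ ab ab (one₂ ab) a₀b₀)
  by false false true  true  ab a₀b ab₀ a₀b₀ = ⊥-elim (¬rows (trans ab (sym a₀b)) (trans ab₀ (sym a₀b₀)))
  by false false true  false ab a₀b ab₀ a₀b₀ = ⊥-elim (rectangle a∈ a₀∈ b₀∈ b∈ a≢a₀ (b≢b₀ ∘ sym) ab₀ a₀b₀ ab a₀b)
  by true  true  false false ab a₀b ab₀ a₀b₀ = ⊥-elim (¬rows (trans ab (sym a₀b)) (trans ab₀ (sym a₀b₀)))
  by true  true  false true  ab a₀b ab₀ a₀b₀ = ⊥-elim (diag a₀∈ b∈ a₂'∈ b₂'∈ (≢-shift a₂≢0) b≢b₂' (≢-shift (≢⇒⊕≢0 a₁≢a₂)) a₂≢ b₁≢ b₂≢ a₁₂ b₀₀ ab a₀b (one₂ ab) ab₀)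
  by false true  false true  ab a₀b ab₀ a₀b₀ = ⊥-elim (¬cols (trans ab (sym ab₀)) (trans a₀b (sym a₀b₀)))
  by false true  false false ab a₀b ab₀ a₀b₀ = ⊥-elim (rectangle a₀∈ a∈ b∈ b₀∈ (a≢a₀ ∘ sym) b≢b₀ a₀b ab a₀b₀ ab₀)
  by true  false true  false ab a₀b ab₀ a₀b₀ = ⊥-elim (¬cols (trans ab (sym ab₀)) (trans a₀b (sym a₀b₀)))
  by true  false true  true  ab a₀b ab₀ a₀b₀ = ⊥-elim (diag a∈ b₀∈ a₂'∈ b₂'∈ a≢a₂' (≢-shift b₂≢0) a₁≢ a₂≢ (≢-shift (≢⇒⊕≢0 b₁≢b₂)) b₂≢ a₀₀ b₁₂ ab ab₀ (one₂ ab) a₀b)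

-- Searching claws among partially known values

is : Bool → Maybe Bool → Bool
is b (just c) = not (b xor c)
is b nothing  = false

is-sound : ∀ {b m} → is b m ≡ true → m ≡ just b
is-sound {true}  {just true}  _ = refl
is-sound {false} {just false} _ = refl

-- An open value never counts, so a claw found here is a claw of every `f` with the known values.
-- The vectors are sought inside a given plane to keep the search small.
ClawIn : (Vect k → Maybe Bool) → Vec (Vect k) 3 → Set
ClawIn known π = ∃[ a ] ∃[ b ] ∃[ c ]
  ( is true (known (at a)) ≡ true × is true (known (at b)) ≡ true × is true (known (at c)) ≡ true
  × is false (known (at (a ⊕ b))) ≡ true × is false (known (at (a ⊕ c))) ≡ true
  × is false (known (at (b ⊕ c))) ≡ true × is false (known (at (a ⊕ (b ⊕ c)))) ≡ true )
  where
  at : Vect 3 → Vect _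
  at v = lincomb v π

clawIn? : (known : Vect k → Maybe Bool) (π : Vec (Vect k) 3) → Dec (ClawIn known π)
clawIn? known π = any-vect? λ a → any-vect? λ b → any-vect? λ c →
  (_ B.≟ _) ×-dec (_ B.≟ _) ×-dec (_ B.≟ _) ×-dec (_ B.≟ _) ×-dec (_ B.≟ _) ×-dec (_ B.≟ _) ×-dec (_ B.≟ _)

claw-search : {f : Subset n} → NoClaw f → (ρ : Vec (Vect n) k) (known : Vect k → Maybe Bool) →
  (∀ cs b → known cs ≡ just b → f (lincomb cs ρ) ≡ b) → {πs : List (Vec (Vect k) 3)} → Any (ClawIn known) πs → ⊥
claw-search cf ρ known val (there p) = claw-search cf ρ known val p
claw-search {f = f} cf ρ known val {π ∷ _} (here (a , b , c , ha , hb , hc , hab , hac , hbc , habc)) =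
  claw-at-lincomb cf ρ (lincomb a π) (lincomb b π) (lincomb c π) (to ha) (to hb) (to hc)
    (subst out (lincomb-⊕ a b π) (to hab)) (subst out (lincomb-⊕ a c π) (to hac)) (subst out (lincomb-⊕ b c π) (to hbc))
    (subst out (trans (lincomb-⊕ a (b ⊕ c) π) (cong (lincomb a π ⊕_) (lincomb-⊕ b c π))) (to habc))
  where
  out : Vect _ → Set
  out v = lincomb v ρ ∉ f
  to : ∀ {v b} → is b (known v) ≡ true → f (lincomb v ρ) ≡ b
  to {v} {b} h = val v b (is-sound h)

-- The values of f on the PG-sum of two triangles, in the basis α, α', β, β'.
q : Vect 4 → Bool
q (i ∷ j ∷ k ∷ l ∷ []) = (i ∨ j) xor (k ∨ l)

data Pattern : Set where
  copy-at  : Vect 4 → Bool → Pattern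
  constant : Bool → Pattern

-- A centre prescribes the values around it but not its own, hence `nothing` at `w`.
value : Pattern → Vect 4 → Maybe Bool
value (copy-at w c) u = if does (u ≟ᵛ w) then nothing else just (q (u ⊕ w) xor c)
value (constant c)  u = just c

two-cosets : Pattern → Pattern → Pattern → Vect 6 → Maybe Bool
two-cosets p₁ p₂ p₁₂ (false ∷ false ∷ u) = just (q u)
two-cosets p₁ p₂ p₁₂ (true ∷ false ∷ u)  = value p₁ u
two-cosets p₁ p₂ p₁₂ (false ∷ true ∷ u)  = value p₂ u
two-cosets p₁ p₂ p₁₂ (true ∷ true ∷ u)   = value p₁₂ u

-- Found by computer: each situation tabulated below has a claw in one of these planes.
planes : List (Vec (Vect 6) 3)
planes =
  ((O ∷ O ∷ I ∷ I ∷ O ∷ I ∷ []) ∷ (O ∷ I ∷ O ∷ I ∷ I ∷ O ∷ []) ∷ (I ∷ O ∷ O ∷ O ∷ I ∷ O ∷ []) ∷ []) ∷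
  ((O ∷ O ∷ I ∷ I ∷ I ∷ I ∷ []) ∷ (O ∷ I ∷ O ∷ O ∷ I ∷ I ∷ []) ∷ (I ∷ O ∷ O ∷ I ∷ I ∷ I ∷ []) ∷ []) ∷
  ((O ∷ O ∷ O ∷ I ∷ O ∷ O ∷ []) ∷ (O ∷ I ∷ I ∷ O ∷ O ∷ I ∷ []) ∷ (I ∷ O ∷ O ∷ O ∷ O ∷ I ∷ []) ∷ []) ∷
  ((O ∷ O ∷ I ∷ I ∷ O ∷ O ∷ []) ∷ (O ∷ I ∷ O ∷ I ∷ O ∷ O ∷ []) ∷ (I ∷ O ∷ O ∷ O ∷ I ∷ I ∷ []) ∷ []) ∷ []

search? : ∀ p₁ p₂ p₁₂ → Dec (Any (ClawIn (two-cosets p₁ p₂ p₁₂)) planes)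
search? p₁ p₂ p₁₂ = any? (clawIn? (two-cosets p₁ p₂ p₁₂)) planes

-- If the frame begins with the nonzero components of the displacement in `A` and `B`, these are its
-- only possible coordinates.
data Shift : Vect 4 → Set where
  along-α  : Shift (I ∷ O ∷ O ∷ O ∷ [])
  along-β  : Shift (O ∷ O ∷ I ∷ O ∷ [])
  along-αβ : Shift (I ∷ O ∷ I ∷ O ∷ [])

shifted-copies : ∀ {w} → Shift w → ∀ c₁ c₂ c₃ →
  Any (ClawIn (two-cosets (copy-at 0v c₁) (copy-at 0v c₂) (copy-at w c₃))) planes
shifted-copies {w} s c₁ c₂ c₃ = by s (c₁ ∷ c₂ ∷ c₃ ∷ [])
  where
  Claws : Vect 4 → Vect 3 → Set
  Claws w (c₁ ∷ c₂ ∷ c₃ ∷ []) = Any (ClawIn (two-cosets (copy-at 0v c₁) (copy-at 0v c₂) (copy-at w c₃))) planes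
  claws? : ∀ w cs → Dec (Claws w cs)
  claws? w (c₁ ∷ c₂ ∷ c₃ ∷ []) = search? (copy-at 0v c₁) (copy-at 0v c₂) (copy-at w c₃)
  by : ∀ {w} → Shift w → ∀ cs → Claws w cs
  by along-α  = does-sound (all-vect? (claws? _)) refl
  by along-β  = does-sound (all-vect? (claws? _)) refl
  by along-αβ = does-sound (all-vect? (claws? _)) refl

copies-const : ∀ c₁ c₂ κ → Any (ClawIn (two-cosets (copy-at 0v c₁) (copy-at 0v c₂) (constant κ))) planes
copies-const c₁ c₂ κ = does-sound (all-vect? claws?) refl (c₁ ∷ c₂ ∷ κ ∷ [])
  where
  Claws : Vect 3 → Set
  Claws (c₁ ∷ c₂ ∷ κ ∷ []) = Any (ClawIn (two-cosets (copy-at 0v c₁) (copy-at 0v c₂) (constant κ))) planes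
  claws? : ∀ cs → Dec (Claws cs)
  claws? (c₁ ∷ c₂ ∷ κ ∷ []) = search? (copy-at 0v c₁) (copy-at 0v c₂) (constant κ)

copy-consts : ∀ c κ → Any (ClawIn (two-cosets (copy-at 0v c) (constant κ) (constant (not κ)))) planes
copy-consts c κ = does-sound (all-vect? claws?) refl (c ∷ κ ∷ [])
  where
  Claws : Vect 2 → Set
  Claws (c ∷ κ ∷ []) = Any (ClawIn (two-cosets (copy-at 0v c) (constant κ) (constant (not κ)))) planes
  claws? : ∀ cs → Dec (Claws cs)
  claws? (c ∷ κ ∷ []) = search? (copy-at 0v c) (constant κ) (constant (not κ))

-- Parity

Σ₂ : (Vect k → Bool) → Bool
Σ₂ {zero}  F = F []
Σ₂ {suc k} F = Σ₂ (F ∘ (false ∷_)) xor Σ₂ (F ∘ (true ∷_))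

Σ₂-cong : {F G : Vect k → Bool} → (∀ v → F v ≡ G v) → Σ₂ F ≡ Σ₂ G
Σ₂-cong {zero}  eq = eq []
Σ₂-cong {suc k} eq = cong₂ _xor_ (Σ₂-cong (eq ∘ (false ∷_))) (Σ₂-cong (eq ∘ (true ∷_)))

xor-interchange : ∀ a b c d → (a xor b) xor (c xor d) ≡ (a xor c) xor (b xor d)
xor-interchange a b c d = trans (xor-assoc a b (c xor d)) (trans
  (cong (a xor_) (trans (sym (xor-assoc b c d)) (trans (cong (_xor d) (xor-comm b c)) (xor-assoc c b d))))
  (sym (xor-assoc a c (b xor d))))

Σ₂-xor : (F G : Vect k → Bool) → Σ₂ (λ v → F v xor G v) ≡ Σ₂ F xor Σ₂ G
Σ₂-xor {zero}  F G = refl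
Σ₂-xor {suc k} F G = trans (cong₂ _xor_ (Σ₂-xor (F ∘ (false ∷_)) (G ∘ (false ∷_))) (Σ₂-xor (F ∘ (true ∷_)) (G ∘ (true ∷_))))
  (xor-interchange (Σ₂ (F ∘ (false ∷_))) _ _ _)

-- Dependent triples are harmless, since each value then occurs an even number of times; including
-- them lets the parity be checked on arbitrary components of the three vectors.
Even : Subset n → Set
Even f = ∀ ps → Σ₂ (λ (cs : Vect 3) → f (lincomb cs ps)) ≡ false

q-even : ∀ us → Σ₂ (λ (cs : Vect 3) → q (lincomb cs us)) ≡ false
q-even (u₁ ∷ u₂ ∷ u₃ ∷ []) = does-sound (all-vect? λ u₁ → all-vect? λ u₂ → all-vect? λ u₃ →
  Σ₂ (λ (cs : Vect 3) → q (lincomb cs (u₁ ∷ u₂ ∷ u₃ ∷ []))) B.≟ false) refl u₁ u₂ u₃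

from-values : Vect 7 → Vect 3 → Bool
from-values (c₁ ∷ c₂ ∷ c₃ ∷ c₄ ∷ c₅ ∷ c₆ ∷ c₇ ∷ []) (O ∷ O ∷ O ∷ []) = false
from-values (c₁ ∷ c₂ ∷ c₃ ∷ c₄ ∷ c₅ ∷ c₆ ∷ c₇ ∷ []) (O ∷ O ∷ I ∷ []) = c₁
from-values (c₁ ∷ c₂ ∷ c₃ ∷ c₄ ∷ c₅ ∷ c₆ ∷ c₇ ∷ []) (O ∷ I ∷ O ∷ []) = c₂
from-values (c₁ ∷ c₂ ∷ c₃ ∷ c₄ ∷ c₅ ∷ c₆ ∷ c₇ ∷ []) (O ∷ I ∷ I ∷ []) = c₃
from-values (c₁ ∷ c₂ ∷ c₃ ∷ c₄ ∷ c₅ ∷ c₆ ∷ c₇ ∷ []) (I ∷ O ∷ O ∷ []) = c₄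
from-values (c₁ ∷ c₂ ∷ c₃ ∷ c₄ ∷ c₅ ∷ c₆ ∷ c₇ ∷ []) (I ∷ O ∷ I ∷ []) = c₅
from-values (c₁ ∷ c₂ ∷ c₃ ∷ c₄ ∷ c₅ ∷ c₆ ∷ c₇ ∷ []) (I ∷ I ∷ O ∷ []) = c₆
from-values (c₁ ∷ c₂ ∷ c₃ ∷ c₄ ∷ c₅ ∷ c₆ ∷ c₇ ∷ []) (I ∷ I ∷ I ∷ []) = c₇

-- The coordinates are those over three centres followed by those over the frame, and `c` records
-- the sign of each sum of centres. The values at the sums themselves, where `u` is 0, stay open.
sum-value : (Vect 3 → Bool) → Vect 7 → Maybe Bool
sum-value c (i ∷ j ∷ k ∷ u) = if does (u ≟ᵛ 0v) then nothing else just (q u xor c (i ∷ j ∷ k ∷ []))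

-- Found by computer, like the planes above.
odd-planes : List (Vec (Vect 7) 3)
odd-planes = graph (I ∷ O ∷ O ∷ O ∷ []) (O ∷ I ∷ O ∷ O ∷ []) (O ∷ O ∷ I ∷ O ∷ [])
           ∷ graph (I ∷ O ∷ O ∷ O ∷ []) (O ∷ I ∷ O ∷ O ∷ []) (I ∷ O ∷ I ∷ O ∷ [])
           ∷ graph (I ∷ O ∷ O ∷ O ∷ []) (O ∷ O ∷ I ∷ O ∷ []) (O ∷ O ∷ O ∷ I ∷ [])
           ∷ graph (I ∷ O ∷ O ∷ O ∷ []) (O ∷ O ∷ I ∷ O ∷ []) (I ∷ O ∷ O ∷ I ∷ [])
           ∷ graph (I ∷ O ∷ I ∷ O ∷ []) (O ∷ I ∷ O ∷ O ∷ []) (I ∷ O ∷ O ∷ O ∷ [])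
           ∷ graph (I ∷ O ∷ O ∷ O ∷ []) (O ∷ I ∷ O ∷ O ∷ []) (O ∷ I ∷ I ∷ O ∷ []) ∷ []
  where
  graph : Vect 4 → Vect 4 → Vect 4 → Vec (Vect 7) 3
  -- As the graph of a linear map, such a plane has one vector over each nonzero sum of centres, so
  -- all seven signs enter.
  graph u v w = (O ∷ O ∷ I ∷ u) ∷ (O ∷ I ∷ O ∷ v) ∷ (I ∷ O ∷ O ∷ w) ∷ []

odd-claw : ∀ cs → Σ₂ (from-values cs) ≡ true → Any (ClawIn (sum-value (from-values cs))) odd-planes
odd-claw = does-sound (all-vect? λ cs → (Σ₂ (from-values cs) B.≟ true) →-dec
  any? (clawIn? (sum-value (from-values cs))) odd-planes) refl

-- PG-sums

record PGSum (f A B : Subset n) (a₁ a₂ b₁ b₂ : Vect n) : Set where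
  field
    subA  : IsSubspace A
    subB  : IsSubspace B
    a₁∈A  : a₁ ∈ A
    a₂∈A  : a₂ ∈ A
    b₁∈B  : b₁ ∈ B
    b₂∈B  : b₂ ∈ B
    a₁≢0  : a₁ ≢ 0v
    a₂≢0  : a₂ ≢ 0v
    b₁≢0  : b₁ ≢ 0v
    b₂≢0  : b₂ ≢ 0v
    a₁≢a₂ : a₁ ≢ a₂
    b₁≢b₂ : b₁ ≢ b₂
    onesA : ∀ {a} → a ∈ A → a ≢ 0v → a ∈ f
    onesB : ∀ {b} → b ∈ B → b ≢ 0v → b ∈ f
    mixed : ∀ {a b} → a ∈ A → b ∈ B → a ≢ 0v → b ≢ 0v → (a ⊕ b) ∉ f

swap : ∀ {f A B : Subset n} {a₁ a₂ b₁ b₂} → PGSum f A B a₁ a₂ b₁ b₂ → PGSum f B A b₁ b₂ a₁ a₂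
swap {f = f} P = record
  { subA = subB ; subB = subA ; a₁∈A = b₁∈B ; a₂∈A = b₂∈B ; b₁∈B = a₁∈A ; b₂∈B = a₂∈A
  ; a₁≢0 = b₁≢0 ; a₂≢0 = b₂≢0 ; b₁≢0 = a₁≢0 ; b₂≢0 = a₂≢0 ; a₁≢a₂ = b₁≢b₂ ; b₁≢b₂ = a₁≢a₂
  ; onesA = onesB ; onesB = onesA
  ; mixed = λ {b} {a} b∈ a∈ b≢0 a≢0 → trans (cong f (⊕-comm b a)) (mixed a∈ b∈ a≢0 b≢0) }
  where open PGSum P

gridRules : ∀ {f A B : Subset n} {a₁ a₂ b₁ b₂} → NoClaw f → PGSum f A B a₁ a₂ b₁ b₂ → ∀ x →
  GridRules A B (λ a b → f (x ⊕ (a ⊕ b))) a₁ a₂ b₁ b₂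
gridRules {f = f} {A} {B} cf P x = record
  { subA = subA ; subB = subB ; a₁∈A = a₁∈A ; a₂∈A = a₂∈A ; b₁∈B = b₁∈B ; b₂∈B = b₂∈B
  ; a₁≢0 = a₁≢0 ; a₂≢0 = a₂≢0 ; b₁≢0 = b₁≢0 ; b₂≢0 = b₂≢0 ; a₁≢a₂ = a₁≢a₂ ; b₁≢b₂ = b₁≢b₂
  ; rectangle = λ {a} {a'} {b} {b'} a∈ a'∈ b∈ b'∈ a≢a' b≢b' h h₁ h₂ h₁₂ →
      claw-at cf (x ∷ a ∷ a' ∷ b ∷ b' ∷ []) (I ∷ I ∷ O ∷ I ∷ O ∷ []) (O ∷ I ∷ I ∷ O ∷ O ∷ []) (O ∷ O ∷ O ∷ I ∷ I ∷ [])
        h (onesA (cloA a∈ a'∈) (≢⇒⊕≢0 a≢a')) (onesB (cloB b∈ b'∈) (≢⇒⊕≢0 b≢b')) h₁ h₂ (cross a∈ a'∈ b∈ b'∈ a≢a' b≢b') h₁₂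
  ; two-changes = λ {a} {a'} {c} {c'} {b} {b'} a∈ a'∈ c∈ b∈ b'∈ a≢a' c≢a c≢a' b≢b' eq h h₁ h₂ h₁₂ →
      claw-at cf (x ∷ a ∷ a' ∷ c ∷ b ∷ b' ∷ [])
        (O ∷ I ∷ I ∷ O ∷ O ∷ O ∷ []) (I ∷ I ∷ O ∷ O ∷ I ∷ O ∷ []) (I ∷ O ∷ O ∷ I ∷ O ∷ I ∷ [])
        (onesA (cloA a∈ a'∈) (≢⇒⊕≢0 a≢a')) h h₂ h₁
        (trans (cong f (trans (solve 5 (λ x a a' c b' → x :⊕ a :⊕ a' :⊕ c :⊕ b' ⊜ x :⊕ (a :⊕ a' :⊕ c) :⊕ b') refl x a a' c b')
          (cong (λ t → x ⊕ (t ⊕ b')) eq))) h₁₂)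
        (cross a∈ c∈ b∈ b'∈ (c≢a ∘ sym) b≢b') (cross a'∈ c∈ b∈ b'∈ (c≢a' ∘ sym) b≢b')
  ; diagonal = λ {a} {a'} {a''} {a*} {b} {b'} {b''} {b*} a∈ a'∈ a''∈ b∈ b'∈ b''∈ a≢a' a≢a'' a'≢a'' b≢b' b≢b'' b'≢b'' ea eb h h' h'' h* →
      claw-at cf (x ∷ a ∷ a' ∷ a'' ∷ b ∷ b' ∷ b'' ∷ [])
        (I ∷ I ∷ O ∷ O ∷ I ∷ O ∷ O ∷ []) (I ∷ O ∷ I ∷ O ∷ O ∷ I ∷ O ∷ []) (I ∷ O ∷ O ∷ I ∷ O ∷ O ∷ I ∷ [])
        h h' h'' (cross a∈ a'∈ b∈ b'∈ a≢a' b≢b') (cross a∈ a''∈ b∈ b''∈ a≢a'' b≢b'') (cross a'∈ a''∈ b'∈ b''∈ a'≢a'' b'≢b'')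
        (trans (cong f (trans
          (solve 7 (λ x a a' a'' b b' b'' → x :⊕ a :⊕ a' :⊕ a'' :⊕ b :⊕ b' :⊕ b'' ⊜ x :⊕ (a :⊕ a' :⊕ a'') :⊕ b :⊕ b' :⊕ b'')
            refl x a a' a'' b b' b'')
          (cong₂ (λ s t → x ⊕ (s ⊕ t)) ea eb))) h*)
  }
  where
  open PGSum P
  cloA : ∀ {u v} → u ∈ A → v ∈ A → (u ⊕ v) ∈ A
  cloA = proj₂ subA _ _
  cloB : ∀ {u v} → u ∈ B → v ∈ B → (u ⊕ v) ∈ B
  cloB = proj₂ subB _ _
  cross : ∀ {a a' b b'} → a ∈ A → a' ∈ A → b ∈ B → b' ∈ B → a ≢ a' → b ≢ b' → (a ⊕ (a' ⊕ (b ⊕ b'))) ∉ f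
  cross {a} {a'} {b} {b'} a∈ a'∈ b∈ b'∈ a≢a' b≢b' = trans (cong f (sym (⊕-assoc a a' (b ⊕ b'))))
    (mixed (cloA a∈ a'∈) (cloB b∈ b'∈) (≢⇒⊕≢0 a≢a') (≢⇒⊕≢0 b≢b'))

grow-B : ∀ {f A B : Subset n} {a₁ a₂ b₁ b₂} → PGSum f A B a₁ a₂ b₁ b₂ → ∀ x →
  (∀ b → b ∈ B → (x ⊕ b) ∈ f) → (∀ a b → a ∈ A → b ∈ B → a ≢ 0v → (x ⊕ (a ⊕ b)) ∉ f) →
  PGSum f A (adj B x) a₁ a₂ b₁ b₂
grow-B {f = f} {A} {B} P x on off = record
  { subA = subA ; subB = adj-subspace B x subB ; a₁∈A = a₁∈A ; a₂∈A = a₂∈A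
  ; b₁∈B = adj-⊇ B x _ b₁∈B ; b₂∈B = adj-⊇ B x _ b₂∈B
  ; a₁≢0 = a₁≢0 ; a₂≢0 = a₂≢0 ; b₁≢0 = b₁≢0 ; b₂≢0 = b₂≢0 ; a₁≢a₂ = a₁≢a₂ ; b₁≢b₂ = b₁≢b₂
  ; onesA = onesA
  ; onesB = λ {b} b∈ b≢0 → [ (λ p → onesB p b≢0)
      , (λ p → trans (cong f (solve 2 (λ b x → b ⊜ x :⊕ b :⊕ x) refl b x)) (on _ p)) ]′ (adj-elim B x b b∈)
  ; mixed = λ {a} {b} a∈ b∈ a≢0 b≢0 → [ (λ p → mixed a∈ p a≢0 b≢0)
      , (λ p → trans (cong f (solve 3 (λ a b x → a :⊕ b ⊜ x :⊕ a :⊕ b :⊕ x) refl a b x)) (off a _ a∈ p a≢0)) ]′ (adj-elim B x b b∈)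
  }
  where open PGSum P

-- Centres and signs over a PG-sum

module Maximal {n : ℕ} {f A B : Subset n} {a₁ a₂ b₁ b₂ : Vect n} (f0 : 0v ∉ f) (cf : NoClaw f)
  (P : PGSum f A B a₁ a₂ b₁ b₂) where

  open PGSum P

  U : Subset n
  U = A ⊞ B

  subU : IsSubspace U
  subU = ⊞-subspace A B subA subB

  cloA : ∀ {u v} → u ∈ A → v ∈ A → (u ⊕ v) ∈ A
  cloA = proj₂ subA _ _

  cloB : ∀ {u v} → u ∈ B → v ∈ B → (u ⊕ v) ∈ B
  cloB = proj₂ subB _ _

  cloU : ∀ {u v} → u ∈ U → v ∈ U → (u ⊕ v) ∈ U
  cloU = proj₂ subU _ _

  0∈U : 0v ∈ U
  0∈U = proj₁ subU

  A⊆U : ∀ {a} → a ∈ A → a ∈ U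
  A⊆U {a} a∈ = subst (_∈ U) (⊕-identityʳ a) (⊞-intro A B a∈ (proj₁ subB))

  B⊆U : ∀ {b} → b ∈ B → b ∈ U
  B⊆U {b} b∈ = subst (_∈ U) (⊕-identityˡ b) (⊞-intro A B (proj₁ subA) b∈)

  -- A nonzero common vector plus `b₁` or `b₂` would be a one as a vector of `B` and a zero as a
  -- mixed sum.
  disjoint : ∀ v → v ∈ A → v ∈ B → v ≡ 0v
  disjoint v v∈A v∈B with v ≟ᵛ 0v | v ≟ᵛ b₁
  ... | yes v≡0 | _ = v≡0
  ... | no v≢0 | no v≢b₁ = ⊥-elim (true≢false (onesB (cloB v∈B b₁∈B) (≢⇒⊕≢0 v≢b₁)) (mixed v∈A b₁∈B v≢0 b₁≢0))
  ... | no v≢0 | yes refl = ⊥-elim (true≢false (onesB (cloB v∈B b₂∈B) (≢⇒⊕≢0 b₁≢b₂)) (mixed v∈A b₂∈B v≢0 b₂≢0))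

  sum≡0ˡ : ∀ {a b} → a ∈ A → b ∈ B → a ⊕ b ≡ 0v → a ≡ 0v
  sum≡0ˡ {a} a∈ b∈ eq = disjoint a a∈ (subst (_∈ B) (sym (⊕≡0⇒≡ eq)) b∈)

  sum≡0ʳ : ∀ {a b} → a ∈ A → b ∈ B → a ⊕ b ≡ 0v → b ≡ 0v
  sum≡0ʳ {b = b} a∈ b∈ eq = disjoint b (subst (_∈ A) (⊕≡0⇒≡ eq) a∈) b∈

  -- Sign `false` is a copy of `f` on `U`; sign `true` is a copy of its negation. Nothing is said
  -- about `d` itself.
  Signed : Bool → Vect n → Set
  Signed c d = ∀ u → u ∈ U → u ≢ 0v → f (d ⊕ u) ≡ f u xor c

  signed-0 : Signed false 0v
  signed-0 u _ _ = trans (cong f (⊕-identityˡ u)) (sym (xor-identityʳ (f u)))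

  -- The sign of a centre z, read off at a₁, where f is 1.
  σ : Vect n → Bool
  σ z = not (f (z ⊕ a₁))

  a₁∈U : a₁ ∈ U
  a₁∈U = A⊆U a₁∈A

  sign : ∀ {c d} → Signed c d → σ d ≡ c
  sign {c} s = trans (cong not (trans (s a₁ a₁∈U a₁≢0) (cong (_xor c) (onesA a₁∈A a₁≢0)))) (not-involutive c)

  -- On independent pairs in `A` and `B` the function `f` is the fixed table `q`, whatever the
  -- dimensions. The pairs remain free, so that a frame can be adapted to a given vector of `U`.
  module Frame {α α' β β' : Vect n} (α∈ : α ∈ A) (α'∈ : α' ∈ A) (β∈ : β ∈ B) (β'∈ : β' ∈ B)
    (α≢0 : α ≢ 0v) (α'≢0 : α' ≢ 0v) (β≢0 : β ≢ 0v) (β'≢0 : β' ≢ 0v) (α≢α' : α ≢ α') (β≢β' : β ≢ β') where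

    frame : Vec (Vect n) 4
    frame = α ∷ α' ∷ β ∷ β' ∷ []

    inA : Bool → Bool → Vect n
    inA i j = ⨁ (i ∷ j ∷ []) (α ∷ α' ∷ [])

    inB : Bool → Bool → Vect n
    inB k l = ⨁ (k ∷ l ∷ []) (β ∷ β' ∷ [])

    inA∈ : ∀ i j → inA i j ∈ A
    inA∈ false false = proj₁ subA
    inA∈ true  false = α∈
    inA∈ false true  = α'∈
    inA∈ true  true  = cloA α∈ α'∈

    inB∈ : ∀ k l → inB k l ∈ B
    inB∈ false false = proj₁ subB
    inB∈ true  false = β∈
    inB∈ false true  = β'∈
    inB∈ true  true  = cloB β∈ β'∈

    inA-0 : ∀ i j → (i ∨ j ≡ true × inA i j ≢ 0v) ⊎ (i ∨ j ≡ false × inA i j ≡ 0v)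
    inA-0 false false = inj₂ (refl , refl)
    inA-0 true  false = inj₁ (refl , α≢0)
    inA-0 false true  = inj₁ (refl , α'≢0)
    inA-0 true  true  = inj₁ (refl , ≢⇒⊕≢0 α≢α')

    inB-0 : ∀ k l → (k ∨ l ≡ true × inB k l ≢ 0v) ⊎ (k ∨ l ≡ false × inB k l ≡ 0v)
    inB-0 false false = inj₂ (refl , refl)
    inB-0 true  false = inj₁ (refl , β≢0)
    inB-0 false true  = inj₁ (refl , β'≢0)
    inB-0 true  true  = inj₁ (refl , ≢⇒⊕≢0 β≢β')

    split : ∀ i j k l → lincomb (i ∷ j ∷ k ∷ l ∷ []) frame ≡ inA i j ⊕ inB k l
    split i j k l = trans (trans (sym (⊕-assoc _ _ _)) (cong₂ _⊕_ (cong (_ ⊕_) (sym (⊕-identityʳ _))) refl))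
      (sym (cong₂ _⊕_ (⨁≡lincomb (i ∷ j ∷ []) (α ∷ α' ∷ [])) (⨁≡lincomb (k ∷ l ∷ []) (β ∷ β' ∷ []))))

    lin∈U : ∀ u → lincomb u frame ∈ U
    lin∈U (i ∷ j ∷ k ∷ l ∷ []) = subst (_∈ U) (sym (split i j k l)) (⊞-intro A B (inA∈ i j) (inB∈ k l))

    lin≢0 : ∀ u → u ≢ 0v → lincomb u frame ≢ 0v
    lin≢0 (i ∷ j ∷ k ∷ l ∷ []) u≢0 eq with inA-0 i j | inB-0 k l
    ... | inj₁ (_ , a≢0) | _ = a≢0 (sum≡0ˡ (inA∈ i j) (inB∈ k l) (trans (sym (split i j k l)) eq))
    ... | _ | inj₁ (_ , b≢0) = b≢0 (sum≡0ʳ (inA∈ i j) (inB∈ k l) (trans (sym (split i j k l)) eq))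
    lin≢0 (false ∷ false ∷ false ∷ false ∷ []) u≢0 eq | inj₂ _ | inj₂ _ = u≢0 refl

    f-lin : ∀ u → f (lincomb u frame) ≡ q u
    f-lin (i ∷ j ∷ k ∷ l ∷ []) = trans (cong f (split i j k l)) (by (inA-0 i j) (inB-0 k l))
      where
      by : (i ∨ j ≡ true × inA i j ≢ 0v) ⊎ (i ∨ j ≡ false × inA i j ≡ 0v) →
           (k ∨ l ≡ true × inB k l ≢ 0v) ⊎ (k ∨ l ≡ false × inB k l ≡ 0v) → f (inA i j ⊕ inB k l) ≡ q (i ∷ j ∷ k ∷ l ∷ [])
      by (inj₁ (x , a≢0)) (inj₁ (y , b≢0)) = trans (mixed (inA∈ i j) (inB∈ k l) a≢0 b≢0) (sym (cong₂ _xor_ x y))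
      by (inj₁ (x , a≢0)) (inj₂ (y , b≡0)) = trans (cong f (trans (cong (inA i j ⊕_) b≡0) (⊕-identityʳ _)))
        (trans (onesA (inA∈ i j) a≢0) (sym (cong₂ _xor_ x y)))
      by (inj₂ (x , a≡0)) (inj₁ (y , b≢0)) = trans (cong f (trans (cong (_⊕ inB k l) a≡0) (⊕-identityˡ _)))
        (trans (onesB (inB∈ k l) b≢0) (sym (cong₂ _xor_ x y)))
      by (inj₂ (x , a≡0)) (inj₂ (y , b≡0)) = trans (cong f (trans (cong₂ _⊕_ a≡0 b≡0) (⊕-self 0v))) (trans f0 (sym (cong₂ _xor_ x y)))

    Follows : Pattern → Vect n → Set
    Follows p d = ∀ u b → value p u ≡ just b → f (d ⊕ lincomb u frame) ≡ b

    follows-copy : ∀ {c d} w → Signed c (d ⊕ lincomb w frame) → Follows (copy-at w c) d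
    follows-copy {c} {d} w s u b eq with u ≟ᵛ w
    follows-copy {c} {d} w s u b refl | no u≢w = trans (cong f shape)
      (trans (s (lincomb (u ⊕ w) frame) (lin∈U (u ⊕ w)) (lin≢0 (u ⊕ w) (≢⇒⊕≢0 u≢w))) (cong (_xor c) (f-lin (u ⊕ w))))
      where
      shape : d ⊕ lincomb u frame ≡ (d ⊕ lincomb w frame) ⊕ lincomb (u ⊕ w) frame
      shape = trans (solve 3 (λ d u w → d :⊕ u ⊜ (d :⊕ w) :⊕ u :⊕ w) refl d (lincomb u frame) (lincomb w frame))
        (cong ((d ⊕ lincomb w frame) ⊕_) (sym (lincomb-⊕ u w frame)))

    follows-copy₀ : ∀ {c d} → Signed c d → Follows (copy-at 0v c) d
    follows-copy₀ {c} {d} s = follows-copy 0v (subst (Signed c) (sym (trans (cong (d ⊕_) (lincomb-0 frame)) (⊕-identityʳ d))) s)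

    follows-const : ∀ {κ d} → (∀ u → u ∈ U → f (d ⊕ u) ≡ κ) → Follows (constant κ) d
    follows-const h u b refl = h _ (lin∈U u)

    no-claw-pattern : ∀ {p₁ p₂ p₁₂ d₁ d₂} → Follows p₁ d₁ → Follows p₂ d₂ → Follows p₁₂ (d₁ ⊕ d₂) →
      ¬ Any (ClawIn (two-cosets p₁ p₂ p₁₂)) planes
    no-claw-pattern {p₁} {p₂} {p₁₂} {d₁} {d₂} h₁ h₂ h₁₂ = claw-search cf (d₁ ∷ d₂ ∷ frame) (two-cosets p₁ p₂ p₁₂) known
      where
      known : ∀ cs b → two-cosets p₁ p₂ p₁₂ cs ≡ just b → f (lincomb cs (d₁ ∷ d₂ ∷ frame)) ≡ b
      known (false ∷ false ∷ u) b refl = trans (cong f (trans (⊕-identityˡ _) (⊕-identityˡ _))) (f-lin u)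
      known (true ∷ false ∷ u)  b eq = trans (cong (λ t → f (d₁ ⊕ t)) (⊕-identityˡ _)) (h₁ u b eq)
      known (false ∷ true ∷ u)  b eq = trans (cong f (⊕-identityˡ _)) (h₂ u b eq)
      known (true ∷ true ∷ u)   b eq = trans (cong f (sym (⊕-assoc d₁ d₂ _))) (h₁₂ u b eq)

  open Frame a₁∈A a₂∈A b₁∈B b₂∈B a₁≢0 a₂≢0 b₁≢0 b₂≢0 a₁≢a₂ b₁≢b₂

  centres-sum-not-const : ∀ {c₁ c₂ d₁ d₂ κ} → Signed c₁ d₁ → Signed c₂ d₂ → ¬ (∀ u → u ∈ U → f ((d₁ ⊕ d₂) ⊕ u) ≡ κ)
  centres-sum-not-const {c₁} {c₂} {κ = κ} s₁ s₂ h =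
    no-claw-pattern (follows-copy₀ s₁) (follows-copy₀ s₂) (follows-const h) (copies-const c₁ c₂ κ)

  consts-along-centre : ∀ {c d t κ κ'} → Signed c d → (∀ u → u ∈ U → f (t ⊕ u) ≡ κ) → (∀ u → u ∈ U → f ((d ⊕ t) ⊕ u) ≡ κ') → κ' ≡ κ
  consts-along-centre {c} {d} {t} {κ} {κ'} s h h' with κ' B.≟ κ
  ... | yes eq = eq
  ... | no ne = ⊥-elim (no-claw-pattern (follows-copy₀ s) (follows-const h) (follows-const h'') (copy-consts c κ))
    where
    differ : ∀ {a b} → a ≢ b → a ≡ not b
    differ {true}  {true}  ne = ⊥-elim (ne refl)
    differ {false} {false} ne = ⊥-elim (ne refl)
    differ {true}  {false} _  = refl
    differ {false} {true}  _  = refl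
    h'' : ∀ u → u ∈ U → f ((d ⊕ t) ⊕ u) ≡ not κ
    h'' u u∈ = trans (h' u u∈) (differ ne)

  other-A : ∀ a → ∃[ a' ] (a' ∈ A × a' ≢ 0v × a ≢ a')
  other-A a with a₁ ≟ᵛ a
  ... | no a₁≢a  = a₁ , a₁∈A , a₁≢0 , a₁≢a ∘ sym
  ... | yes refl = a₂ , a₂∈A , a₂≢0 , a₁≢a₂

  other-B : ∀ b → ∃[ b' ] (b' ∈ B × b' ≢ 0v × b ≢ b')
  other-B b with b₁ ≟ᵛ b
  ... | no b₁≢b  = b₁ , b₁∈B , b₁≢0 , b₁≢b ∘ sym
  ... | yes refl = b₂ , b₂∈B , b₂≢0 , b₁≢b₂

  -- Each nonzero component of `w` in `A` or `B` is taken as the first frame vector there; every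
  -- displacement then falls under a tabulated claw, for all signs.
  centres-sum : ∀ {c₁ c₂ c₃ d₁ d₂ w} → Signed c₁ d₁ → Signed c₂ d₂ → w ∈ U → Signed c₃ ((d₁ ⊕ d₂) ⊕ w) → w ≡ 0v
  centres-sum {c₁} {c₂} {c₃} {d₁} {d₂} s₁ s₂ w∈U s₃ with ⊞-elim A B w∈U
  ... | a , b , a∈ , b∈ , refl = by (a ≟ᵛ 0v) (b ≟ᵛ 0v) (other-A a) (other-B b)
    where
    by : Dec (a ≡ 0v) → Dec (b ≡ 0v) → ∃[ a' ] (a' ∈ A × a' ≢ 0v × a ≢ a') → ∃[ b' ] (b' ∈ B × b' ≢ 0v × b ≢ b') → a ⊕ b ≡ 0v
    by (yes refl) (yes refl) _ _ = ⊕-self 0v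
    by (no a≢0) (yes refl) (a' , a'∈ , a'≢0 , a≢a') _ = ⊥-elim (Fr.no-claw-pattern (Fr.follows-copy₀ s₁) (Fr.follows-copy₀ s₂)
        (Fr.follows-copy (I ∷ O ∷ O ∷ O ∷ []) (subst (λ t → Signed c₃ ((d₁ ⊕ d₂) ⊕ t)) (sym (Fr.split I O O O)) s₃))
        (shifted-copies along-α c₁ c₂ c₃))
      where
      module Fr = Frame a∈ a'∈ b₁∈B b₂∈B a≢0 a'≢0 b₁≢0 b₂≢0 a≢a' b₁≢b₂
    by (yes refl) (no b≢0) _ (b' , b'∈ , b'≢0 , b≢b') = ⊥-elim (Fr.no-claw-pattern (Fr.follows-copy₀ s₁) (Fr.follows-copy₀ s₂)
        (Fr.follows-copy (O ∷ O ∷ I ∷ O ∷ []) (subst (λ t → Signed c₃ ((d₁ ⊕ d₂) ⊕ t)) (sym (Fr.split O O I O)) s₃))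
        (shifted-copies along-β c₁ c₂ c₃))
      where
      module Fr = Frame a₁∈A a₂∈A b∈ b'∈ a₁≢0 a₂≢0 b≢0 b'≢0 a₁≢a₂ b≢b'
    by (no a≢0) (no b≢0) (a' , a'∈ , a'≢0 , a≢a') (b' , b'∈ , b'≢0 , b≢b') = ⊥-elim (Fr.no-claw-pattern (Fr.follows-copy₀ s₁) (Fr.follows-copy₀ s₂)
        (Fr.follows-copy (I ∷ O ∷ I ∷ O ∷ []) (subst (λ t → Signed c₃ ((d₁ ⊕ d₂) ⊕ t)) (sym (Fr.split I O I O)) s₃))
        (shifted-copies along-αβ c₁ c₂ c₃))
      where
      module Fr = Frame a∈ a'∈ b∈ b'∈ a≢0 a'≢0 b≢0 b'≢0 a≢a' b≢b'

  -- The two extensions enlarge the PG-sum.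
  data Kind (x : Vect n) : Set where
    const    : (∀ u → u ∈ U → f (x ⊕ u) ≡ f x) → Kind x
    extend-A : ∀ y → y ∉ U → (∀ a → a ∈ A → (y ⊕ a) ∈ f) → (∀ b a → b ∈ B → a ∈ A → b ≢ 0v → (y ⊕ (b ⊕ a)) ∉ f) → Kind x
    extend-B : ∀ y → y ∉ U → (∀ b → b ∈ B → (y ⊕ b) ∈ f) → (∀ a b → a ∈ A → b ∈ B → a ≢ 0v → (y ⊕ (a ⊕ b)) ∉ f) → Kind x
    centre   : ∀ w c → w ∈ U → Signed c (x ⊕ w) → Kind x

  kind : ∀ x → x ∉ U → Kind x
  kind x x∉U with classify (gridRules cf P x) (gridRules cf (swap P) x) (λ a b → cong (λ t → f (x ⊕ t)) (⊕-comm a b))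
  ... | constant h = const λ u u∈ → const-on u (⊞-elim A B u∈)
    where
    const-on : ∀ u → ∃[ a ] ∃[ b ] (a ∈ A × b ∈ B × u ≡ a ⊕ b) → f (x ⊕ u) ≡ f x
    const-on _ (a , b , a∈ , b∈ , refl) = trans (h a b a∈ b∈) (cong f (solve 1 (λ x → x :⊕ :0 :⊕ :0 ⊜ x) refl x))
  ... | row a₀ a₀∈ off on = extend-B (x ⊕ a₀) (∉-shift subU x a₀ x∉U (A⊆U a₀∈))
      (λ b b∈ → trans (cong f (⊕-assoc x a₀ b)) (on b b∈))
      (λ a b a∈ b∈ a≢0 → trans (cong f (solve 4 (λ x a₀ a b → (x :⊕ a₀) :⊕ a :⊕ b ⊜ x :⊕ (a₀ :⊕ a) :⊕ b) refl x a₀ a b))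
        (off _ b (cloA a₀∈ a∈) b∈ (≢-shift a≢0 ∘ sym)))
  ... | column b₀ b₀∈ off on = extend-A (x ⊕ b₀) (∉-shift subU x b₀ x∉U (B⊆U b₀∈))
      (λ a a∈ → trans (cong f (solve 3 (λ x b₀ a → (x :⊕ b₀) :⊕ a ⊜ x :⊕ a :⊕ b₀) refl x b₀ a)) (on a a∈))
      (λ b a b∈ a∈ b≢0 → trans (cong f (solve 4 (λ x b₀ a b → (x :⊕ b₀) :⊕ b :⊕ a ⊜ x :⊕ a :⊕ b₀ :⊕ b) refl x b₀ a b))
        (off a _ a∈ (cloB b₀∈ b∈) (≢-shift b≢0 ∘ sym)))
  ... | centred a₀ b₀ c a₀∈ b₀∈ inner in-col in-row = centre (a₀ ⊕ b₀) c (⊞-intro A B a₀∈ b₀∈) λ u u∈ u≢0 → signed u u≢0 (⊞-elim A B u∈)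
    where
    signed : ∀ u → u ≢ 0v → ∃[ a ] ∃[ b ] (a ∈ A × b ∈ B × u ≡ a ⊕ b) → f ((x ⊕ (a₀ ⊕ b₀)) ⊕ u) ≡ f u xor c
    signed _ u≢0 (a , b , a∈ , b∈ , refl) with a ≟ᵛ 0v | b ≟ᵛ 0v
    ... | yes refl | yes refl = ⊥-elim (u≢0 (⊕-self 0v))
    ... | no a≢0 | yes refl = trans (cong f (solve 4 (λ x a₀ b₀ a → (x :⊕ a₀ :⊕ b₀) :⊕ a :⊕ :0 ⊜ x :⊕ (a₀ :⊕ a) :⊕ b₀) refl x a₀ b₀ a))
      (trans (in-col _ (cloA a₀∈ a∈) (≢-shift a≢0 ∘ sym))
        (sym (cong (_xor c) (trans (cong f (⊕-identityʳ a)) (onesA a∈ a≢0)))))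
    ... | yes refl | no b≢0 = trans (cong f (solve 4 (λ x a₀ b₀ b → (x :⊕ a₀ :⊕ b₀) :⊕ :0 :⊕ b ⊜ x :⊕ a₀ :⊕ b₀ :⊕ b) refl x a₀ b₀ b))
      (trans (in-row _ (cloB b₀∈ b∈) (≢-shift b≢0 ∘ sym))
        (sym (cong (_xor c) (trans (cong f (⊕-identityˡ b)) (onesB b∈ b≢0)))))
    ... | no a≢0 | no b≢0 = trans (cong f (solve 5 (λ x a₀ b₀ a b → (x :⊕ a₀ :⊕ b₀) :⊕ a :⊕ b ⊜ x :⊕ (a₀ :⊕ a) :⊕ b₀ :⊕ b) refl x a₀ b₀ a b))
      (trans (inner _ _ (cloA a₀∈ a∈) (cloB b₀∈ b∈) (≢-shift a≢0 ∘ sym) (≢-shift b≢0 ∘ sym))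
        (sym (cong (_xor c) (mixed a∈ b∈ a≢0 b≢0))))

  module Stuck (indV : Indecomposable f full)
    (settled : ∀ x → x ∉ U → (∀ u → u ∈ U → f (x ⊕ u) ≡ f x) ⊎ ∃[ w ] ∃[ c ] (w ∈ U × Signed c (x ⊕ w))) where

    signed? : ∀ z → Dec (Signed (σ z) z)
    signed? z = all-vect? λ u → (U u B.≟ true) →-dec (¬? (u ≟ᵛ 0v) →-dec (f (z ⊕ u) B.≟ (f u xor σ z)))

    Z : Subset n
    Z z = does (signed? z)

    signed : ∀ {z} → z ∈ Z → Signed (σ z) z
    signed {z} = does-sound (signed? z)

    centre∈Z : ∀ {c z} → Signed c z → z ∈ Z
    centre∈Z {z = z} s = dec-true (signed? z) (subst (λ c → Signed c z) (sym (sign s)) s)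

    0∈Z : 0v ∈ Z
    0∈Z = centre∈Z signed-0

    -- Centres `v` and 0 with displacement `v`: the displaced sum is the centre 0, so `centres-sum`
    -- gives `v = 0`.
    U∩Z : ∀ v → v ∈ U → v ∈ Z → v ≡ 0v
    U∩Z v v∈U v∈Z = centres-sum (signed v∈Z) signed-0 v∈U
      (subst (Signed false) (solve 1 (λ v → :0 ⊜ (v :⊕ :0) :⊕ v) refl v) signed-0)

    -- The coset of `d + e` is not constant, so off `U` it has a centre, which `centres-sum`
    -- identifies with `d + e`. If `d + e` lies in `U`, the displacement `d + e` leads to the centre
    -- 0.
    closed : ∀ d e → d ∈ Z → e ∈ Z → (d ⊕ e) ∈ Z
    closed d e d∈ e∈ with U (d ⊕ e) in de
    ... | true = subst (_∈ Z) (sym (centres-sum (signed d∈) (signed e∈) de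
        (subst (Signed false) (sym (⊕-self (d ⊕ e))) signed-0))) 0∈Z
    ... | false with settled (d ⊕ e) de
    ...   | inj₁ k = ⊥-elim (centres-sum-not-const (signed d∈) (signed e∈) k)
    ...   | inj₂ (w , c , w∈U , s) = centre∈Z (subst (Signed c)
        (trans (cong ((d ⊕ e) ⊕_) (centres-sum (signed d∈) (signed e∈) w∈U s)) (⊕-identityʳ (d ⊕ e))) s)

    subZ : IsSubspace Z
    subZ = 0∈Z , closed

    S : Subset n
    S = U ⊞ Z

    subS : IsSubspace S
    subS = ⊞-subspace U Z subU subZ

    const-outside : ∀ {x} → x ∉ S → ∀ u → u ∈ U → f (x ⊕ u) ≡ f x
    const-outside {x} x∉S with settled x (≢true⇒false λ x∈U → true≢false
      (subst (_∈ S) (⊕-identityʳ x) (⊞-intro U Z x∈U 0∈Z)) x∉S)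
    ... | inj₁ k = k
    ... | inj₂ (w , c , w∈U , s) = ⊥-elim (true≢false (subst (_∈ S) (solve 2 (λ x w → w :⊕ x :⊕ w ⊜ x) refl x w)
        (⊞-intro U Z w∈U (centre∈Z s))) x∉S)

    all : ∀ v → v ∈ S
    all = sum-exhausts indV subU subZ (a₁ , a₁≢0 , a₁∈U) (λ x u x∉ → const-outside x∉ u) λ x z x∉ z∈ →
      trans (cong f (⊕-comm x z)) (consts-along-centre (signed z∈) (const-outside x∉) (λ u u∈ → trans
        (const-outside (subst (_∉ S) (⊕-comm x z) (∉-shift subS x z x∉ (subst (_∈ S) (⊕-identityˡ z) (⊞-intro U Z 0∈U z∈)))) u u∈) refl))

    unsigned⇒all : (∀ z → z ∈ Z → σ z ≡ false) → ∀ v → v ∈ U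
    unsigned⇒all none = copies-trivial indV subU subZ (a₁ , a₁≢0 , a₁∈U) U∩Z
      (λ z u z∈ u∈ u≢0 → trans (signed z∈ u u∈ u≢0) (trans (cong (f u xor_) (none z z∈)) (xor-identityʳ (f u)))) all

    -- A centre of sign true makes A and B two-dimensional; then f is a quadratic
    -- form on U plus the function σ on Z.
    module _ (z : Vect n) (z∈Z : z ∈ Z) (σz : σ z ≡ true) where

      negated : ∀ {u} → u ∈ U → u ≢ 0v → f (z ⊕ u) ≡ not (f u)
      negated {u} u∈ u≢0 = trans (signed z∈Z u u∈ u≢0) (trans (cong (f u xor_) σz) (xor-comm (f u) true))

      -- On `z + U` the mixed sums are ones, and nonzero vectors of `A` and `B` give zeros. A vector
      -- of `A` outside the span of `a₁`, `a₂` then yields a claw whose three generators lie in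
      -- `z + U`; likewise for `B`.
      U-framed : ∀ u → u ∈ U → ∃[ us ] (lincomb us frame ≡ u)
      U-framed u u∈ with ⊞-elim A B u∈
      ... | a , b , a∈ , b∈ , refl with in-pair P (λ a∈ b∈ a≢0 → negated (⊞-intro A B a∈ b∈) (λ e → a≢0 (sum≡0ˡ a∈ b∈ e))) a∈
                                     | in-pair (swap P) (λ {b} {a} b∈ a∈ b≢0 → negated (subst (_∈ U) (⊕-comm a b) (⊞-intro A B a∈ b∈))
                                         (λ e → b≢0 (sum≡0ʳ a∈ b∈ (trans (⊕-comm a b) e)))) b∈
        where
        in-pair : ∀ {A B a₁ a₂ b₁ b₂} → PGSum f A B a₁ a₂ b₁ b₂ →
          (∀ {a b} → a ∈ A → b ∈ B → a ≢ 0v → f (z ⊕ (a ⊕ b)) ≡ not (f (a ⊕ b))) →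
          ∀ {a} → a ∈ A → ∃[ i ] ∃[ j ] (a ≡ ⨁ (i ∷ j ∷ []) (a₁ ∷ a₂ ∷ []))
        in-pair {A} {B} {a₁} {a₂} {b₁} {b₂} Q neg {a} a∈ with a ≟ᵛ 0v | a ≟ᵛ a₁ | a ≟ᵛ a₂ | a ≟ᵛ (a₁ ⊕ a₂)
        ... | yes eq | _ | _ | _ = O , O , eq
        ... | _ | yes eq | _ | _ = I , O , eq
        ... | _ | _ | yes eq | _ = O , I , eq
        ... | _ | _ | _ | yes eq = I , I , eq
        ... | no a≢0 | no a≢a₁ | no a≢a₂ | no a≢a₁₂ = ⊥-elim (claw-at cf (z ∷ a ∷ a₁ ∷ a₂ ∷ b₁ ∷ b₂ ∷ [])
            (I ∷ I ∷ I ∷ O ∷ I ∷ O ∷ []) (I ∷ I ∷ O ∷ I ∷ O ∷ I ∷ []) (I ∷ I ∷ I ∷ I ∷ I ∷ I ∷ [])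
            (trans (cong f (solve 4 (λ z a a₁ b₁ → z :⊕ a :⊕ a₁ :⊕ b₁ ⊜ z :⊕ (a :⊕ a₁) :⊕ b₁) refl z a a₁ b₁))
              (one (cloA' a∈ Q.a₁∈A) Q.b₁∈B (≢⇒⊕≢0 a≢a₁) Q.b₁≢0))
            (trans (cong f (solve 4 (λ z a a₁ b₁ → z :⊕ a :⊕ a₁ :⊕ b₁ ⊜ z :⊕ (a :⊕ a₁) :⊕ b₁) refl z a a₂ b₂))
              (one (cloA' a∈ Q.a₂∈A) Q.b₂∈B (≢⇒⊕≢0 a≢a₂) Q.b₂≢0))
            (trans (cong f (solve 6 (λ z a a₁ a₂ b₁ b₂ → z :⊕ a :⊕ a₁ :⊕ a₂ :⊕ b₁ :⊕ b₂ ⊜ z :⊕ (a :⊕ a₁ :⊕ a₂) :⊕ b₁ :⊕ b₂) refl z a a₁ a₂ b₁ b₂))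
              (one (cloA' a∈ (cloA' Q.a₁∈A Q.a₂∈A)) (cloB' Q.b₁∈B Q.b₂∈B) (≢⇒⊕≢0 a≢a₁₂) (≢⇒⊕≢0 Q.b₁≢b₂)))
            (trans (cong f (sym (⊕-assoc a₁ a₂ (b₁ ⊕ b₂)))) (Q.mixed (cloA' Q.a₁∈A Q.a₂∈A) (cloB' Q.b₁∈B Q.b₂∈B) (≢⇒⊕≢0 Q.a₁≢a₂) (≢⇒⊕≢0 Q.b₁≢b₂)))
            (Q.mixed Q.a₂∈A Q.b₂∈B Q.a₂≢0 Q.b₂≢0)
            (Q.mixed Q.a₁∈A Q.b₁∈B Q.a₁≢0 Q.b₁≢0)
            (trans (cong (λ t → f (z ⊕ t)) (sym (⊕-identityʳ a))) (trans (neg a∈ (proj₁ Q.subB) a≢0)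
              (cong not (trans (cong f (⊕-identityʳ a)) (Q.onesA a∈ a≢0))))))
          where
          module Q = PGSum Q
          cloA' : ∀ {u v} → u ∈ A → v ∈ A → (u ⊕ v) ∈ A
          cloA' = proj₂ Q.subA _ _
          cloB' : ∀ {u v} → u ∈ B → v ∈ B → (u ⊕ v) ∈ B
          cloB' = proj₂ Q.subB _ _
          one : ∀ {a b} → a ∈ A → b ∈ B → a ≢ 0v → b ≢ 0v → (z ⊕ (a ⊕ b)) ∈ f
          one a∈ b∈ a≢0 b≢0 = trans (neg a∈ b∈ a≢0) (cong not (Q.mixed a∈ b∈ a≢0 b≢0))
      ...   | i , j , refl | k , l , refl = (i ∷ j ∷ k ∷ l ∷ []) , split i j k l

      -- The claw is the one of `in-pair` with `a` replaced by 0.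
      z∈f⇐σ : ∀ y → y ∈ Z → σ y ≡ true → y ∈ f
      z∈f⇐σ y y∈ σy = ≢false⇒true λ y∉f → claw-at cf (y ∷ a₁ ∷ a₂ ∷ b₁ ∷ b₂ ∷ [])
        (I ∷ I ∷ O ∷ I ∷ O ∷ []) (I ∷ O ∷ I ∷ O ∷ I ∷ []) (I ∷ I ∷ I ∷ I ∷ I ∷ [])
        (one a₁∈A b₁∈B a₁≢0 b₁≢0) (one a₂∈A b₂∈B a₂≢0 b₂≢0)
        (trans (cong (λ t → f (y ⊕ t)) (sym (⊕-assoc a₁ a₂ (b₁ ⊕ b₂)))) (one (cloA a₁∈A a₂∈A) (cloB b₁∈B b₂∈B) (≢⇒⊕≢0 a₁≢a₂) (≢⇒⊕≢0 b₁≢b₂)))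
        (trans (cong f (sym (⊕-assoc a₁ a₂ (b₁ ⊕ b₂)))) (mixed (cloA a₁∈A a₂∈A) (cloB b₁∈B b₂∈B) (≢⇒⊕≢0 a₁≢a₂) (≢⇒⊕≢0 b₁≢b₂)))
        (mixed a₂∈A b₂∈B a₂≢0 b₂≢0) (mixed a₁∈A b₁∈B a₁≢0 b₁≢0) y∉f
        where
        one : ∀ {a b} → a ∈ A → b ∈ B → a ≢ 0v → b ≢ 0v → (y ⊕ (a ⊕ b)) ∈ f
        one a∈ b∈ a≢0 b≢0 = trans (signed y∈ _ (⊞-intro A B a∈ b∈) (λ e → a≢0 (sum≡0ˡ a∈ b∈ e)))
          (cong₂ _xor_ (mixed a∈ b∈ a≢0 b≢0) σy)

      -- A centre b of sign false with b ∈ E would lie in the subspace of all centres of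
      -- sign false that are periods of σ, and that subspace is a decomposer.
      Period? : ∀ d → Dec (d ∈ Z × σ d ≡ false × (∀ y → y ∈ Z → σ (d ⊕ y) ≡ σ y))
      Period? d = (Z d B.≟ true) ×-dec (σ d B.≟ false) ×-dec all-vect? λ y → (Z y B.≟ true) →-dec (σ (d ⊕ y) B.≟ σ y)

      Periods : Subset n
      Periods d = does (Period? d)

      subPeriods : IsSubspace Periods
      subPeriods = dec-true (Period? 0v) (0∈Z , sign signed-0 , λ y _ → cong σ (⊕-identityˡ y)) , λ d e d∈ e∈ →
        let (d∈Z , σd , pd) = does-sound (Period? d) d∈ ; (e∈Z , σe , pe) = does-sound (Period? e) e∈ in
        dec-true (Period? (d ⊕ e)) (closed d e d∈Z e∈Z , trans (pd e e∈Z) σe ,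
          λ y y∈ → trans (cong σ (⊕-assoc d e y)) (trans (pd (e ⊕ y) (closed e y e∈Z y∈)) (pe y y∈)))

      -- If `σ` changes from `y` to `b + y`, translation by `b` negates `f` on `y + U` off `y`.
      -- Since `v` and `b + v` are zeros, `b` forms a claw with the one among `w`, `b + w` and the
      -- one among `w + v`, `b + w + v`, for `w = y + a₂`.
      bad⇒period : ∀ b → b ∈ Z → σ b ≡ false → b ∈ f → b ∈ Periods
      bad⇒period b b∈ σb b∈f = dec-true (Period? b) (b∈ , σb , period)
        where
        v : Vect n
        v = a₁ ⊕ b₁
        v∈U = ⊞-intro A B a₁∈A b₁∈B
        v∉f = mixed a₁∈A b₁∈B a₁≢0 b₁≢0
        bv∉f : (b ⊕ v) ∉ f
        bv∉f = trans (signed b∈ v v∈U (λ e → a₁≢0 (sum≡0ˡ a₁∈A b₁∈B e))) (cong₂ _xor_ v∉f σb)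
        claw : ∀ w s t → f w ≡ s → f (b ⊕ w) ≡ not s → f (w ⊕ v) ≡ t → f (b ⊕ (w ⊕ v)) ≡ not t → ⊥
        claw w true  true  p p' r r' = claw-at cf (b ∷ w ∷ v ∷ []) (I ∷ O ∷ O ∷ []) (O ∷ I ∷ O ∷ []) (O ∷ I ∷ I ∷ []) b∈f p r p' r' v∉f bv∉f
        claw w true  false p p' r r' = claw-at cf (b ∷ w ∷ v ∷ []) (I ∷ O ∷ O ∷ []) (O ∷ I ∷ O ∷ []) (I ∷ I ∷ I ∷ []) b∈f p r' p' r bv∉f v∉f
        claw w false true  p p' r r' = claw-at cf (b ∷ w ∷ v ∷ []) (I ∷ O ∷ O ∷ []) (I ∷ I ∷ O ∷ []) (O ∷ I ∷ I ∷ []) b∈f p' r p r' bv∉f v∉f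
        claw w false false p p' r r' = claw-at cf (b ∷ w ∷ v ∷ []) (I ∷ O ∷ O ∷ []) (I ∷ I ∷ O ∷ []) (I ∷ I ∷ I ∷ []) b∈f p' r' p r v∉f bv∉f
        period : ∀ y → y ∈ Z → σ (b ⊕ y) ≡ σ y
        period y y∈ with σ (b ⊕ y) B.≟ σ y
        ... | yes eq = eq
        ... | no ne = ⊥-elim (claw (y ⊕ a₂) _ _ refl (flips (A⊆U a₂∈A) a₂≢0) refl
              (trans (cong f (solve 4 (λ b y a₂ v → b :⊕ (y :⊕ a₂) :⊕ v ⊜ b :⊕ y :⊕ a₂ :⊕ v) refl b y a₂ v))
                (trans (flips (cloU (A⊆U a₂∈A) v∈U) a₂v≢0) (cong not (cong f (sym (⊕-assoc y a₂ v)))))))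
          where
          a₂v≢0 : a₂ ⊕ v ≢ 0v
          a₂v≢0 e = b₁≢0 (sum≡0ʳ (cloA a₂∈A a₁∈A) b₁∈B (trans (⊕-assoc a₂ a₁ b₁) e))
          flip-xor : ∀ a c c' → c' ≢ c → a xor c' ≡ not (a xor c)
          flip-xor a true  true  ne = ⊥-elim (ne refl)
          flip-xor a false false ne = ⊥-elim (ne refl)
          flip-xor true  true  false _ = refl
          flip-xor true  false true  _ = refl
          flip-xor false true  false _ = refl
          flip-xor false false true  _ = refl
          flips : ∀ {u} → u ∈ U → u ≢ 0v → f (b ⊕ (y ⊕ u)) ≡ not (f (y ⊕ u))
          flips {u} u∈ u≢0 = trans (cong f (sym (⊕-assoc b y u))) (trans (signed (closed b y b∈ y∈) u u∈ u≢0)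
            (trans (flip-xor (f u) (σ y) (σ (b ⊕ y)) ne) (cong not (sym (signed y∈ u u∈ u≢0)))))

      f-non-period : ∀ y → y ∈ Z → y ∉ Periods → f y ≡ σ y
      f-non-period y y∈ y∉ with σ y B.≟ true
      ... | yes σy = trans (z∈f⇐σ y y∈ σy) (sym σy)
      ... | no ¬σy = trans (≢true⇒false λ y∈f → true≢false (bad⇒period y y∈ (≢true⇒false ¬σy) y∈f) y∉) (sym (≢true⇒false ¬σy))

      periods-trivial : ∀ d → d ∈ Periods → d ≡ 0v
      periods-trivial d d∈ with d ≟ᵛ 0v
      ... | yes d≡0 = d≡0
      ... | no d≢0 = ⊥-elim (indV Periods (subPeriods , (λ _ _ → refl) , (d , d≢0 , d∈) , (a₁ , refl , a₁∉) , inv))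
        where
        a₁∉ : a₁ ∉ Periods
        a₁∉ = ≢true⇒false λ a₁∈ → a₁≢0 (U∩Z a₁ a₁∈U (proj₁ (does-sound (Period? a₁) a₁∈)))
        period-shift : ∀ d u y → d ∈ Periods → u ∈ U → y ∈ Z → (u ⊕ y) ∉ Periods →
          d ∈ Z × σ d ≡ false × (∀ y → y ∈ Z → σ (d ⊕ y) ≡ σ y) → Dec (u ≡ 0v) → f ((u ⊕ y) ⊕ d) ≡ f (u ⊕ y)
        period-shift d u y d∈ u∈ y∈ x∉ (d∈Z , σd , pd) (no u≢0) = trans (cong f (solve 3 (λ u y d → (u :⊕ y) :⊕ d ⊜ (d :⊕ y) :⊕ u) refl u y d))
              (trans (signed (closed d y d∈Z y∈) u u∈ u≢0) (trans (cong (f u xor_) (pd y y∈))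
                (sym (trans (cong f (⊕-comm u y)) (signed y∈ u u∈ u≢0)))))
        period-shift d u y d∈ u∈ y∈ x∉ (d∈Z , σd , pd) (yes refl) = trans (cong f (solve 2 (λ y d → (:0 :⊕ y) :⊕ d ⊜ d :⊕ y) refl y d))
              (trans (f-non-period (d ⊕ y) (closed d y d∈Z y∈) (subst (_∉ Periods) (⊕-comm y d) (∉-shift subPeriods y d y∉ d∈)))
                (trans (pd y y∈) (sym (trans (cong f (⊕-identityˡ y)) (f-non-period y y∈ y∉)))))
          where
          y∉ : y ∉ Periods
          y∉ = subst (_∉ Periods) (⊕-identityˡ y) x∉
        inv : ∀ x d → x ∈ full → x ∉ Periods → d ∈ Periods → f (x ⊕ d) ≡ f x
        inv x d _ x∉ d∈ = via (⊞-elim U Z (all x))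
          where
          via : ∃[ u ] ∃[ y ] (u ∈ U × y ∈ Z × x ≡ u ⊕ y) → f (x ⊕ d) ≡ f x
          via (u , y , u∈ , y∈ , eq) = subst (λ x → f (x ⊕ d) ≡ f x) (sym eq)
            (period-shift d u y d∈ u∈ y∈ (subst (_∉ Periods) eq x∉) (does-sound (Period? d) d∈) (u ≟ᵛ 0v))

      f-Z : ∀ y → y ∈ Z → f y ≡ σ y
      f-Z y y∈ = by (Periods y B.≟ true)
        where
        by : Dec (y ∈ Periods) → f y ≡ σ y
        by (no ¬py) = f-non-period y y∈ (≢true⇒false ¬py)
        by (yes py) = trans (cong f (periods-trivial y py)) (trans f0 (sym (trans (cong σ (periods-trivial y py)) (sign signed-0))))

      -- At `us = 0` the defining relation of a centre is silent, and `f-Z` supplies the value.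
      f-sum : ∀ us y → y ∈ Z → f (lincomb us frame ⊕ y) ≡ q us xor σ y
      f-sum us y y∈ with us ≟ᵛ 0v
      ... | yes refl = trans (cong f (trans (cong (_⊕ y) (lincomb-0 frame)) (⊕-identityˡ y))) (f-Z y y∈)
      ... | no us≢0 = trans (cong f (⊕-comm _ y)) (trans (signed y∈ _ (lin∈U us) (lin≢0 us us≢0)) (cong (_xor σ y) (f-lin us)))

      lincomb∈Z : ∀ {k} (cs : Vect k) ys → (∀ i → lookup ys i ∈ Z) → lincomb cs ys ∈ Z
      lincomb∈Z []           []       _  = 0∈Z
      lincomb∈Z (true ∷ cs)  (y ∷ ys) h = closed _ _ (h zero) (lincomb∈Z cs ys (h ∘ suc))
      lincomb∈Z (false ∷ cs) (y ∷ ys) h = closed _ _ 0∈Z (lincomb∈Z cs ys (h ∘ suc))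

      -- Signs of odd sum on the combinations of three centres would force one of the claws
      -- tabulated in `odd-claw`.
      σ-even : ∀ y₁ y₂ y₃ → y₁ ∈ Z → y₂ ∈ Z → y₃ ∈ Z → Σ₂ (λ (cs : Vect 3) → σ (lincomb cs (y₁ ∷ y₂ ∷ y₃ ∷ []))) ≡ false
      σ-even y₁ y₂ y₃ y₁∈ y₂∈ y₃∈ = ≢true⇒false λ odd → claw-search cf ((y₁ ∷ y₂ ∷ y₃ ∷ []) ++ frame) (sum-value (from-values cs)) known
        (odd-claw cs (trans (sym (Σ₂-cong table)) odd))
        where
        ys : Vec (Vect n) 3
        ys = y₁ ∷ y₂ ∷ y₃ ∷ []
        s : Vect 3 → Bool
        s c = σ (lincomb c ys)
        cs : Vect 7
        cs = s (O ∷ O ∷ I ∷ []) ∷ s (O ∷ I ∷ O ∷ []) ∷ s (O ∷ I ∷ I ∷ []) ∷ s (I ∷ O ∷ O ∷ []) ∷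
             s (I ∷ O ∷ I ∷ []) ∷ s (I ∷ I ∷ O ∷ []) ∷ s (I ∷ I ∷ I ∷ []) ∷ []
        table : ∀ c → s c ≡ from-values cs c
        table (O ∷ O ∷ O ∷ []) = trans (cong σ (lincomb-0 ys)) (sign signed-0)
        table (O ∷ O ∷ I ∷ []) = refl
        table (O ∷ I ∷ O ∷ []) = refl
        table (O ∷ I ∷ I ∷ []) = refl
        table (I ∷ O ∷ O ∷ []) = refl
        table (I ∷ O ∷ I ∷ []) = refl
        table (I ∷ I ∷ O ∷ []) = refl
        table (I ∷ I ∷ I ∷ []) = refl
        in-Z : ∀ i → lookup ys i ∈ Z
        in-Z zero             = y₁∈
        in-Z (suc zero)       = y₂∈
        in-Z (suc (suc zero)) = y₃∈
        known : ∀ c b → sum-value (from-values cs) c ≡ just b → f (lincomb c (ys ++ frame)) ≡ b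
        known (i ∷ j ∷ k ∷ u) b eq with u ≟ᵛ 0v
        known (i ∷ j ∷ k ∷ u) b refl | no u≢0 = trans
          (cong f (solve 4 (λ p r t w → p :⊕ r :⊕ t :⊕ w ⊜ w :⊕ p :⊕ r :⊕ t :⊕ :0) refl _ _ _ _))
          (trans (f-sum u _ (lincomb∈Z (i ∷ j ∷ k ∷ []) ys in-Z)) (cong (q u xor_) (table (i ∷ j ∷ k ∷ []))))

      decompose : ∀ p → ∃[ us ] ∃[ y ] (y ∈ Z × p ≡ lincomb us frame ⊕ y)
      decompose p = from (⊞-elim U Z (all p))
        where
        from : ∃[ u ] ∃[ y ] (u ∈ U × y ∈ Z × p ≡ u ⊕ y) → ∃[ us ] ∃[ y ] (y ∈ Z × p ≡ lincomb us frame ⊕ y)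
        from (u , y , u∈ , y∈ , eq) = let (us , eq') = U-framed u u∈ in us , y , y∈ , trans eq (cong (_⊕ y) (sym eq'))

      join : Vect 4 → Vect n → Vect n
      join us y = lincomb us frame ⊕ y

      distribute : ∀ {k} (cs : Vect k) (us : Vec (Vect 4) k) (ys : Vec (Vect n) k) →
        lincomb cs (zipWith join us ys) ≡ lincomb (lincomb cs us) frame ⊕ lincomb cs ys
      distribute []       []       []       = trans (sym (⊕-self 0v)) (cong (_⊕ 0v) (sym (lincomb-0 frame)))
      distribute (c ∷ cs) (u ∷ us) (y ∷ ys) = trans (cong₂ _⊕_ (head c) (distribute cs us ys))
        (trans (⊕-interchange _ _ _ _) (cong (_⊕ _) (sym (lincomb-⊕ (if c then u else 0v) (lincomb cs us) frame))))
        where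
        head : ∀ c → (if c then lincomb u frame ⊕ y else 0v) ≡ lincomb (if c then u else 0v) frame ⊕ (if c then y else 0v)
        head true  = refl
        head false = trans (sym (⊕-self 0v)) (cong (_⊕ 0v) (sym (lincomb-0 frame)))

      even-at : ∀ (us : Vec (Vect 4) 3) y₁ y₂ y₃ → y₁ ∈ Z → y₂ ∈ Z → y₃ ∈ Z →
        Σ₂ (λ (cs : Vect 3) → f (lincomb cs (zipWith join us (y₁ ∷ y₂ ∷ y₃ ∷ [])))) ≡ false
      even-at us y₁ y₂ y₃ y₁∈ y₂∈ y₃∈ = trans (Σ₂-cong split-value)
        (trans (Σ₂-xor {3} (λ cs → q (lincomb cs us)) (λ cs → σ (lincomb cs ys)))
          (cong₂ _xor_ (q-even us) (σ-even y₁ y₂ y₃ y₁∈ y₂∈ y₃∈)))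
        where
        ys : Vec (Vect n) 3
        ys = y₁ ∷ y₂ ∷ y₃ ∷ []
        in-Z : ∀ i → lookup ys i ∈ Z
        in-Z zero             = y₁∈
        in-Z (suc zero)       = y₂∈
        in-Z (suc (suc zero)) = y₃∈
        split-value : ∀ cs → f (lincomb cs (zipWith join us ys)) ≡ q (lincomb cs us) xor σ (lincomb cs ys)
        split-value cs = trans (cong f (distribute cs us ys)) (f-sum (lincomb cs us) _ (lincomb∈Z cs ys in-Z))

      even : Even f
      even (p₁ ∷ p₂ ∷ p₃ ∷ []) =
        let (u₁ , y₁ , y₁∈ , eq₁) = decompose p₁
            (u₂ , y₂ , y₂∈ , eq₂) = decompose p₂
            (u₃ , y₃ , y₃∈ , eq₃) = decompose p₃
        in trans (Σ₂-cong {3} λ cs → cong (λ ps → f (lincomb cs ps)) (cong₂ _∷_ eq₁ (cong₂ _∷_ eq₂ (cong₂ _∷_ eq₃ (refl {x = []})))))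
                 (even-at (u₁ ∷ u₂ ∷ u₃ ∷ []) y₁ y₂ y₃ y₁∈ y₂∈ y₃∈)

-- From two triangles to a PG-sum of the whole space

record PGCover (f A B : Subset n) : Set where
  field
    subA    : IsSubspace A
    subB    : IsSubspace B
    a≢0     : ∃[ a ] (a ≢ 0v × a ∈ A)
    b≢0     : ∃[ b ] (b ≢ 0v × b ∈ B)
    disj    : ∀ v → v ∈ A → v ∈ B → v ≡ 0v
    onesA   : ∀ a → a ∈ A → a ≢ 0v → a ∈ f
    onesB   : ∀ b → b ∈ B → b ≢ 0v → b ∈ f
    mixed   : ∀ a b → a ∈ A → b ∈ B → a ≢ 0v → b ≢ 0v → (a ⊕ b) ∉ f
    covers  : ∀ v → ∃[ a ] (a ∈ A × (a ⊕ v) ∈ B)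

module BiTriangleCase {n : ℕ} {f : Subset n} (f0 : 0v ∉ f) (cf : NoClaw f) (indV : Indecomposable f full)
  (¬even : ¬ Even f) (¬pg : ∀ A B → ¬ PGCover f A B) where

  descend : ∀ k {A B : Subset n} {a₁ a₂ b₁ b₂} → co-size A + co-size B < k → PGSum f A B a₁ a₂ b₁ b₂ → ⊥
  descend (suc k) {A} {B} (s≤s le) P = conclude (any-vect? λ z → (Z z B.≟ true) ×-dec (σ z B.≟ true))
    where
    open PGSum P
    open Maximal f0 cf P hiding (cloA; cloB)
    grow-A : ∀ y → y ∉ U → (∀ a → a ∈ A → (y ⊕ a) ∈ f) → (∀ b a → b ∈ B → a ∈ A → b ≢ 0v → (y ⊕ (b ⊕ a)) ∉ f) → ⊥
    grow-A y y∉ on off = descend k (<-≤-trans (+-mono-<-≤ (co-size-strict (adj-⊇ A y) y y∉A (adj-self A y subA)) ≤-refl) le)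
      (swap (grow-B (swap P) y on off))
      where
      y∉A : y ∉ A
      y∉A = ≢true⇒false λ y∈ → true≢false (A⊆U y∈) y∉
    grow-B' : ∀ y → y ∉ U → (∀ b → b ∈ B → (y ⊕ b) ∈ f) → (∀ a b → a ∈ A → b ∈ B → a ≢ 0v → (y ⊕ (a ⊕ b)) ∉ f) → ⊥
    grow-B' y y∉ on off = descend k (<-≤-trans (+-mono-≤-< (≤-refl {co-size A}) (co-size-strict (adj-⊇ B y) y y∉B (adj-self B y subB))) le)
      (grow-B P y on off)
      where
      y∉B : y ∉ B
      y∉B = ≢true⇒false λ y∈ → true≢false (B⊆U y∈) y∉
    settled : ∀ x → x ∉ U → (∀ u → u ∈ U → f (x ⊕ u) ≡ f x) ⊎ ∃[ w ] ∃[ c ] (w ∈ U × Signed c (x ⊕ w))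
    settled x x∉ with kind x x∉
    ... | const k = inj₁ k
    ... | centre w c w∈ s = inj₂ (w , c , w∈ , s)
    ... | extend-A y y∉ on off = ⊥-elim (grow-A y y∉ on off)
    ... | extend-B y y∉ on off = ⊥-elim (grow-B' y y∉ on off)
    open Stuck indV settled
    conclude : Dec (∃[ z ] (z ∈ Z × σ z ≡ true)) → ⊥
    conclude (yes (z , z∈ , σz)) = ¬even (even z z∈ σz)
    conclude (no none) = ¬pg A B record
      { subA = subA ; subB = subB ; a≢0 = _ , a₁≢0 , a₁∈A ; b≢0 = _ , b₁≢0 , b₁∈B ; disj = disjoint
      ; onesA = λ a → onesA ; onesB = λ b → onesB ; mixed = λ a b → mixed
      ; covers = λ v → does-sound (⊞? A B v) (unsigned⇒all (λ z z∈ → ≢true⇒false λ σz → none (z , z∈ , σz)) v) }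

  bi-triangle-contradiction : ∀ {a₁ a₂ b₁ b₂} → ¬ BiTriangle f a₁ a₂ b₁ b₂
  bi-triangle-contradiction {a₁} {a₂} {b₁} {b₂} T = descend _ ≤-refl record
    { subA = span-subspace as ; subB = span-subspace bs
    ; a₁∈A = in-span as (I ∷ O ∷ []) ; a₂∈A = in-span as (O ∷ I ∷ []) ; b₁∈B = in-span bs (I ∷ O ∷ []) ; b₂∈B = in-span bs (O ∷ I ∷ [])
    ; a₁≢0 = ≢0 T.a₁∈ ; a₂≢0 = ≢0 T.a₂∈ ; b₁≢0 = ≢0 T.b₁∈ ; b₂≢0 = ≢0 T.b₂∈
    ; a₁≢a₂ = λ { refl → ≢0 T.a₁₂∈ (⊕-self a₁) } ; b₁≢b₂ = λ { refl → ≢0 T.b₁₂∈ (⊕-self b₁) }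
    ; onesA = λ a∈ → onesA (out-span as a∈) ; onesB = λ b∈ → onesB (out-span bs b∈)
    ; mixed = λ a∈ b∈ → mixed (out-span as a∈) (out-span bs b∈) }
    where
    module T = BiTriangle T
    as bs : Vec (Vect n) 2
    as = a₁ ∷ a₂ ∷ []
    bs = b₁ ∷ b₂ ∷ []
    ≢0 : ∀ {v} → v ∈ f → v ≢ 0v
    ≢0 v∈ refl = true≢false v∈ f0
    in-span : ∀ (ρ : Vec (Vect n) 2) cs → ⨁ cs ρ ∈ span ρ
    in-span ρ cs = subst (_∈ span ρ) (sym (⨁≡lincomb cs ρ)) (span-intro ρ cs)
    out-span : ∀ (ρ : Vec (Vect n) 2) {v} → v ∈ span ρ → ∃[ cs ] (⨁ cs ρ ≡ v)
    out-span ρ v∈ = let (cs , eq) = span-elim ρ v∈ in cs , trans (⨁≡lincomb cs ρ) eq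
    onesA : ∀ {a} → ∃[ cs ] (⨁ cs as ≡ a) → a ≢ 0v → a ∈ f
    onesA (O ∷ O ∷ [] , refl) a≢0 = ⊥-elim (a≢0 refl)
    onesA (I ∷ O ∷ [] , refl) _ = T.a₁∈
    onesA (O ∷ I ∷ [] , refl) _ = T.a₂∈
    onesA (I ∷ I ∷ [] , refl) _ = T.a₁₂∈
    onesB : ∀ {b} → ∃[ cs ] (⨁ cs bs ≡ b) → b ≢ 0v → b ∈ f
    onesB (O ∷ O ∷ [] , refl) b≢0 = ⊥-elim (b≢0 refl)
    onesB (I ∷ O ∷ [] , refl) _ = T.b₁∈
    onesB (O ∷ I ∷ [] , refl) _ = T.b₂∈
    onesB (I ∷ I ∷ [] , refl) _ = T.b₁₂∈
    mixed : ∀ {a b} → ∃[ cs ] (⨁ cs as ≡ a) → ∃[ cs ] (⨁ cs bs ≡ b) → a ≢ 0v → b ≢ 0v → (a ⊕ b) ∉ f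
    mixed (O ∷ O ∷ [] , refl) _ a≢0 _ = ⊥-elim (a≢0 refl)
    mixed (I ∷ O ∷ [] , _) (O ∷ O ∷ [] , refl) _ b≢0 = ⊥-elim (b≢0 refl)
    mixed (O ∷ I ∷ [] , _) (O ∷ O ∷ [] , refl) _ b≢0 = ⊥-elim (b≢0 refl)
    mixed (I ∷ I ∷ [] , _) (O ∷ O ∷ [] , refl) _ b≢0 = ⊥-elim (b≢0 refl)
    mixed (I ∷ O ∷ [] , refl) (I ∷ O ∷ [] , refl) _ _ = T.a₁b₁∉
    mixed (I ∷ O ∷ [] , refl) (O ∷ I ∷ [] , refl) _ _ = T.a₁b₂∉
    mixed (I ∷ O ∷ [] , refl) (I ∷ I ∷ [] , refl) _ _ = T.a₁b₁₂∉
    mixed (O ∷ I ∷ [] , refl) (I ∷ O ∷ [] , refl) _ _ = T.a₂b₁∉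
    mixed (O ∷ I ∷ [] , refl) (O ∷ I ∷ [] , refl) _ _ = T.a₂b₂∉
    mixed (O ∷ I ∷ [] , refl) (I ∷ I ∷ [] , refl) _ _ = T.a₂b₁₂∉
    mixed (I ∷ I ∷ [] , refl) (I ∷ O ∷ [] , refl) _ _ = T.a₁₂b₁∉
    mixed (I ∷ I ∷ [] , refl) (O ∷ I ∷ [] , refl) _ _ = T.a₁₂b₂∉
    mixed (I ∷ I ∷ [] , refl) (I ∷ I ∷ [] , refl) _ _ = T.a₁₂b₁₂∉

-- Flats

-- The zero test of `with0` is local to it; applying `with0` to the empty set exposes that very
-- test.
isZero : Vect n → Bool
isZero = with0 (λ _ → false)

isZero-sound : (v : Vect n) → isZero v ≡ true → v ≡ 0v
isZero-sound []          _ = refl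
isZero-sound (false ∷ v) p = cong (false ∷_) (isZero-sound v p)

isZero-0 : isZero (0v {n}) ≡ true
isZero-0 {zero}  = refl
isZero-0 {suc n} = isZero-0 {n}

≢0⇒¬isZero : {v : Vect n} → v ≢ 0v → isZero v ≡ false
≢0⇒¬isZero {v = v} v≢0 = ≢true⇒false (v≢0 ∘ isZero-sound v)

punctured : Subset n → Subset n
punctured D v = D v ∧ not (isZero v)

punctured-intro : (D : Subset n) {v : Vect n} → v ∈ D → v ≢ 0v → v ∈ punctured D
punctured-intro D v∈ v≢0 rewrite v∈ | ≢0⇒¬isZero v≢0 = refl

punctured-elim : (D : Subset n) {v : Vect n} → v ∈ punctured D → v ∈ D × v ≢ 0v
punctured-elim {n} D {v} p with D v | isZero v in z
... | true | false = refl , λ { refl → true≢false (isZero-0 {n}) z }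

0∉punctured : (D : Subset n) → 0v ∉ punctured D
0∉punctured D = ≢true⇒false λ p → proj₂ (punctured-elim D p) refl

with0-punctured : (D : Subset n) → 0v ∈ D → ∀ v → with0 (punctured D) v ≡ D v
with0-punctured D 0∈D v = go (D v) (isZero v) (λ z → trans (cong D (isZero-sound v z)) 0∈D)
  where
  go : ∀ d z → (z ≡ true → d ≡ true) → (d ∧ not z) ∨ z ≡ d
  go true  true  _ = refl
  go true  false _ = refl
  go false false _ = refl
  go false true  h = sym (h refl)

with0-elim : (F : Subset n) {v : Vect n} → v ∈ with0 F → v ∈ F ⊎ v ≡ 0v
with0-elim F {v} p with F v
... | true  = inj₁ refl
... | false = inj₂ (isZero-sound v p)

subspace-resp : {S T : Subset n} → (∀ v → S v ≡ T v) → IsSubspace S → IsSubspace T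
subspace-resp eq (0∈ , clo) = trans (sym (eq _)) 0∈ ,
  λ x y x∈ y∈ → trans (sym (eq (x ⊕ y))) (clo x y (trans (eq x) x∈) (trans (eq y) y∈))

flat-punctured : (D : Subset n) → IsSubspace D → IsFlat (punctured D)
flat-punctured D sub = 0∉punctured D , subspace-resp (λ v → sym (with0-punctured D (proj₁ sub) v)) sub

-- Independence of `a`, `b`, `c` comes from the values: a vanishing combination would put 0 into E
-- or identify two of the seven vectors with different values.
clawFree⇒noClaw : (M : Matroid n) → ClawFree M → NoClaw (E M)
clawFree⇒noClaw {n} M cf a b c a∈ b∈ c∈ ab∉ ac∉ bc∉ abc∉ =
  cf F flat ((flat , bs , indep , spans) , bs , indep , spans , λ v → mk⇔ (in-basis v) (basis-in v))
  where
  f = E M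
  bs : Vec (Vect n) 3
  bs = a ∷ b ∷ c ∷ []
  F : Subset n
  F = punctured (span bs)
  flat : IsFlat F
  flat = flat-punctured (span bs) (span-subspace bs)
  spans : ∀ v → (v ∈ with0 F) ⇔ InSpan v bs
  spans v = mk⇔ (λ p → span-elim bs (trans (sym (eq v)) p))
    (λ { (cs , refl) → trans (eq (lincomb cs bs)) (span-intro bs cs) })
    where
    eq = with0-punctured (span bs) (proj₁ (span-subspace bs))
  nonzero : ∀ {v} → v ∈ f → v ≢ 0v
  nonzero v∈ refl = true≢false v∈ (E⊆G M)
  vals : ∀ cs → ⨁ cs bs ≡ 0v → cs ≡ 0v
  vals (O ∷ O ∷ O ∷ []) _ = refl
  vals (I ∷ O ∷ O ∷ []) z = ⊥-elim (nonzero a∈ z)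
  vals (O ∷ I ∷ O ∷ []) z = ⊥-elim (nonzero b∈ z)
  vals (O ∷ O ∷ I ∷ []) z = ⊥-elim (nonzero c∈ z)
  vals (I ∷ I ∷ O ∷ []) z = ⊥-elim (true≢false c∈ (trans (cong f (trans (sym (⊕-cancel a c)) (cong (λ t → a ⊕ (t ⊕ c)) (⊕≡0⇒≡ z)))) abc∉))
  vals (I ∷ O ∷ I ∷ []) z = ⊥-elim (true≢false b∈ (trans (cong f (trans (solve 2 (λ a b → b ⊜ a :⊕ b :⊕ a) refl a b) (cong (λ t → a ⊕ (b ⊕ t)) (⊕≡0⇒≡ z)))) abc∉))
  vals (O ∷ I ∷ I ∷ []) z = ⊥-elim (true≢false a∈ (trans (cong f (trans (sym (⊕-identityʳ a)) (cong (a ⊕_) (sym z)))) abc∉))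
  vals (I ∷ I ∷ I ∷ []) z = ⊥-elim (true≢false a∈ (trans (cong f (⊕≡0⇒≡ z)) bc∉))
  indep : LinIndep bs
  indep cs z = vals cs (trans (⨁≡lincomb cs bs) z)
  in-basis : ∀ v → v ∈ (E M ∩ F) → VAny.Any (v ≡_) bs
  in-basis v p = aux p (span-elim bs (proj₁ (punctured-elim (span bs) (∧-right {f v} p))))
    where
    ∧-left : ∀ {x y} → x ∧ y ≡ true → x ≡ true
    ∧-left {true} _ = refl
    ∧-right : ∀ {x y} → x ∧ y ≡ true → y ≡ true
    ∧-right {true} q = q
    find : ∀ cs → ⨁ cs bs ≡ v → v ∈ f → VAny.Any (v ≡_) bs
    find (O ∷ O ∷ O ∷ []) refl v∈ = ⊥-elim (true≢false v∈ (E⊆G M))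
    find (I ∷ O ∷ O ∷ []) refl v∈ = VAny.here refl
    find (O ∷ I ∷ O ∷ []) refl v∈ = VAny.there (VAny.here refl)
    find (O ∷ O ∷ I ∷ []) refl v∈ = VAny.there (VAny.there (VAny.here refl))
    find (I ∷ I ∷ O ∷ []) refl v∈ = ⊥-elim (true≢false v∈ ab∉)
    find (I ∷ O ∷ I ∷ []) refl v∈ = ⊥-elim (true≢false v∈ ac∉)
    find (O ∷ I ∷ I ∷ []) refl v∈ = ⊥-elim (true≢false v∈ bc∉)
    find (I ∷ I ∷ I ∷ []) refl v∈ = ⊥-elim (true≢false v∈ abc∉)
    aux : v ∈ (E M ∩ F) → InSpan v bs → VAny.Any (v ≡_) bs
    aux p (cs , eq) = find cs (trans (⨁≡lincomb cs bs) eq) (∧-left {f v} p)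
  member : ∀ cs → ⨁ cs bs ∈ f → ⨁ cs bs ∈ (E M ∩ F)
  member cs p rewrite p = punctured-intro (span bs) (subst (_∈ span bs) (sym (⨁≡lincomb cs bs)) (span-intro bs cs)) (nonzero p)
  basis-in : ∀ v → VAny.Any (v ≡_) bs → v ∈ (E M ∩ F)
  basis-in _ (VAny.here refl)                             = member (I ∷ O ∷ O ∷ []) a∈
  basis-in _ (VAny.there (VAny.here refl))                = member (O ∷ I ∷ O ∷ []) b∈
  basis-in _ (VAny.there (VAny.there (VAny.here refl)))   = member (O ∷ O ∷ I ∷ []) c∈

-- Counting modulo 2

-- A Boolean test that computes along the coordinates, so that it acts as a Kronecker delta under
-- the recursion of `Σ₂`.
eqᵇ : Vect n → Vect n → Bool
eqᵇ []      []      = true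
eqᵇ (b ∷ v) (c ∷ w) = not (b xor c) ∧ eqᵇ v w

eqᵇ-refl : (v : Vect n) → eqᵇ v v ≡ true
eqᵇ-refl []          = refl
eqᵇ-refl (true ∷ v)  = eqᵇ-refl v
eqᵇ-refl (false ∷ v) = eqᵇ-refl v

eqᵇ-sound : (v w : Vect n) → eqᵇ v w ≡ true → v ≡ w
eqᵇ-sound []          []          _ = refl
eqᵇ-sound (true ∷ v)  (true ∷ w)  p = cong (true ∷_) (eqᵇ-sound v w p)
eqᵇ-sound (false ∷ v) (false ∷ w) p = cong (false ∷_) (eqᵇ-sound v w p)

Σ₂-0 : {F : Vect k → Bool} → (∀ v → F v ≡ false) → Σ₂ F ≡ false
Σ₂-0 {zero}  h = h []
Σ₂-0 {suc k} h = cong₂ _xor_ (Σ₂-0 (h ∘ (false ∷_))) (Σ₂-0 (h ∘ (true ∷_)))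

Σ₂-δ : (F : Vect k → Bool) (w : Vect k) → Σ₂ (λ v → F v ∧ eqᵇ v w) ≡ F w
Σ₂-δ F []          = ∧-identityʳ (F [])
Σ₂-δ F (false ∷ w) = trans (cong₂ _xor_ (Σ₂-δ (F ∘ (false ∷_)) w) (Σ₂-0 λ v → ∧-zeroʳ (F (true ∷ v)))) (xor-identityʳ _)
Σ₂-δ F (true ∷ w)  = cong₂ _xor_ (Σ₂-0 λ v → ∧-zeroʳ (F (false ∷ v))) (Σ₂-δ (F ∘ (true ∷_)) w)

Σ₂-swap : (F : Vect n → Vect k → Bool) → Σ₂ (λ v → Σ₂ (F v)) ≡ Σ₂ (λ w → Σ₂ (λ v → F v w))
Σ₂-swap {zero}  F = refl
Σ₂-swap {suc n} F = trans (cong₂ _xor_ (Σ₂-swap (F ∘ (false ∷_))) (Σ₂-swap (F ∘ (true ∷_)))) 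
  (sym (Σ₂-xor (λ w → Σ₂ (λ v → F (false ∷ v) w)) (λ w → Σ₂ (λ v → F (true ∷ v) w))))

odd : ℕ → Bool
odd zero    = false
odd (suc m) = not (odd m)

¬odd⇒2∣ : ∀ m → odd m ≡ false → 2 ∣ m
¬odd⇒2∣ zero          _ = divides 0 refl
¬odd⇒2∣ (suc (suc m)) p with ¬odd⇒2∣ m (trans (sym (not-involutive (odd m))) p)
... | divides d refl = divides (suc d) refl

xor-list : Subset n → List (Vect n) → Bool
xor-list S []       = false
xor-list S (v ∷ vs) = S v xor xor-list S vs

odd-count : (S : Subset n) (vs : List (Vect n)) → odd (length (filter (λ v → S v B.≟ true) vs)) ≡ xor-list S vs
odd-count S []       = refl
odd-count S (v ∷ vs) with S v
... | true  = cong not (odd-count S vs)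
... | false = odd-count S vs

xor-list-pairs : (S : Subset (suc n)) (vs : List (Vect n)) →
  xor-list S (concatMap (λ v → (false ∷ v) ∷ (true ∷ v) ∷ []) vs) ≡ xor-list (λ v → S (false ∷ v) xor S (true ∷ v)) vs
xor-list-pairs S []       = refl
xor-list-pairs S (v ∷ vs) = trans (cong (λ t → S (false ∷ v) xor (S (true ∷ v) xor t)) (xor-list-pairs S vs))
  (sym (xor-assoc (S (false ∷ v)) _ _))

xor-list-all : (S : Subset n) → xor-list S (allVects n) ≡ Σ₂ S
xor-list-all {zero}  S = xor-identityʳ (S [])
xor-list-all {suc n} S = trans (xor-list-pairs S (allVects n)) 
  (trans (xor-list-all (λ v → S (false ∷ v) xor S (true ∷ v))) (Σ₂-xor (S ∘ (false ∷_)) (S ∘ (true ∷_))))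

odd-card : (S : Subset n) → odd ∣ S ∣ ≡ Σ₂ S
odd-card {n} S = trans (odd-count S (allVects n)) (xor-list-all S)

-- Double counting modulo 2: by independence each vector of the plane has unique coordinates, so
-- membership expands into a sum of deltas, and the two sums are exchanged. The vector 0, absent
-- from `P`, contributes nothing because it is not in E.
even⇒evenPlane : (M : Matroid n) → Even (E M) → EvenPlane M
even⇒evenPlane {n} M ev P ((0∉P , _) , bs , indep , spans) = ¬odd⇒2∣ ∣ E M ∩ P ∣ (begin
  odd ∣ E M ∩ P ∣                                              ≡⟨ odd-card (E M ∩ P) ⟩
  Σ₂ (λ v → f v ∧ P v)                                         ≡⟨ Σ₂-cong expand ⟩
  Σ₂ (λ v → Σ₂ (λ (cs : Vect 3) → f v ∧ eqᵇ v (lincomb cs bs))) ≡⟨ Σ₂-swap (λ v (cs : Vect 3) → f v ∧ eqᵇ v (lincomb cs bs)) ⟩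
  Σ₂ (λ (cs : Vect 3) → Σ₂ (λ v → f v ∧ eqᵇ v (lincomb cs bs))) ≡⟨ Σ₂-cong (λ cs → Σ₂-δ f (lincomb cs bs)) ⟩
  Σ₂ (λ (cs : Vect 3) → f (lincomb cs bs))                     ≡⟨ ev bs ⟩
  false                                                        ∎)
  where
  open ≡-Reasoning
  f = E M
  expand : ∀ v → f v ∧ P v ≡ Σ₂ (λ (cs : Vect 3) → f v ∧ eqᵇ v (lincomb cs bs))
  expand v with with0 P v B.≟ true
  ... | yes v∈ = trans (drop (with0-elim P v∈)) (sym (trans (Σ₂-cong unique) (Σ₂-δ (λ _ → f v) cs₀)))
    where
    cs₀ = proj₁ (Equivalence.to (spans v) v∈)
    eq₀ : lincomb cs₀ bs ≡ v
    eq₀ = proj₂ (Equivalence.to (spans v) v∈)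
    drop : v ∈ P ⊎ v ≡ 0v → f v ∧ P v ≡ f v
    drop (inj₁ v∈P) = trans (cong (f v ∧_) v∈P) (∧-identityʳ (f v))
    drop (inj₂ refl) = trans (cong (_∧ P v) (E⊆G M)) (sym (E⊆G M))
    same : ∀ cs → eqᵇ v (lincomb cs bs) ≡ eqᵇ cs cs₀
    same cs with eqᵇ cs cs₀ in e
    ... | true  = trans (cong (λ ds → eqᵇ v (lincomb ds bs)) (eqᵇ-sound cs cs₀ e)) (trans (cong (eqᵇ v) eq₀) (eqᵇ-refl v))
    ... | false = ≢true⇒false λ p → true≢false (trans (cong (λ ds → eqᵇ ds cs₀) (⊕≡0⇒≡ (indep (cs ⊕ cs₀)
        (trans (lincomb-⊕ cs cs₀ bs) (trans (cong₂ _⊕_ (sym (eqᵇ-sound v _ p)) eq₀) (⊕-self v)))))) (eqᵇ-refl cs₀)) e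
    unique : ∀ cs → f v ∧ eqᵇ v (lincomb cs bs) ≡ f v ∧ eqᵇ cs cs₀
    unique cs = cong (f v ∧_) (same cs)
  ... | no v∉ = trans (trans (cong (f v ∧_) (≢true⇒false v∉P)) (∧-zeroʳ (f v))) (sym (Σ₂-0 λ cs →
      trans (cong (f v ∧_) (≢true⇒false λ p → v∉ (Equivalence.from (spans v) (cs , sym (eqᵇ-sound v _ p))))) (∧-zeroʳ (f v))))
    where
    v∉P : ¬ (v ∈ P)
    v∉P v∈P = v∉ (cong (_∨ isZero v) v∈P)

-- The four outcomes

∈Ec⇒∉E : (M : Matroid n) {v : Vect n} → v ∈ Ec M → v ∉ E M
∈Ec⇒∉E M {v} p with E M v
... | false = refl

triFree⇒triangleFreeComplement : (M : Matroid n) → TriFree (E M) full → TriangleFreeComplement M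
triFree⇒triangleFreeComplement M tri T (_ , bs@(p ∷ q ∷ []) , indep , spans) T⊆Ec =
  true≢false (tri p q refl refl p≢0 q≢0 p≢q (zero-at (I ∷ O ∷ []) p≢0) (zero-at (O ∷ I ∷ []) q≢0)) (zero-at (I ∷ I ∷ []) (≢⇒⊕≢0 p≢q))
  where
  indep⨁ : ∀ cs → ⨁ cs bs ≡ 0v → cs ≡ 0v
  indep⨁ cs z = indep cs (trans (sym (⨁≡lincomb cs bs)) z)
  p≢0 : p ≢ 0v
  p≢0 z with () ← indep⨁ (I ∷ O ∷ []) z
  q≢0 : q ≢ 0v
  q≢0 z with () ← indep⨁ (O ∷ I ∷ []) z
  p≢q : p ≢ q
  p≢q refl with () ← indep⨁ (I ∷ I ∷ []) (⊕-self p)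
  zero-at : ∀ cs → ⨁ cs bs ≢ 0v → ⨁ cs bs ∉ E M
  zero-at cs ≢0 = ∈Ec⇒∉E M (T⊆Ec _ ([ (λ v∈T → v∈T) , ⊥-elim ∘ ≢0 ]′
    (with0-elim T (Equivalence.from (spans _) (cs , sym (⨁≡lincomb cs bs))))))

pgCover⇒strictPGSum : (M : Matroid n) {A B : Subset n} → PGCover (E M) A B → StrictPGSum M
pgCover⇒strictPGSum M {A} {B} P = spanning , punctured A , punctured B ,
  flat-punctured A subA , flat-punctured B subB ,
  (let (a , a≢0 , a∈) = a≢0 in a , punctured-intro A a∈ a≢0) ,
  (let (b , b≢0 , b∈) = b≢0 in b , punctured-intro B b∈ b≢0) ,
  (λ v p → let (v∈A , v≢0) = punctured-elim A (proj₁ p) in v≢0 (disj v v∈A (proj₁ (punctured-elim B (proj₂ p))))) ,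
  λ v → mk⇔ (λ v∈ → split v v∈ (covers v)) [ (λ p → onesA v (proj₁ (punctured-elim A p)) (proj₂ (punctured-elim A p)))
                                            , (λ p → onesB v (proj₁ (punctured-elim B p)) (proj₂ (punctured-elim B p))) ]′
  where
  open PGCover P
  split : ∀ v → v ∈ E M → ∃[ a ] (a ∈ A × (a ⊕ v) ∈ B) → v ∈ punctured A ⊎ v ∈ punctured B
  split v v∈ (a , a∈ , b∈) with a ≟ᵛ 0v | (a ⊕ v) ≟ᵛ 0v
  ... | yes refl | _ = inj₂ (punctured-intro B (subst (_∈ B) (⊕-identityˡ v) b∈) λ { refl → true≢false v∈ (E⊆G M) })
  ... | no a≢0 | yes z = inj₁ (subst (_∈ punctured A) (⊕≡0⇒≡ z) (punctured-intro A a∈ a≢0))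
  ... | no a≢0 | no b≢0 = ⊥-elim (true≢false v∈ (trans (cong (E M) (sym (⊕-cancel a v))) (mixed a (a ⊕ v) a∈ b∈ a≢0 b≢0)))
  singleton : ∀ v → (v ≢ 0v → v ∈ E M) → ∃[ xs ] (All (_∈ E M) xs × foldr _⊕_ 0v xs ≡ v)
  singleton v h with v ≟ᵛ 0v
  ... | yes v≡0 = [] , [] , sym v≡0
  ... | no v≢0 = v ∷ [] , h v≢0 ∷ [] , ⊕-identityʳ v
  spanning : Spans (E M)
  spanning v with covers v
  ... | a , a∈ , b∈ with singleton (a ⊕ v) (onesB (a ⊕ v) b∈) | a ≟ᵛ 0v
  ...   | xs , all , eq | no a≢0 = a ∷ xs , onesA a a∈ a≢0 ∷ all , trans (cong (a ⊕_) eq) (⊕-cancel a v)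
  ...   | xs , all , eq | yes refl = xs , all , trans eq (⊕-identityˡ v)

decomposes⇒isDecomposer : (M : Matroid n) {D : Subset n} → Decomposes (E M) full D → IsDecomposer M (punctured D)
decomposes⇒isDecomposer M {D} (sub , _ , (v , v≢0 , v∈) , (w , _ , w∉) , inv) =
  flat-punctured D sub , (v , punctured-intro D v∈ v≢0) ,
  (w , (λ { refl → true≢false (proj₁ sub) w∉ }) , ≢true⇒false λ p → true≢false (proj₁ (punctured-elim D p)) w∉) ,
  λ { x x≢0 x∉ ((y , y∈ , y∈E) , (z , z∈ , z∈Ec)) →
    let x∉D = ≢true⇒false λ x∈ → true≢false (punctured-intro D x∈ x≢0) x∉ in
    true≢false (trans (sym (same x x∉D y y∈)) y∈E) (trans (sym (same x x∉D z z∈)) (∈Ec⇒∉E M z∈Ec)) }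
  where
  same : ∀ x → x ∉ D → ∀ y → y ∈ coset (punctured D) x → E M y ≡ E M x
  same x x∉ y y∈ = trans (cong (E M) (solve 2 (λ x y → y ⊜ x :⊕ y :⊕ x) refl x y))
    (inv x (y ⊕ x) refl x∉ (trans (sym (with0-punctured D (proj₁ sub) (y ⊕ x))) y∈))

-- Deciding the outcomes, and the conclusion

subspace? : (S : Subset n) → Dec (IsSubspace S)
subspace? S = (S 0v B.≟ true) ×-dec all-vect? λ x → all-vect? λ y →
  (S x B.≟ true) →-dec ((S y B.≟ true) →-dec (S (x ⊕ y) B.≟ true))

even? : (f : Subset n) → Dec (Even f)
even? f = map′ (λ { h (p ∷ q ∷ r ∷ []) → h p q r }) (λ h p q r → h (p ∷ q ∷ r ∷ []))
  (all-vect? λ p → all-vect? λ q → all-vect? λ r → Σ₂ (λ (cs : Vect 3) → f (lincomb cs (p ∷ q ∷ r ∷ []))) B.≟ false)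

triFree? : (f : Subset n) → Dec (TriFree f full)
triFree? f = all-vect? λ p → all-vect? λ q → (true B.≟ true) →-dec ((true B.≟ true) →-dec (¬? (p ≟ᵛ 0v) →-dec
  (¬? (q ≟ᵛ 0v) →-dec (¬? (p ≟ᵛ q) →-dec ((f p B.≟ false) →-dec ((f q B.≟ false) →-dec (f (p ⊕ q) B.≟ true)))))))

decomposes? : (f D : Subset n) → Dec (Decomposes f full D)
decomposes? f D = subspace? D ×-dec all-vect? (λ v → (D v B.≟ true) →-dec (true B.≟ true))
  ×-dec any-vect? (λ v → ¬? (v ≟ᵛ 0v) ×-dec (D v B.≟ true)) ×-dec any-vect? (λ v → (true B.≟ true) ×-dec (D v B.≟ false))
  ×-dec all-vect? (λ x → all-vect? λ d → (true B.≟ true) →-dec ((D x B.≟ false) →-dec ((D d B.≟ true) →-dec (f (x ⊕ d) B.≟ f x))))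

decomposable? : (f : Subset n) → Dec (∃[ D ] Decomposes f full D)
decomposable? f = any-subset?
  (λ { eq (sub , _ , (v , v≢0 , v∈) , (w , _ , w∉) , inv) → subspace-resp eq sub , (λ _ _ → refl)
     , (v , v≢0 , trans (sym (eq v)) v∈) , (w , refl , trans (sym (eq w)) w∉)
     , λ x d _ x∉ d∈ → inv x d refl (trans (eq x) x∉) (trans (eq d) d∈) })
  (decomposes? f)

pgCover-resp : {f A B A' B' : Subset n} → (∀ v → A v ≡ A' v) → (∀ v → B v ≡ B' v) → PGCover f A B → PGCover f A' B'
pgCover-resp eqA eqB P = record
  { subA = subspace-resp eqA subA ; subB = subspace-resp eqB subB
  ; a≢0 = let (a , a≢0 , a∈) = a≢0 in a , a≢0 , trans (sym (eqA a)) a∈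
  ; b≢0 = let (b , b≢0 , b∈) = b≢0 in b , b≢0 , trans (sym (eqB b)) b∈
  ; disj = λ v v∈A v∈B → disj v (trans (eqA v) v∈A) (trans (eqB v) v∈B)
  ; onesA = λ a a∈ → onesA a (trans (eqA a) a∈) ; onesB = λ b b∈ → onesB b (trans (eqB b) b∈)
  ; mixed = λ a b a∈ b∈ → mixed a b (trans (eqA a) a∈) (trans (eqB b) b∈)
  ; covers = λ v → let (a , a∈ , b∈) = covers v in a , trans (sym (eqA a)) a∈ , trans (sym (eqB (a ⊕ v))) b∈ }
  where open PGCover P

pgCover? : (f A B : Subset n) → Dec (PGCover f A B)
pgCover? f A B = map′
  (λ { (sA , sB , a , b , d , oA , oB , m , c) → record { subA = sA ; subB = sB ; a≢0 = a ; b≢0 = b ; disj = d ; onesA = oA ; onesB = oB ; mixed = m ; covers = c } })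
  (λ P → let open PGCover P in subA , subB , a≢0 , b≢0 , disj , onesA , onesB , mixed , covers)
  (subspace? A ×-dec subspace? B
  ×-dec any-vect? (λ a → ¬? (a ≟ᵛ 0v) ×-dec (A a B.≟ true)) ×-dec any-vect? (λ b → ¬? (b ≟ᵛ 0v) ×-dec (B b B.≟ true))
  ×-dec all-vect? (λ v → (A v B.≟ true) →-dec ((B v B.≟ true) →-dec (v ≟ᵛ 0v)))
  ×-dec all-vect? (λ a → (A a B.≟ true) →-dec (¬? (a ≟ᵛ 0v) →-dec (f a B.≟ true)))
  ×-dec all-vect? (λ b → (B b B.≟ true) →-dec (¬? (b ≟ᵛ 0v) →-dec (f b B.≟ true)))
  ×-dec all-vect? (λ a → all-vect? λ b → (A a B.≟ true) →-dec ((B b B.≟ true) →-dec (¬? (a ≟ᵛ 0v) →-dec (¬? (b ≟ᵛ 0v) →-dec (f (a ⊕ b) B.≟ false)))))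
  ×-dec all-vect? (λ v → ⊞? A B v))

pgCoverable? : (f : Subset n) → Dec (∃[ A ] ∃[ B ] PGCover f A B)
pgCoverable? f = any-subset? (λ { eq (B , P) → B , pgCover-resp eq (λ _ → refl) P })
  λ A → any-subset? (λ eq → pgCover-resp (λ _ → refl) eq) (pgCover? f A)

-- Each outcome, in its subspace form, is decidable by finite search, so it suffices to refute that
-- all four fail. Dimension at least two provides the two distinct nonzero vectors that
-- `constant-off` uses when `f` is constant off 0.
clawFree⇒outcome : (M : Matroid (suc (suc n))) → ClawFree M → Outcome M
clawFree⇒outcome M cf = decide (even? (E M)) (triFree? (E M)) (pgCoverable? (E M)) (decomposable? (E M))
  where
  decide : Dec (Even (E M)) → Dec (TriFree (E M) full) → Dec (∃[ A ] ∃[ B ] PGCover (E M) A B) →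
    Dec (∃[ D ] Decomposes (E M) full D) → Outcome M
  decide (yes ev) _ _ _ = inj₁ (even⇒evenPlane M ev)
  decide _ (yes tri) _ _ = inj₂ (inj₁ (triFree⇒triangleFreeComplement M tri))
  decide _ _ (yes (A , B , P)) _ = inj₂ (inj₂ (inj₁ (pgCover⇒strictPGSum M P)))
  decide _ _ _ (yes (D , d)) = inj₂ (inj₂ (inj₂ (punctured D , decomposes⇒isDecomposer M d)))
  decide (no ¬even) (no ¬tri) (no ¬pg) (no ¬dec) = ⊥-elim
    (NoAntiClaw.contradiction (E⊆G M) noClaw ind noAntiClaw {true ∷ 0v} {false ∷ true ∷ 0v} (λ ()) (λ ()) (λ ()))
    where
    noClaw : NoClaw (E M)
    noClaw = clawFree⇒noClaw M cf
    ind : Indecomposable (E M) full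
    ind D d = ¬dec (D , d)
    noBiTriangle : ∀ {a₁ a₂ b₁ b₂} → ¬ BiTriangle (E M) a₁ a₂ b₁ b₂
    noBiTriangle = BiTriangleCase.bi-triangle-contradiction (E⊆G M) noClaw ind ¬even λ A B P → ¬pg (A , B , P)
    noAntiClaw : ∀ {a b c} → ¬ AntiClaw (E M) a b c
    noAntiClaw K = TriangleFreeCase.no-bitriangle-contradiction (E⊆G M) noClaw noBiTriangle K ind ¬tri

theorem5p2 : (∀ (n : ℕ) → n ≤ 8 → (M : Matroid n) → ClawFree M → Outcome M)
    → ∀ (n : ℕ) (M : Matroid n) → ClawFree M → Outcome M
theorem5p2 small zero          M = small 0 z≤n M
theorem5p2 small (suc zero)    M = small 1 (s≤s z≤n) M
theorem5p2 small (suc (suc n)) M = clawFree⇒outcome M
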